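{- Let $r\ge2$ and $2\le s\le r$ be integers. There exist $\delta_0>0$ and $n_0$ such that for all $n\ge n_0$ and $0<\delta\le\delta_0$ the following holds: if $G$ is a graph on $n$ vertices containing no copy of $K_{r+1}$ and $k_s(G)\ge\binom rs\left(\frac nr\right)^s-\delta n^s$, then $$D_r(G)\le\left(\frac{2r}{3\sqrt3}+o_\delta(1)\right)\frac{\binom r2^{3/2}}{\binom rs^{3/s}}\,\delta^{3/s}n^2,$$ where $o_\delta(1)$ denotes a term (depending only on $r,s,\delta$) that tends to $0$ as $\delta\to0$.
   Context: $K_{m}$ is the complete graph on $m$ vertices; $k_s(G)$ is the number of copies of $K_s$ in $G$. $D_r(G)$ is the minimum number of edges that must be removed from $G$ to make it $r$-partite (i.e. $r$-colorable). -}

module Defs where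

open import Algebra.Bundles using (CommutativeRing; Semiring)
open import Data.Empty using (⊥-elim)
open import Data.Fin.Base as Fin using (Fin; finToFun; funToFin)
import Data.Fin.Properties as Fin
open import Data.Integer.Base as ℤ using (+_; -[1+_])
import Data.Integer.Properties as ℤ
import Data.Integer.Solver as ℤ
open import Data.List.Base using (List; []; _∷_; [_]; map; _++_; filter; length; allFin; cartesianProduct)
open import Data.List.Extrema.Nat using (min)
open import Data.List.Relation.Unary.AllPairs using (AllPairs; allPairs?)
open import Data.Nat.Base as ℕ using (ℕ; zero; suc)
import Data.Nat.Properties as ℕ
open import Data.Product using (Σ-syntax; ∃-syntax; _×_; _,_; proj₁; proj₂)
open import Data.Product.Properties using (≡-dec)
open import Data.Rational.Base as ℚ using (ℚ; mkℚ; 0ℚ; 1ℚ; ½; _/_; _≤_; _<_; _+_; _*_; _-_; -_; ∣_∣)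
import Data.Rational.Properties as ℚ
open import Data.Rational.Solver using (module +-*-Solver)
open import Data.Rational.Unnormalised.Base as ℚᵘ using (mkℚᵘ)
import Data.Rational.Unnormalised.Properties as ℚᵘ
open import Data.Sum.Base using (_⊎_; inj₁; inj₂)
open import Level using (0ℓ)
open import Relation.Binary.Core using (Rel)
open import Relation.Binary.Definitions using (Decidable; Symmetric; Irreflexive)
open import Relation.Binary.PropositionalEquality
  using (_≡_; _≢_; refl; sym; trans; cong; cong₂; subst; subst₂)
open import Relation.Nullary using (Dec; yes; no; ¬_)
open import Relation.Nullary.Decidable using (map′; _×-dec_; _→-dec_; ¬?)
open import Algebra.Definitions.RawSemiring
  (Semiring.rawSemiring (CommutativeRing.semiring ℚ.+-*-commutativeRing)) using () renaming (_^_ to _^ℚ_)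
import Data.List.Membership.DecPropositional as DecMembership

-- The standard library has no real numbers.  They are constructed here as
-- Cauchy sequences of rationals carrying a modulus of convergence.

record ℝ : Set where
  constructor mkℝ
  field
    seq    : ℕ → ℚ
    cauchy : ∀ ε → 0ℚ ℚ.< ε →
             ∃[ N ] (∀ m n → N ℕ.≤ m → N ℕ.≤ n → ℚ.∣ seq m ℚ.- seq n ∣ ℚ.≤ ε)

open ℝ public

infix 4 _≤ᴿ_ _<ᴿ_ _≈ᴿ_

_≤ᴿ_ : Rel ℝ 0ℓ
x ≤ᴿ y = ∀ ε → 0ℚ ℚ.< ε → ∃[ N ] (∀ n → N ℕ.≤ n → seq x n ℚ.≤ seq y n ℚ.+ ε)

_<ᴿ_ : Rel ℝ 0ℓ
x <ᴿ y = ∃[ ε ] 0ℚ ℚ.< ε × ∃[ N ] (∀ n → N ℕ.≤ n → seq x n ℚ.+ ε ℚ.≤ seq y n)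

_≈ᴿ_ : Rel ℝ 0ℓ
x ≈ᴿ y = x ≤ᴿ y × y ≤ᴿ x

open +-*-Solver
open ℚ.≤-Reasoning

module RationalLemmas where
  p≤∣p∣ : ∀ p → p ≤ ∣ p ∣
  p≤∣p∣ p with ℚ.≤-total 0ℚ p
  ... | inj₁ 0≤p = ℚ.≤-reflexive (sym (ℚ.0≤p⇒∣p∣≡p 0≤p))
  ... | inj₂ p≤0 = ℚ.≤-trans p≤0 (ℚ.0≤∣p∣ p)

  ∣p∣≤⁺ : ∀ {p ε} → p ≤ ε → - p ≤ ε → ∣ p ∣ ≤ ε
  ∣p∣≤⁺ {p} {ε} a b with ℚ.∣p∣≡p∨∣p∣≡-p p
  ... | inj₁ e = subst (_≤ ε) (sym e) a
  ... | inj₂ e = subst (_≤ ε) (sym e) b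

  shift : ∀ {a b ε} → a ≤ b + ε → a - b ≤ ε
  shift {a} {b} {ε} h = begin
    a - b        ≤⟨ ℚ.+-monoˡ-≤ (- b) h ⟩
    b + ε - b    ≡⟨ solve 2 (λ b ε → b :+ ε :- b := ε) refl b ε ⟩
    ε            ∎

  unshift : ∀ {a b ε} → a - b ≤ ε → a ≤ b + ε
  unshift {a} {b} {ε} h = begin
    a            ≡⟨ solve 2 (λ a b → a := b :+ (a :- b)) refl a b ⟩
    b + (a - b)  ≤⟨ ℚ.+-monoʳ-≤ b h ⟩
    b + ε        ∎

  dist-comm : ∀ a b → ∣ a - b ∣ ≡ ∣ b - a ∣
  dist-comm a b = trans (cong ∣_∣ (solve 2 (λ a b → a :- b := :- (b :- a)) refl a b)) (ℚ.∣-p∣≡∣p∣ (b - a))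

  close⁺ : ∀ {a b ε} → a ≤ b + ε → b ≤ a + ε → ∣ a - b ∣ ≤ ε
  close⁺ {a} {b} {ε} h k = ∣p∣≤⁺ (shift h)
    (subst (_≤ ε) (solve 2 (λ a b → b :- a := :- (a :- b)) refl a b) (shift k))

  close⁻ : ∀ {a b ε} → ∣ a - b ∣ ≤ ε → a ≤ b + ε
  close⁻ {a} {b} h = unshift (ℚ.≤-trans (p≤∣p∣ (a - b)) h)

  half-pos : ∀ {ε} → 0ℚ < ε → 0ℚ < ½ * ε
  half-pos {ε} p = begin-strict
    0ℚ      ≡⟨ ℚ.*-zeroʳ ½ ⟨
    ½ * 0ℚ  <⟨ ℚ.*-monoʳ-<-pos ½ p ⟩
    ½ * ε   ∎

  halves : ∀ ε → ½ * ε + ½ * ε ≡ ε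
  halves = solve 1 (λ ε → con ½ :* ε :+ con ½ :* ε := ε) refl

  -- 1/(n+1)
  unit : ℕ → ℚ
  unit n = + 1 / suc n

open RationalLemmas

fromℚ : ℚ → ℝ
fromℚ q = mkℝ (λ _ → q) (λ ε 0<ε → 0 , λ _ _ _ _ → begin
  ∣ q - q ∣  ≡⟨ cong ∣_∣ (ℚ.+-inverseʳ q) ⟩
  0ℚ         ≤⟨ ℚ.<⇒≤ 0<ε ⟩
  ε          ∎)

fromℕ : ℕ → ℝ
fromℕ n = fromℚ (+ n / 1)

0ᴿ 1ᴿ : ℝ
0ᴿ = fromℕ 0
1ᴿ = fromℕ 1

-- The quotient m/n, with the convention m/0 = 0.
frac : ℕ → ℕ → ℝ
frac m zero    = 0ᴿ
frac m (suc n) = fromℚ (+ m / suc n)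

infixl 6 _+ᴿ_ _-ᴿ_
infixl 7 _*ᴿ_
infixr 8 _^ᴿ_ _^ᴿ[_/_]
infix  8 -ᴿ_

_+ᴿ_ : ℝ → ℝ → ℝ
x +ᴿ y = mkℝ (λ n → seq x n + seq y n) λ ε 0<ε →
  let Nx , hx = cauchy x (½ * ε) (half-pos 0<ε)
      Ny , hy = cauchy y (½ * ε) (half-pos 0<ε)
  in Nx ℕ.⊔ Ny , λ m n p q → begin
    ∣ seq x m + seq y m - (seq x n + seq y n) ∣
      ≡⟨ cong ∣_∣ (solve 4 (λ a b c d → a :+ b :- (c :+ d) := (a :- c) :+ (b :- d)) refl
                     (seq x m) (seq y m) (seq x n) (seq y n)) ⟩
    ∣ (seq x m - seq x n) + (seq y m - seq y n) ∣
      ≤⟨ ℚ.∣p+q∣≤∣p∣+∣q∣ (seq x m - seq x n) (seq y m - seq y n) ⟩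
    ∣ seq x m - seq x n ∣ + ∣ seq y m - seq y n ∣
      ≤⟨ ℚ.+-mono-≤ (hx m n (ℕ.m⊔n≤o⇒m≤o Nx Ny p) (ℕ.m⊔n≤o⇒m≤o Nx Ny q))
                    (hy m n (ℕ.m⊔n≤o⇒n≤o Nx Ny p) (ℕ.m⊔n≤o⇒n≤o Nx Ny q)) ⟩
    ½ * ε + ½ * ε ≡⟨ halves ε ⟩
    ε ∎

-ᴿ_ : ℝ → ℝ
-ᴿ x = mkℝ (λ n → - seq x n) λ ε 0<ε →
  let N , h = cauchy x ε 0<ε
  in N , λ m n p q → subst (_≤ ε)
    (cong ∣_∣ (solve 2 (λ a b → a :- b := (:- b) :- (:- a)) refl (seq x n) (seq x m)))
    (h n m q p)

_-ᴿ_ : ℝ → ℝ → ℝ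
x -ᴿ y = x +ᴿ -ᴿ y

∣_∣ᴿ : ℝ → ℝ
∣ x ∣ᴿ = mkℝ (λ n → ∣ seq x n ∣) λ ε 0<ε →
  let N , h = cauchy x ε 0<ε
  in N , λ m n p q → close⁺
       (tri (seq x m) (seq x n) (h m n p q)) (tri (seq x n) (seq x m) (h n m q p))
  where
  tri : ∀ a b {ε} → ∣ a - b ∣ ≤ ε → ∣ a ∣ ≤ ∣ b ∣ + ε
  tri a b {ε} h = begin
    ∣ a ∣              ≡⟨ cong ∣_∣ (solve 2 (λ a b → a := b :+ (a :- b)) refl a b) ⟩
    ∣ b + (a - b) ∣    ≤⟨ ℚ.∣p+q∣≤∣p∣+∣q∣ b (a - b) ⟩
    ∣ b ∣ + ∣ a - b ∣  ≤⟨ ℚ.+-monoʳ-≤ ∣ b ∣ h ⟩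
    ∣ b ∣ + ε          ∎

module MultiplicationLemmas where
  bounded : ∀ x → ∃[ K ] 1ℚ ≤ K × ∃[ N ] (∀ n → N ℕ.≤ n → ∣ seq x n ∣ ≤ K)
  bounded x =
    let N , h = cauchy x 1ℚ (ℚ.positive⁻¹ 1ℚ)
    in ∣ seq x N ∣ + 1ℚ
     , (begin 1ℚ ≡⟨ ℚ.+-identityˡ 1ℚ ⟨ 0ℚ + 1ℚ ≤⟨ ℚ.+-monoˡ-≤ 1ℚ (ℚ.0≤∣p∣ (seq x N)) ⟩ ∣ seq x N ∣ + 1ℚ ∎)
     , N , λ n p → begin
       ∣ seq x n ∣
         ≡⟨ cong ∣_∣ (solve 2 (λ a b → a := b :+ (a :- b)) refl (seq x n) (seq x N)) ⟩
       ∣ seq x N + (seq x n - seq x N) ∣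
         ≤⟨ ℚ.∣p+q∣≤∣p∣+∣q∣ (seq x N) (seq x n - seq x N) ⟩
       ∣ seq x N ∣ + ∣ seq x n - seq x N ∣
         ≤⟨ ℚ.+-monoʳ-≤ ∣ seq x N ∣ (h n N p ℕ.≤-refl) ⟩
       ∣ seq x N ∣ + 1ℚ ∎

  *-mono-≤⁺ : ∀ {a b c d} → 0ℚ ≤ a → 0ℚ ≤ d → a ≤ b → c ≤ d → a * c ≤ b * d
  *-mono-≤⁺ {a} {b} {c} {d} 0≤a 0≤d a≤b c≤d = begin
    a * c ≤⟨ ℚ.*-monoˡ-≤-nonNeg a {{ℚ.nonNegative 0≤a}} c≤d ⟩
    a * d ≤⟨ ℚ.*-monoʳ-≤-nonNeg d {{ℚ.nonNegative 0≤d}} a≤b ⟩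
    b * d ∎

  pos*pos : ∀ {a b} → 0ℚ < a → 0ℚ < b → 0ℚ < a * b
  pos*pos {a} {b} p q = ℚ.positive⁻¹ (a * b)
    {{ℚ.pos*pos⇒pos a {{ℚ.positive p}} b {{ℚ.positive q}}}}

  -- An error small enough to survive multiplication by 2K.
  shrink : ∀ K ε → 0ℚ < K → 0ℚ < ε → ∃[ η ] 0ℚ < η × K * η + η * K ≡ ε
  shrink K ε 0<K 0<ε = ½ * ε * K⁻¹
    , pos*pos (half-pos 0<ε) (ℚ.positive⁻¹ K⁻¹ {{ℚ.1/pos⇒pos K}})
    , (begin-equality
        K * (½ * ε * K⁻¹) + ½ * ε * K⁻¹ * K
          ≡⟨ solve 3 (λ k e i → k :* (con ½ :* e :* i) :+ con ½ :* e :* i :* k := e :* (k :* i)) refl K ε K⁻¹ ⟩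
        ε * (K * K⁻¹) ≡⟨ cong (ε *_) (ℚ.*-inverseʳ K) ⟩
        ε * 1ℚ        ≡⟨ ℚ.*-identityʳ ε ⟩
        ε             ∎)
    where
    instance
      K-pos : ℚ.Positive K
      K-pos = ℚ.positive 0<K
      K-nonZero : ℚ.NonZero K
      K-nonZero = ℚ.pos⇒nonZero K
    K⁻¹ = ℚ.1/ K

  product-close : ∀ {a b c d K η ε} → 0ℚ ≤ K → 0ℚ ≤ η → K * η + η * K ≡ ε →
                  ∣ a ∣ ≤ K → ∣ d ∣ ≤ K → ∣ a - c ∣ ≤ η → ∣ b - d ∣ ≤ η →
                  ∣ a * b - c * d ∣ ≤ ε
  product-close {a} {b} {c} {d} {K} {η} {ε} 0≤K 0≤η Kη a≤K d≤K ac bd = begin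
    ∣ a * b - c * d ∣
      ≡⟨ cong ∣_∣ (solve 4 (λ a b c d → a :* b :- c :* d := a :* (b :- d) :+ (a :- c) :* d) refl a b c d) ⟩
    ∣ a * (b - d) + (a - c) * d ∣
      ≤⟨ ℚ.∣p+q∣≤∣p∣+∣q∣ (a * (b - d)) ((a - c) * d) ⟩
    ∣ a * (b - d) ∣ + ∣ (a - c) * d ∣
      ≡⟨ cong₂ _+_ (ℚ.∣p*q∣≡∣p∣*∣q∣ a (b - d)) (ℚ.∣p*q∣≡∣p∣*∣q∣ (a - c) d) ⟩
    ∣ a ∣ * ∣ b - d ∣ + ∣ a - c ∣ * ∣ d ∣
      ≤⟨ ℚ.+-mono-≤ (*-mono-≤⁺ (ℚ.0≤∣p∣ a) 0≤η a≤K bd) (*-mono-≤⁺ (ℚ.0≤∣p∣ (a - c)) 0≤K ac d≤K) ⟩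
    K * η + η * K ≡⟨ Kη ⟩
    ε ∎

  1≤⇒0≤ : ∀ {p} → 1ℚ ≤ p → 0ℚ ≤ p
  1≤⇒0≤ = ℚ.≤-trans (ℚ.<⇒≤ (ℚ.positive⁻¹ 1ℚ))

  p≤p+q : ∀ {p q} → 0ℚ ≤ q → p ≤ p + q
  p≤p+q {p} {q} 0≤q = subst (_≤ p + q) (ℚ.+-identityʳ p) (ℚ.+-monoʳ-≤ p 0≤q)

  q≤p+q : ∀ {p q} → 0ℚ ≤ p → q ≤ p + q
  q≤p+q {p} {q} 0≤p = subst (_≤ p + q) (ℚ.+-identityˡ q) (ℚ.+-monoˡ-≤ q 0≤p)

  Bound : ℝ → ℚ → Set
  Bound x K = ∃[ N ] (∀ n → N ℕ.≤ n → ∣ seq x n ∣ ≤ K)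

  Modulus : (ℕ → ℚ) → ℚ → Set
  Modulus u ε = ∃[ N ] (∀ m n → N ℕ.≤ m → N ℕ.≤ n → ∣ u m - u n ∣ ≤ ε)

  *-modulus : ∀ x y {K η ε} → 0ℚ ≤ K → 0ℚ ≤ η → K * η + η * K ≡ ε →
              Bound x K → Bound y K → Modulus (seq x) η → Modulus (seq y) η →
              Modulus (λ n → seq x n * seq y n) ε
  *-modulus x y {K} {η} {ε} 0≤K 0≤η Kη (Mx , bx) (My , by) (Nx , hx) (Ny , hy) =
    (Mx ℕ.⊔ My) ℕ.⊔ (Nx ℕ.⊔ Ny) , close
    where
    close : ∀ m n → (Mx ℕ.⊔ My) ℕ.⊔ (Nx ℕ.⊔ Ny) ℕ.≤ m → (Mx ℕ.⊔ My) ℕ.⊔ (Nx ℕ.⊔ Ny) ℕ.≤ n →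
            ∣ seq x m * seq y m - seq x n * seq y n ∣ ≤ ε
    close m n p q = product-close {seq x m} {seq y m} {seq x n} {seq y n} 0≤K 0≤η Kη
      (bx m (ℕ.m⊔n≤o⇒m≤o Mx My p₁))
      (by n (ℕ.m⊔n≤o⇒n≤o Mx My q₁))
      (hx m n (ℕ.m⊔n≤o⇒m≤o Nx Ny p₂) (ℕ.m⊔n≤o⇒m≤o Nx Ny q₂))
      (hy m n (ℕ.m⊔n≤o⇒n≤o Nx Ny p₂) (ℕ.m⊔n≤o⇒n≤o Nx Ny q₂))
      where
      p₁ = ℕ.m⊔n≤o⇒m≤o (Mx ℕ.⊔ My) (Nx ℕ.⊔ Ny) p
      p₂ = ℕ.m⊔n≤o⇒n≤o (Mx ℕ.⊔ My) (Nx ℕ.⊔ Ny) p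
      q₁ = ℕ.m⊔n≤o⇒m≤o (Mx ℕ.⊔ My) (Nx ℕ.⊔ Ny) q
      q₂ = ℕ.m⊔n≤o⇒n≤o (Mx ℕ.⊔ My) (Nx ℕ.⊔ Ny) q

  *-cauchy : ∀ x y ε → 0ℚ < ε → Modulus (λ n → seq x n * seq y n) ε
  *-cauchy x y ε 0<ε = combine (bounded x) (bounded y)
    where
    rescale : ∀ {K} → 0ℚ ≤ K → Bound x K → Bound y K → (∃[ η ] 0ℚ < η × K * η + η * K ≡ ε) →
              Modulus (λ n → seq x n * seq y n) ε
    rescale 0≤K bx by (η , 0<η , Kη) =
      *-modulus x y 0≤K (ℚ.<⇒≤ 0<η) Kη bx by (cauchy x η 0<η) (cauchy y η 0<η)

    combine : (∃[ K ] 1ℚ ≤ K × Bound x K) → (∃[ K ] 1ℚ ≤ K × Bound y K) →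
              Modulus (λ n → seq x n * seq y n) ε
    combine (Kx , 1≤Kx , Mx , bx) (Ky , 1≤Ky , My , by) = rescale (1≤⇒0≤ 1≤K)
      (Mx , λ n p → ℚ.≤-trans (bx n p) (p≤p+q (1≤⇒0≤ 1≤Ky)))
      (My , λ n p → ℚ.≤-trans (by n p) (q≤p+q (1≤⇒0≤ 1≤Kx)))
      (shrink (Kx + Ky) ε (ℚ.<-≤-trans (ℚ.positive⁻¹ 1ℚ) 1≤K) 0<ε)
      where
      1≤K : 1ℚ ≤ Kx + Ky
      1≤K = ℚ.≤-trans 1≤Kx (p≤p+q (1≤⇒0≤ 1≤Ky))

open MultiplicationLemmas

_*ᴿ_ : ℝ → ℝ → ℝ
x *ᴿ y = mkℝ (λ n → seq x n * seq y n) (*-cauchy x y)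

_^ᴿ_ : ℝ → ℕ → ℝ
x ^ᴿ zero  = 1ᴿ
x ^ᴿ suc n = x *ᴿ x ^ᴿ n

-- The largest i ≤ j satisfying P, or 0 if there is none.
largest : {P : ℕ → Set} → (∀ i → Dec (P i)) → ℕ → ℕ
largest P? zero    = zero
largest P? (suc j) with P? (suc j)
... | yes _ = suc j
... | no  _ = largest P? j

-- startBound q n / (n+1) exceeds q and is at least 1, so it exceeds every
-- k-th root of q with k ≥ 1.
startBound : ℚ → ℕ → ℕ
startBound q n = suc n ℕ.* suc ℤ.∣ ℚ.↥ q ∣

-- The k-th root of q, rounded down to a multiple of 1/(n+1).
rootApprox : (k : ℕ) (q : ℚ) (n : ℕ) → ℚ
rootApprox k q n =
  + largest (λ i → (+ i / suc n) ^ℚ k ℚ.≤? q) (startBound q n) / suc n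

module RootLemmas where
  toℚᵘ-/ : ∀ i n → ℚ.toℚᵘ (+ i / suc n) ℚᵘ.≃ mkℚᵘ (+ i) n
  toℚᵘ-/ i n = ℚ.toℚᵘ-fromℚᵘ (mkℚᵘ (+ i) n)

  /-mono : ∀ {i j} n → i ℕ.≤ j → + i / suc n ≤ + j / suc n
  /-mono {i} {j} n i≤j = ℚ.toℚᵘ-cancel-≤
    (ℚᵘ.≤-respˡ-≃ (ℚᵘ.≃-sym (toℚᵘ-/ i n)) (ℚᵘ.≤-respʳ-≃ (ℚᵘ.≃-sym (toℚᵘ-/ j n))
      (ℚᵘ.*≤* (ℤ.*-monoʳ-≤-nonNeg (+ suc n) (ℤ.+≤+ i≤j)))))

  /-suc : ∀ i n → + suc i / suc n ≡ + i / suc n + unit n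
  /-suc i n = ℚ.toℚᵘ-injective (begin′
    ℚ.toℚᵘ (+ suc i / suc n)                        ≈⟨ toℚᵘ-/ (suc i) n ⟩
    mkℚᵘ (+ suc i) n                                ≈⟨ ℚᵘ.*≡* lemma ⟩
    mkℚᵘ (+ i) n ℚᵘ.+ mkℚᵘ (+ 1) n                  ≈⟨ ℚᵘ.+-cong (toℚᵘ-/ i n) (toℚᵘ-/ 1 n) ⟨
    ℚ.toℚᵘ (+ i / suc n) ℚᵘ.+ ℚ.toℚᵘ (unit n)       ≈⟨ ℚ.toℚᵘ-homo-+ (+ i / suc n) (unit n) ⟨
    ℚ.toℚᵘ (+ i / suc n + unit n)                   ∎′)
    where
    open import Relation.Binary.Reasoning.Setoid ℚᵘ.≃-setoid renaming (begin_ to begin′_; _∎ to _∎′)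
    D = + suc n
    lemma : + suc i ℤ.* (D ℤ.* D) ≡ (+ i ℤ.* D ℤ.+ + 1 ℤ.* D) ℤ.* D
    lemma = trans (cong (ℤ._* (D ℤ.* D)) (ℤ.pos-+ 1 i))
      (ℤ.+-*-Solver.solve 2 (λ i d → (con′ (+ 1) :+′ i) :*′ (d :*′ d) :=′ (i :*′ d :+′ con′ (+ 1) :*′ d) :*′ d) refl (+ i) D)
      where open ℤ.+-*-Solver renaming (con to con′; _:+_ to _:+′_; _:*_ to _:*′_; _:=_ to _:=′_) using ()

  0/n : ∀ n → + 0 / suc n ≡ 0ℚ
  0/n n = ℚ.toℚᵘ-injective (ℚᵘ.≃-trans (toℚᵘ-/ 0 n) (ℚᵘ.*≡* refl))

  0≤/ : ∀ i n → 0ℚ ≤ + i / suc n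
  0≤/ i n = subst (_≤ + i / suc n) (0/n n) (/-mono {0} {i} n ℕ.z≤n)

  ^-nonNeg : ∀ {a} k → 0ℚ ≤ a → 0ℚ ≤ a ^ℚ k
  ^-nonNeg zero    _ = ℚ.<⇒≤ (ℚ.positive⁻¹ 1ℚ)
  ^-nonNeg {a} (suc k) p = begin
    0ℚ             ≡⟨ ℚ.*-zeroʳ a ⟨
    a * 0ℚ         ≤⟨ ℚ.*-monoˡ-≤-nonNeg a {{ℚ.nonNegative p}} (^-nonNeg k p) ⟩
    a * (a ^ℚ k)   ∎

  ^-pos : ∀ {a} k → 0ℚ < a → 0ℚ < a ^ℚ k
  ^-pos zero    _ = ℚ.positive⁻¹ 1ℚ
  ^-pos (suc k) p = pos*pos p (^-pos k p)

  ^-mono : ∀ {a b} k → 0ℚ ≤ a → a ≤ b → a ^ℚ k ≤ b ^ℚ k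
  ^-mono zero    _ _ = ℚ.≤-refl
  ^-mono (suc k) p q = *-mono-≤⁺ p (^-nonNeg k (ℚ.≤-trans p q)) q (^-mono k p q)

  ^-cancel-< : ∀ {a b} k → 0ℚ ≤ b → a ^ℚ k < b ^ℚ k → a < b
  ^-cancel-< k 0≤b h = ℚ.≰⇒> (λ b≤a → ℚ.<-irrefl refl (ℚ.<-≤-trans h (^-mono k 0≤b b≤a)))

  ^-superadd : ∀ {a b} k → 0ℚ ≤ a → 0ℚ ≤ b → a ^ℚ suc k + b ^ℚ suc k ≤ (a + b) ^ℚ suc k
  ^-superadd {a} {b} zero    _ _ = ℚ.≤-reflexive (sym (ℚ.*-distribʳ-+ 1ℚ a b))
  ^-superadd {a} {b} (suc k) p q = begin
    a * a ^ℚ suc k + b * b ^ℚ suc k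
      ≤⟨ ℚ.+-mono-≤ (ℚ.*-monoʳ-≤-nonNeg (a ^ℚ suc k) {{ℚ.nonNegative (^-nonNeg (suc k) p)}} a≤)
                    (ℚ.*-monoʳ-≤-nonNeg (b ^ℚ suc k) {{ℚ.nonNegative (^-nonNeg (suc k) q)}} b≤) ⟩
    (a + b) * a ^ℚ suc k + (a + b) * b ^ℚ suc k
      ≡⟨ ℚ.*-distribˡ-+ (a + b) (a ^ℚ suc k) (b ^ℚ suc k) ⟨
    (a + b) * (a ^ℚ suc k + b ^ℚ suc k)
      ≤⟨ ℚ.*-monoˡ-≤-nonNeg (a + b) {{ℚ.nonNegative (ℚ.≤-trans p a≤)}} (^-superadd k p q) ⟩
    (a + b) * (a + b) ^ℚ suc k ∎
    where
    a≤ : a ≤ a + b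
    a≤ = begin a ≡⟨ ℚ.+-identityʳ a ⟨ a + 0ℚ ≤⟨ ℚ.+-monoʳ-≤ a q ⟩ a + b ∎
    b≤ : b ≤ a + b
    b≤ = begin b ≡⟨ ℚ.+-identityˡ b ⟨ 0ℚ + b ≤⟨ ℚ.+-monoˡ-≤ b p ⟩ a + b ∎

  1≤^ : ∀ {a} k → 1ℚ ≤ a → 1ℚ ≤ a ^ℚ k
  1≤^ zero    _ = ℚ.≤-refl
  1≤^ (suc k) p = *-mono-≤⁺ 0≤1 (^-nonNeg k (ℚ.≤-trans 0≤1 p)) p (1≤^ k p)
    where 0≤1 = ℚ.<⇒≤ (ℚ.positive⁻¹ 1ℚ)

  a≤^ : ∀ {a} k → 1ℚ ≤ a → a ≤ a ^ℚ suc k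
  a≤^ {a} k p = begin
    a            ≡⟨ ℚ.*-identityʳ a ⟨
    a * 1ℚ       ≤⟨ ℚ.*-monoˡ-≤-nonNeg a {{ℚ.nonNegative (ℚ.≤-trans (ℚ.<⇒≤ (ℚ.positive⁻¹ 1ℚ)) p)}} (1≤^ k p) ⟩
    a * a ^ℚ k   ∎

  start≥1 : ∀ q n → 1ℚ ≤ + startBound q n / suc n
  start≥1 q n = ℚ.toℚᵘ-cancel-≤ (ℚᵘ.≤-respʳ-≃ (ℚᵘ.≃-sym (toℚᵘ-/ (startBound q n) n))
    (ℚᵘ.*≤* (subst₂ ℤ._≤_ (sym (ℤ.*-identityˡ (+ suc n))) (sym (ℤ.*-identityʳ (+ startBound q n)))
      (ℤ.+≤+ (ℕ.m≤m*n (suc n) (suc ℤ.∣ ℚ.↥ q ∣))))))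

  start> : ∀ q n → q < + startBound q n / suc n
  start> q@(mkℚ a d c) n = ℚ.toℚᵘ-cancel-< (ℚᵘ.<-respʳ-≃ (ℚᵘ.≃-sym (toℚᵘ-/ (startBound q n) n)) (ℚᵘ.*<* (lemma a)))
    where
    lemma : ∀ a → a ℤ.* + suc n ℤ.< + (suc n ℕ.* suc ℤ.∣ a ∣) ℤ.* + suc d
    lemma (+ a)    = subst₂ ℤ._<_ (ℤ.pos-* a (suc n)) (ℤ.pos-* (suc n ℕ.* suc a) (suc d))
      (ℤ.+<+ (ℕ.<-≤-trans
        (subst (ℕ._< suc n ℕ.* suc a) (ℕ.*-comm (suc n) a) (ℕ.*-monoʳ-< (suc n) (ℕ.n<1+n a)))
        (ℕ.m≤m*n (suc n ℕ.* suc a) (suc d))))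
    lemma -[1+ a ] = ℤ.-<+

  Below : ℕ → ℚ → ℕ → ℕ → Set
  Below k q n i = (+ i / suc n) ^ℚ k ≤ q

  below? : ∀ k q n i → Dec (Below k q n i)
  below? k q n i = (+ i / suc n) ^ℚ k ℚ.≤? q

  largest-lower : ∀ {P : ℕ → Set} (P? : ∀ i → Dec (P i)) j → P (largest P? j) ⊎ largest P? j ≡ 0
  largest-lower P? zero    = inj₂ refl
  largest-lower P? (suc j) with P? (suc j)
  ... | yes p = inj₁ p
  ... | no  _ = largest-lower P? j

  largest-upper : ∀ {P : ℕ → Set} (P? : ∀ i → Dec (P i)) j → ¬ P (suc j) → ¬ P (suc (largest P? j))
  largest-upper P? zero    h = h
  largest-upper P? (suc j) h with P? (suc j)
  ... | yes _ = h
  ... | no ¬p = largest-upper P? j ¬p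

  start-^ : ∀ k q n → q < (+ suc (startBound q n) / suc n) ^ℚ suc k
  start-^ k q n = ℚ.<-≤-trans (start> q n)
    (ℚ.≤-trans (a≤^ k (start≥1 q n))
      (^-mono (suc k) (0≤/ (startBound q n) n) (/-mono n (ℕ.n≤1+n (startBound q n)))))

  lower : ∀ k q n i → Below k q n i ⊎ i ≡ 0 → (+ i / suc n) ^ℚ k ≤ q ⊎ + i / suc n ≡ 0ℚ
  lower k q n i (inj₁ h)    = inj₁ h
  lower k q n i (inj₂ refl) = inj₂ (0/n n)

  upper : ∀ k q n i → ¬ Below k q n (suc i) → q < (+ i / suc n + unit n) ^ℚ k
  upper k q n i h = subst (λ z → q < z ^ℚ k) (/-suc i n) (ℚ.≰⇒> h)

  rootApprox-lower : ∀ k q n → rootApprox k q n ^ℚ k ≤ q ⊎ rootApprox k q n ≡ 0ℚ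
  rootApprox-lower k q n = lower k q n (largest (below? k q n) (startBound q n))
    (largest-lower (below? k q n) (startBound q n))

  rootApprox-upper : ∀ k q n → q < (rootApprox (suc k) q n + unit n) ^ℚ suc k
  rootApprox-upper k q n = upper (suc k) q n (largest (below? (suc k) q n) (startBound q n))
    (largest-upper (below? (suc k) q n) (startBound q n)
      (λ h → ℚ.<-irrefl refl (ℚ.<-≤-trans (start-^ k q n) h)))

  rootApprox-nonNeg : ∀ k q n → 0ℚ ≤ rootApprox k q n
  rootApprox-nonNeg k q n = 0≤/ (largest (below? k q n) (startBound q n)) n

  root-close : ∀ k {a b p q u e} → 0ℚ ≤ a → 0ℚ ≤ u → 0ℚ ≤ e →
               b ^ℚ suc k ≤ p ⊎ b ≡ 0ℚ → q < (a + u) ^ℚ suc k →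
               p ≤ q + e ^ℚ suc k → u ≤ e → b ≤ a + (e + e)
  root-close k {a} {b} {e = e} 0≤a _ 0≤e (inj₂ b≡0) _ _ _ =
    subst (_≤ a + (e + e)) (sym b≡0) (ℚ.+-mono-≤ 0≤a (ℚ.+-mono-≤ 0≤e 0≤e))
  root-close k {a} {b} {p} {q} {u} {e} 0≤a 0≤u 0≤e (inj₁ bᵏ≤p) q< p≤q u≤e = begin
    b            ≤⟨ ℚ.<⇒≤ (^-cancel-< (suc k) (ℚ.+-mono-≤ 0≤a+u 0≤e) bᵏ<) ⟩
    a + u + e    ≡⟨ ℚ.+-assoc a u e ⟩
    a + (u + e)  ≤⟨ ℚ.+-monoʳ-≤ a (ℚ.+-monoˡ-≤ e u≤e) ⟩
    a + (e + e)  ∎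
    where
    0≤a+u : 0ℚ ≤ a + u
    0≤a+u = ℚ.+-mono-≤ 0≤a 0≤u
    bᵏ< : b ^ℚ suc k < (a + u + e) ^ℚ suc k
    bᵏ< = begin-strict
      b ^ℚ suc k                    ≤⟨ bᵏ≤p ⟩
      p                             ≤⟨ p≤q ⟩
      q + e ^ℚ suc k                <⟨ ℚ.+-monoˡ-< (e ^ℚ suc k) q< ⟩
      (a + u) ^ℚ suc k + e ^ℚ suc k ≤⟨ ^-superadd k 0≤a+u 0≤e ⟩
      (a + u + e) ^ℚ suc k          ∎

  rootApprox-close : ∀ k p q m n e → 0ℚ < e → p ≤ q + e ^ℚ suc k → unit n ≤ e →
                     rootApprox (suc k) p m ≤ rootApprox (suc k) q n + (e + e)
  rootApprox-close k p q m n e 0<e p≤q u≤e =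
    root-close k {rootApprox (suc k) q n} {rootApprox (suc k) p m} {p} {q} {unit n} {e}
      (rootApprox-nonNeg (suc k) q n) (0≤/ 1 n) (ℚ.<⇒≤ 0<e)
      (rootApprox-lower (suc k) p m) (rootApprox-upper k q n) p≤q u≤e

  unit≤ : ∀ e → 0ℚ < e → ∀ n → ℚ.↧ₙ e ℕ.≤ n → unit n ≤ e
  unit≤ (mkℚ (+ zero) d c) 0<e n h = ⊥-elim (ℚ.<-irrefl refl (subst (0ℚ <_) (ℚ.↥p≡0⇒p≡0 (mkℚ (+ zero) d c) refl) 0<e))
  unit≤ (mkℚ (+ suc a) d c) 0<e n h = ℚ.toℚᵘ-cancel-≤ (ℚᵘ.≤-respˡ-≃ (ℚᵘ.≃-sym (toℚᵘ-/ 1 n))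
    (ℚᵘ.*≤* (ℤ.+≤+ (ℕ.≤-trans (subst (ℕ._≤ suc n) (sym (ℕ.*-identityˡ (suc d))) (ℕ.m≤n⇒m≤1+n h))
                              (ℕ.m≤n*m (suc n) (suc a))))))
  unit≤ (mkℚ -[1+ a ] d c) (ℚ.*<* ()) n h

  root-cauchy : ∀ k x ε → 0ℚ < ε → Modulus (λ n → rootApprox (suc k) (seq x n) n) ε
  root-cauchy k x ε 0<ε = modulus (½ * ε) (half-pos 0<ε) (halves ε)
    where
    modulus : ∀ e → 0ℚ < e → e + e ≡ ε → Modulus (λ n → rootApprox (suc k) (seq x n) n) ε
    modulus e 0<e e+e≡ε = N ℕ.⊔ ℚ.↧ₙ e , λ m n p q → close⁺ (below m n p q) (below n m q p)
      where
      xN : Modulus (seq x) (e ^ℚ suc k)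
      xN = cauchy x (e ^ℚ suc k) (^-pos (suc k) 0<e)
      N : ℕ
      N = proj₁ xN
      below : ∀ m n → N ℕ.⊔ ℚ.↧ₙ e ℕ.≤ m → N ℕ.⊔ ℚ.↧ₙ e ℕ.≤ n →
              rootApprox (suc k) (seq x m) m ≤ rootApprox (suc k) (seq x n) n + ε
      below m n p q =
        subst (λ z → rootApprox (suc k) (seq x m) m ≤ rootApprox (suc k) (seq x n) n + z) e+e≡ε
          (rootApprox-close k (seq x m) (seq x n) m n e 0<e
            (close⁻ (proj₂ xN m n (ℕ.m⊔n≤o⇒m≤o N (ℚ.↧ₙ e) p) (ℕ.m⊔n≤o⇒m≤o N (ℚ.↧ₙ e) q)))
            (unit≤ e 0<e n (ℕ.m⊔n≤o⇒n≤o N (ℚ.↧ₙ e) q)))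

open RootLemmas

-- The (k+1)-th root of max(x,0).
root : (k : ℕ) → ℝ → ℝ
root k x = mkℝ (λ n → rootApprox (suc k) (seq x n) n) (root-cauchy k x)

-- x ^ᴿ[ p / q ] is x^(p/q) for x ≥ 0, with the convention p/0 = 0.
_^ᴿ[_/_] : ℝ → ℕ → ℕ → ℝ
x ^ᴿ[ p / zero ]  = 1ᴿ
x ^ᴿ[ p / suc q ] = root q (x ^ᴿ p)

-- η(δ) → 0 as δ → 0⁺.
TendsToZeroAt0⁺ : (ℝ → ℝ) → Set
TendsToZeroAt0⁺ η =
  ∀ ε → 0ᴿ <ᴿ ε → ∃[ δ₁ ] 0ᴿ <ᴿ δ₁ × (∀ δ → 0ᴿ <ᴿ δ → δ ≤ᴿ δ₁ → ∣ η δ ∣ᴿ ≤ᴿ ε)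

-- A finite simple graph on the vertex set Fin n.
record Graph (n : ℕ) : Set₁ where
  field
    _~_     : Rel (Fin n) 0ℓ
    _~?_    : Decidable _~_
    ~-sym   : Symmetric _~_
    ~-irrefl : Irreflexive _≡_ _~_

sublists : {A : Set} → List A → List (List A)
sublists []       = [ [] ]
sublists (x ∷ xs) = map (x ∷_) (sublists xs) ++ sublists xs

module _ {n : ℕ} (G : Graph n) where
  open Graph G

  -- By irreflexivity the entries of vs are distinct.
  IsClique : ℕ → List (Fin n) → Set
  IsClique s vs = length vs ≡ s × AllPairs _~_ vs

  isClique? : ∀ s vs → Dec (IsClique s vs)
  isClique? s vs = (length vs ℕ.≟ s) ×-dec allPairs? _~?_ vs

  CliqueFree : ℕ → Set
  CliqueFree s = ∀ vs → ¬ IsClique s vs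

  -- The sublists of allFin n are the vertex sets, each listed once.
  cliqueCount : ℕ → ℕ
  cliqueCount s = length (filter (isClique? s) (sublists (allFin n)))

  edges : List (Fin n × Fin n)
  edges = filter (λ (i , j) → (i Fin.<? j) ×-dec (i ~? j)) (cartesianProduct (allFin n) (allFin n))

  open DecMembership (≡-dec (Fin._≟_ {n}) (Fin._≟_ {n})) using (_∈_; _∉_; _∈?_)

  delete : List (Fin n × Fin n) → Graph n
  delete F = record
    { _~_      = λ i j → i ~ j × (i , j) ∉ F × (j , i) ∉ F
    ; _~?_     = λ i j → (i ~? j) ×-dec ¬? ((i , j) ∈? F) ×-dec ¬? ((j , i) ∈? F)
    ; ~-sym    = λ (a , b , c) → ~-sym a , c , b
    ; ~-irrefl = λ i≡j (a , _) → ~-irrefl i≡j a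
    }

  Colorable : ℕ → Set
  Colorable r = Σ[ c ∈ (Fin n → Fin r) ] (∀ i j → i ~ j → c i ≢ c j)

  colorable? : ∀ r → Dec (Colorable r)
  colorable? r = map′
    (λ (k , proper) → finToFun k , proper)
    (λ (c , proper) → funToFin c , λ i j i~j eq → proper i j i~j
      (trans (sym (Fin.finToFun-funToFin c i)) (trans eq (Fin.finToFun-funToFin c j))))
    (Fin.any? λ k → Fin.all? λ i → Fin.all? λ j →
      (i ~? j) →-dec ¬? (finToFun {r} {n} k i Fin.≟ finToFun k j))

-- The default value of the minimum corresponds to deleting every
-- edge, which is always admissible when r ≥ 1.
D : ℕ → ∀ {n} → Graph n → ℕ
D r G = min (length (edges G))
  (map length (filter (λ F → colorable? (delete G F) r) (sublists (edges G))))

{-# OPTIONS --safe #-}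
module Submission where

-- Double counting of ordered cliques (Moon–Moser) bounds the number of s-cliques linearly by the number
-- of edges, so G has at least (1 - 1/r) n²/2 - α n² edges with α ≤ C(r,2) (δ / C(r,s))^(2/s) for small δ.
-- Füredi's argument gives an r-partition with at most α n² monochromatic edges; make it locally optimal.
-- Write α = τ⁶.  Let k be the largest degree inside a class.  All classes contain k neighbours of the same
-- vertex, and averaging over transversals gives k² missing pairs between these sets.  Every monochromatic
-- edge, up to O(τ¹⁰ n²) exceptions, has an end with nearly n/r missing pairs; if there are a such vertices,
-- then a n/r + k² ≤ (1 + O(τ)) α n², while there are at most a k + O(τ¹⁰ n²) monochromatic edges.
-- Maximising a k by x² y ≤ (4/27) (x + y)³ gives (2r / (3√3) + O(τ)) α^(3/2) n².
-- On the reals, this is applied at each index to rational approximations of the roots.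

open import Defs
open import Algebra.Bundles using (CommutativeRing; Semiring)
open import Data.Bool.Base using (Bool; true; false; _∧_; not; if_then_else_)
import Data.Bool.Properties as Bool
open import Data.Empty using (⊥; ⊥-elim)
open import Data.Fin.Base using (Fin; zero; suc; punchIn)
import Data.Fin.Properties as Fin
import Data.Integer.Base as ℤ
import Data.Integer.Properties as ℤ
open import Data.List.Base using (List; []; _∷_; map; _++_; filter; length; allFin; tabulate; cartesianProduct)
open import Data.List.Extrema.Nat using (min≤v⁺)
open import Data.List.Membership.Propositional using (_∈_; lose)
import Data.List.Membership.Propositional.Properties as ∈
open import Data.List.Relation.Unary.All as All using (All; []; _∷_; all?)
open import Data.List.Relation.Unary.AllPairs using (AllPairs; []; _∷_; allPairs?)
open import Data.List.Relation.Unary.Any using (here)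
import Data.List.Relation.Unary.Any.Properties as Any
open import Data.Nat.Base as ℕ using (ℕ; zero; suc)
open import Data.Nat.Combinatorics using (_C_; nC1≡n; nCn≡1; nCk≡nC[n∸k]; nCk+nC[k+1]≡[n+1]C[k+1])
open import Data.Nat.Combinatorics.Specification using (k>n⇒nCk≡0)
import Data.Nat.Properties as ℕ
open import Data.Nat.Tactic.RingSolver using (solve-∀)
open import Data.Product using (Σ-syntax; ∃-syntax; _×_; _,_; proj₁; proj₂)
open import Data.Rational.Base as ℚ using (ℚ; 0ℚ; 1ℚ)
import Data.Rational.Properties as ℚ
open import Data.Rational.Solver using (module +-*-Solver)
open import Data.Rational.Unnormalised.Base as ℚᵘ using (mkℚᵘ)
import Data.Rational.Unnormalised.Properties as ℚᵘ
open import Data.Sum.Base using (_⊎_; inj₁; inj₂)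
open import Data.Vec.Base using (Vec; []; _∷_; insertAt; removeAt; lookup; toList)
import Data.Vec.Properties as Vec
open import Function.Base using (_∘_)
open import Function.Bundles using (mk⇔)
open import Relation.Binary.Definitions using (tri<; tri≈; tri>)
open import Relation.Binary.PropositionalEquality
open import Relation.Nullary using (Dec; does; yes; no; ¬_)
open import Relation.Nullary.Decidable using (dec-true; dec-false; does-⇔; from-yes; _×-dec_)
open import Relation.Unary using (Decidable)

-- The sixth power keeps roots out of the combinatorial part: class-size deficits, inner degrees and
-- common neighbourhoods are compared with α^(1/2) n = τ³ n, the answer has order α^(3/2) n² = τ⁹
-- n², and inequalities between square roots are replaced by inequalities between squares. A vertex
-- is exceptional when it has at least τ n missing pairs. This threshold balances two errors. Only
-- O(τ⁶ n²) pairs are missing, so O(τ⁵ n) vertices reach it, and the O(τ¹⁰ n²) pairs among them are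
-- a factor τ below the main term. A monochromatic edge with an end below the threshold leaves n/r -
-- O(τ n) missing pairs to the other end. All errors together are a multiple K τ, which becomes the
-- o(1) term, with τ the ninth root of C(r,2)^(3/2) C(r,s)^(-3/s) δ^(3/s). An inequality between
-- reals yields rational inequalities only up to an arbitrary ε and from some index on. By then G
-- and n are fixed, so the rounding errors of all roots can be chosen small against n^(-2) and are
-- paid for by that ε.

module Combinatorics where
  open import Data.Nat.Base
  open import Data.Nat.Properties
  open import Algebra.Properties.Semiring.Sum +-*-semiring as Sum using (∑-distrib-+; ∑-comm; *-distribˡ-sum; *-distribʳ-sum)

  -- Finite sums of natural numbers, indicators and extremal elements.

  ∑ : ∀ {n} → (Fin n → ℕ) → ℕ
  ∑ = Sum.sum

  ∑∑ : ∀ {m n} → (Fin m → Fin n → ℕ) → ℕ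
  ∑∑ f = ∑ λ u → ∑ (f u)

  ∑-cong : ∀ {n} {f g : Fin n → ℕ} → (∀ i → f i ≡ g i) → ∑ f ≡ ∑ g
  ∑-cong = Sum.sum-cong-≗

  ∑-mono : ∀ {n} {f g : Fin n → ℕ} → (∀ i → f i ≤ g i) → ∑ f ≤ ∑ g
  ∑-mono {zero}  h = z≤n
  ∑-mono {suc n} h = +-mono-≤ (h zero) (∑-mono (λ i → h (suc i)))

  ∑∑-cong : ∀ {m n} {f g : Fin m → Fin n → ℕ} → (∀ u v → f u v ≡ g u v) → ∑∑ f ≡ ∑∑ g
  ∑∑-cong h = ∑-cong λ u → ∑-cong (h u)

  ∑∑-mono : ∀ {m n} {f g : Fin m → Fin n → ℕ} → (∀ u v → f u v ≤ g u v) → ∑∑ f ≤ ∑∑ g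
  ∑∑-mono h = ∑-mono λ u → ∑-mono (h u)

  ∑∑-distrib-+ : ∀ {m n} (f g : Fin m → Fin n → ℕ) → ∑∑ (λ u v → f u v + g u v) ≡ ∑∑ f + ∑∑ g
  ∑∑-distrib-+ f g = trans (∑-cong λ u → ∑-distrib-+ (f u) (g u)) (∑-distrib-+ (λ u → ∑ (f u)) (λ u → ∑ (g u)))

  ∑-const : ∀ n k → ∑ {n} (λ _ → k) ≡ n * k
  ∑-const zero    k = refl
  ∑-const (suc n) k = cong (k +_) (∑-const n k)

  ∑-zero : ∀ {n} {f : Fin n → ℕ} → (∀ i → f i ≡ 0) → ∑ f ≡ 0
  ∑-zero {n} h = trans (∑-cong h) (trans (∑-const n 0) (*-zeroʳ n))

  f≤∑f : ∀ {n} (f : Fin n → ℕ) i → f i ≤ ∑ f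
  f≤∑f f zero    = m≤m+n (f zero) _
  f≤∑f f (suc i) = ≤-trans (f≤∑f (λ j → f (suc j)) i) (m≤n+m _ (f zero))

  ∑*∑ : ∀ {m n} (f : Fin m → ℕ) (g : Fin n → ℕ) → ∑∑ (λ u v → f u * g v) ≡ ∑ f * ∑ g
  ∑*∑ f g = trans (∑-cong λ u → sym (*-distribˡ-sum (f u) g)) (sym (*-distribʳ-sum (∑ g) f))

  ι : Bool → ℕ
  ι b = if b then 1 else 0

  ι-∧ : ∀ a b → ι (a ∧ b) ≡ ι a * ι b
  ι-∧ false b = refl
  ι-∧ true  b = sym (*-identityˡ (ι b))

  ι≤1 : ∀ b → ι b ≤ 1
  ι≤1 false = z≤n
  ι≤1 true  = ≤-refl

  ∧-left : ∀ a {b} → a ∧ b ≡ true → a ≡ true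
  ∧-left true _ = refl

  ∧-right : ∀ a {b} → a ∧ b ≡ true → b ≡ true
  ∧-right true e = e

  infix 6 _≡ᶠ_

  _≡ᶠ_ : ∀ {n} → Fin n → Fin n → Bool
  i ≡ᶠ j = does (i Fin.≟ j)

  ≡ᶠ-refl : ∀ {n} (i : Fin n) → (i ≡ᶠ i) ≡ true
  ≡ᶠ-refl i = dec-true (i Fin.≟ i) refl

  ≢⇒≡ᶠ : ∀ {n} {i j : Fin n} → i ≢ j → (i ≡ᶠ j) ≡ false
  ≢⇒≡ᶠ {i = i} {j} = dec-false (i Fin.≟ j)

  ≡ᶠ⇒≡ : ∀ {n} {i j : Fin n} → (i ≡ᶠ j) ≡ true → i ≡ j
  ≡ᶠ⇒≡ {i = i} {j} e with i Fin.≟ j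
  ... | yes p = p
  ≡ᶠ⇒≡ () | no _

  ≡ᶠ-sym : ∀ {n} (i j : Fin n) → (i ≡ᶠ j) ≡ (j ≡ᶠ i)
  ≡ᶠ-sym i j with i Fin.≟ j
  ... | yes refl = sym (≡ᶠ-refl j)
  ... | no  i≢j  = sym (≢⇒≡ᶠ (λ e → i≢j (sym e)))

  ∑-≡ᶠ : ∀ {n} (f : Fin n → ℕ) (i : Fin n) → ∑ (λ j → ι (i ≡ᶠ j) * f j) ≡ f i
  ∑-≡ᶠ {suc n} f zero = trans (cong₂ _+_ (+-identityʳ (f zero)) (∑-zero {n} λ _ → refl)) (+-identityʳ (f zero))
  ∑-≡ᶠ f (suc i) = ∑-≡ᶠ (λ j → f (suc j)) i

  -- Averaging over transversals needs sets of exactly equal sizes, so larger neighbourhoods are cut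
  -- down first.
  thin : ∀ {n} (p : Fin n → Bool) k → k ≤ ∑ (λ i → ι (p i)) →
         Σ[ q ∈ (Fin n → Bool) ] (∀ i → q i ≡ true → p i ≡ true) × ∑ (λ i → ι (q i)) ≡ k
  thin {n} p zero h = (λ _ → false) , (λ _ ()) , ∑-zero {n} (λ _ → refl)
  thin {zero} p (suc k) ()
  thin {suc n} p (suc k) h with p zero in e
  ... | true  = let q , q⊆p , eq = thin (λ i → p (suc i)) k (s≤s⁻¹ h)
                in (λ { zero → true ; (suc i) → q i }) , (λ { zero _ → e ; (suc i) → q⊆p i }) , cong suc eq
  ... | false = let q , q⊆p , eq = thin (λ i → p (suc i)) (suc k) h
                in (λ { zero → false ; (suc i) → q i }) , (λ { zero () ; (suc i) → q⊆p i }) , eq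

  argmax : ∀ {n} (f : Fin (suc n) → ℕ) → ∃[ y ] (∀ z → f z ≤ f y)
  argmax {zero}  f = zero , λ { zero → ≤-refl }
  argmax {suc n} f with argmax (λ i → f (suc i))
  ... | y , max with f zero ≤? f (suc y)
  ...   | yes le = suc y , λ { zero → le ; (suc z) → max z }
  ...   | no  gt = zero , λ { zero → ≤-refl ; (suc z) → ≤-trans (max z) (≰⇒≥ gt) }

  argmax-on : ∀ {n} (p : Fin n → Bool) (f : Fin n → ℕ) x → p x ≡ true →
              ∃[ y ] p y ≡ true × (∀ z → p z ≡ true → f z ≤ f y)
  argmax-on {suc n} p f x px = y , py , λ z pz → s≤s⁻¹ (subst₂ _≤_ (value z pz) (value y py) (max z))
    where
    g : Fin (suc n) → ℕ
    -- The shift by one ranks every element of `p` above all others, even where `f` is 0, so the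
    -- maximum of `g` is attained inside `p`.
    g z = if p z then suc (f z) else 0
    value : ∀ z → p z ≡ true → g z ≡ suc (f z)
    value z pz rewrite pz = refl
    y = proj₁ (argmax g)
    max = proj₂ (argmax g)
    py : p y ≡ true
    py with p y | subst (_≤ g y) (value x px) (max x)
    ... | true  | _ = refl

  argmin : ∀ {n} (f : Fin (suc n) → ℕ) → ∃[ y ] (∀ z → f y ≤ f z)
  argmin {zero}  f = zero , λ { zero → ≤-refl }
  argmin {suc n} f with argmin (λ i → f (suc i))
  ... | y , min with f zero ≤? f (suc y)
  ...   | yes le = zero , λ { zero → ≤-refl ; (suc z) → ≤-trans le (min z) }
  ...   | no  gt = suc y , λ { zero → ≰⇒≥ gt ; (suc z) → min z }

  -- Ordered cliques and the Moon-Moser inequality.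

  module Ordered {n : ℕ} (adj : Fin n → Fin n → Bool) (adj-sym : ∀ u v → adj u v ≡ adj v u) where

    ∑ᵛ : ∀ s → (Vec (Fin n) s → ℕ) → ℕ
    ∑ᵛ zero    F = F []
    ∑ᵛ (suc s) F = ∑ λ w → ∑ᵛ s λ T → F (w ∷ T)

    joined : ∀ {s} → Fin n → Vec (Fin n) s → ℕ
    joined w []      = 1
    joined w (v ∷ T) = ι (adj w v) * joined w T

    clique : ∀ {s} → Vec (Fin n) s → ℕ
    clique []      = 1
    clique (v ∷ T) = joined v T * clique T

    codegree : ∀ {s} → Vec (Fin n) s → ℕ
    codegree T = ∑ λ w → joined w T

    -- This is s! times the number of s-cliques. Ordered tuples allow any position to play the role
    -- of the vertex added last.
    h : ℕ → ℕ
    h s = ∑ᵛ s clique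

    ∑ᵛ-cong : ∀ s {F F′ : Vec (Fin n) s → ℕ} → (∀ T → F T ≡ F′ T) → ∑ᵛ s F ≡ ∑ᵛ s F′
    ∑ᵛ-cong zero    e = e []
    ∑ᵛ-cong (suc s) e = ∑-cong λ w → ∑ᵛ-cong s λ T → e (w ∷ T)

    ∑ᵛ-mono : ∀ s {F F′ : Vec (Fin n) s → ℕ} → (∀ T → F T ≤ F′ T) → ∑ᵛ s F ≤ ∑ᵛ s F′
    ∑ᵛ-mono zero    e = e []
    ∑ᵛ-mono (suc s) e = ∑-mono λ w → ∑ᵛ-mono s λ T → e (w ∷ T)

    ∑ᵛ-+ : ∀ s (F F′ : Vec (Fin n) s → ℕ) → ∑ᵛ s (λ T → F T + F′ T) ≡ ∑ᵛ s F + ∑ᵛ s F′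
    ∑ᵛ-+ zero    F F′ = refl
    ∑ᵛ-+ (suc s) F F′ = trans (∑-cong λ w → ∑ᵛ-+ s (λ T → F (w ∷ T)) (λ T → F′ (w ∷ T))) (∑-distrib-+ {n} _ _)

    ∑ᵛ-* : ∀ s k (F : Vec (Fin n) s → ℕ) → ∑ᵛ s (λ T → k * F T) ≡ k * ∑ᵛ s F
    ∑ᵛ-* zero    k F = refl
    ∑ᵛ-* (suc s) k F = trans (∑-cong λ w → ∑ᵛ-* s k λ T → F (w ∷ T)) (sym (*-distribˡ-sum {n} k _))

    ∑ᵛ-∑ : ∀ s {m} (F : Fin m → Vec (Fin n) s → ℕ) → ∑ᵛ s (λ T → ∑ λ i → F i T) ≡ ∑ λ i → ∑ᵛ s (F i)
    ∑ᵛ-∑ zero    F = refl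
    ∑ᵛ-∑ (suc s) {m} F = trans (∑-cong λ w → ∑ᵛ-∑ s λ i T → F i (w ∷ T)) (∑-comm {n} {m} λ w i → ∑ᵛ s λ T → F i (w ∷ T))

    ∑ᵛ-insertAt : ∀ s i (F : Vec (Fin n) (suc s) → ℕ) → ∑ᵛ (suc s) F ≡ ∑ λ w → ∑ᵛ s λ T → F (insertAt T i w)
    ∑ᵛ-insertAt s       zero    F = refl
    ∑ᵛ-insertAt (suc s) (suc i) F = trans
      (∑-cong λ u → ∑ᵛ-insertAt s i λ T → F (u ∷ T))
      (∑-comm {n} {n} λ u w → ∑ᵛ s λ T → F (u ∷ insertAt T i w))

    joined-insertAt : ∀ {s} v (T : Vec (Fin n) s) i w → joined v (insertAt T i w) ≡ ι (adj v w) * joined v T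
    joined-insertAt v T       zero    w = refl
    joined-insertAt v (u ∷ T) (suc i) w = trans (cong (ι (adj v u) *_) (joined-insertAt v T i w))
      (swap (ι (adj v u)) (ι (adj v w)) (joined v T))
      where
      swap : ∀ a b c → a * (b * c) ≡ b * (a * c)
      swap = solve-∀

    clique-insertAt : ∀ {s} (T : Vec (Fin n) s) i w → clique (insertAt T i w) ≡ joined w T * clique T
    clique-insertAt T       zero    w = refl
    clique-insertAt (v ∷ T) (suc i) w = begin
      joined v (insertAt T i w) * clique (insertAt T i w)
        ≡⟨ cong₂ _*_ (joined-insertAt v T i w) (clique-insertAt T i w) ⟩
      ι (adj v w) * joined v T * (joined w T * clique T)
        ≡⟨ cong (λ b → ι b * joined v T * (joined w T * clique T)) (adj-sym v w) ⟩
      ι (adj w v) * joined v T * (joined w T * clique T)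
        ≡⟨ swap (ι (adj w v)) (joined v T) (joined w T) (clique T) ⟩
      ι (adj w v) * joined w T * (joined v T * clique T) ∎
      where
      open ≡-Reasoning
      swap : ∀ a b c d → a * b * (c * d) ≡ a * c * (b * d)
      swap = solve-∀

    h-suc : ∀ s → h (suc s) ≡ ∑ᵛ s λ T → codegree T * clique T
    h-suc s = sym (trans (∑ᵛ-cong s λ T → *-distribʳ-sum (clique T) λ w → joined w T)
                         (∑ᵛ-∑ s {n} λ w T → joined w T * clique T))

    joined≤1 : ∀ {s} w (T : Vec (Fin n) s) → joined w T ≤ 1
    joined≤1 w []      = ≤-refl
    joined≤1 w (v ∷ T) = *-mono-≤ (ι≤1 (adj w v)) (joined≤1 w T)

    -- A vertex outside the common neighbourhood is joined to at most one of
    -- the sets obtained from T by removing a vertex.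
    joined-removeAt : ∀ s w (T : Vec (Fin n) (suc s)) →
                      ∑ (λ i → joined w (removeAt T i)) ≤ 1 + s * joined w T
    joined-removeAt zero    w (v ∷ []) = s≤s z≤n
    joined-removeAt (suc s) w (v ∷ T@(_ ∷ _)) with adj w v
    ... | false = begin
      joined w T + ∑ {suc s} (λ _ → 0)      ≡⟨ cong (joined w T +_) (∑-zero {suc s} λ _ → refl) ⟩
      joined w T + 0                        ≤⟨ +-monoˡ-≤ 0 (joined≤1 w T) ⟩
      1                                     ≤⟨ m≤m+n 1 _ ⟩
      1 + suc s * 0                         ∎
      where open ≤-Reasoning
    ... | true  = begin
      joined w T + ∑ (λ i → 1 * joined w (removeAt T i))
        ≡⟨ cong (joined w T +_) (∑-cong {suc s} λ i → *-identityˡ (joined w (removeAt T i))) ⟩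
      joined w T + ∑ (λ i → joined w (removeAt T i))
        ≤⟨ +-monoʳ-≤ (joined w T) (joined-removeAt s w T) ⟩
      joined w T + (1 + s * joined w T)
        ≡⟨ arith (joined w T) s ⟩
      1 + suc s * (1 * joined w T) ∎
      where
      open ≤-Reasoning
      arith : ∀ j s → j + (1 + s * j) ≡ 1 + suc s * (1 * j)
      arith = solve-∀

    ∑-codegree² : ∀ s → ℕ
    ∑-codegree² s = ∑ᵛ s λ T → codegree T * (codegree T * clique T)

    -- Count triples of an ordered (s+1)-clique T, a position i and a vertex w joined to T without
    -- its i-th vertex. Grouping by the remaining s-clique gives a sum of squared codegrees for each
    -- of the s + 1 positions; grouping by T and w allows `joined-removeAt` to be applied.
    moon-moser : ∀ s → suc s * ∑-codegree² s ≤ n * h (suc s) + s * h (suc (suc s))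
    moon-moser s = begin
      suc s * ∑-codegree² s
        ≡⟨ ∑-const (suc s) (∑-codegree² s) ⟨
      ∑ {suc s} (λ _ → ∑-codegree² s)
        ≡⟨ ∑-cong {suc s} (λ i → sym (drop i)) ⟩
      ∑ {suc s} (λ i → ∑ᵛ (suc s) λ T → clique T * codegree (removeAt T i))
        ≡⟨ ∑ᵛ-∑ (suc s) {suc s} (λ i T → clique T * codegree (removeAt T i)) ⟨
      ∑ᵛ (suc s) (λ T → ∑ {suc s} λ i → clique T * codegree (removeAt T i))
        ≤⟨ ∑ᵛ-mono (suc s) bound ⟩
      ∑ᵛ (suc s) (λ T → n * clique T + s * (codegree T * clique T))
        ≡⟨ ∑ᵛ-+ (suc s) (λ T → n * clique T) (λ T → s * (codegree T * clique T)) ⟩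
      ∑ᵛ (suc s) (λ T → n * clique T) + ∑ᵛ (suc s) (λ T → s * (codegree T * clique T))
        ≡⟨ cong₂ _+_ (∑ᵛ-* (suc s) n clique) (∑ᵛ-* (suc s) s λ T → codegree T * clique T) ⟩
      n * h (suc s) + s * ∑ᵛ (suc s) (λ T → codegree T * clique T)
        ≡⟨ cong (λ z → n * h (suc s) + s * z) (h-suc (suc s)) ⟨
      n * h (suc s) + s * h (suc (suc s)) ∎
      where
      open ≤-Reasoning
      drop : ∀ i → ∑ᵛ (suc s) (λ T → clique T * codegree (removeAt T i)) ≡ ∑-codegree² s
      drop i = begin-equality
        ∑ᵛ (suc s) (λ T → clique T * codegree (removeAt T i))
          ≡⟨ ∑ᵛ-insertAt s i (λ T → clique T * codegree (removeAt T i)) ⟩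
        ∑ (λ w → ∑ᵛ s λ T → clique (insertAt T i w) * codegree (removeAt (insertAt T i w) i))
          ≡⟨ ∑-cong (λ w → ∑ᵛ-cong s λ T →
               trans (cong₂ _*_ (clique-insertAt T i w) (cong codegree (Vec.removeAt-insertAt T i w)))
                     (*-assoc (joined w T) (clique T) (codegree T))) ⟩
        ∑ (λ w → ∑ᵛ s λ T → joined w T * (clique T * codegree T))
          ≡⟨ ∑ᵛ-∑ s (λ w T → joined w T * (clique T * codegree T)) ⟨
        ∑ᵛ s (λ T → ∑ λ w → joined w T * (clique T * codegree T))
          ≡⟨ ∑ᵛ-cong s (λ T → trans (sym (*-distribʳ-sum (clique T * codegree T) (λ w → joined w T)))
               (cong (codegree T *_) (*-comm (clique T) (codegree T)))) ⟩
        ∑-codegree² s ∎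
      bound : ∀ T → ∑ {suc s} (λ i → clique T * codegree (removeAt T i)) ≤ n * clique T + s * (codegree T * clique T)
      bound T = begin
        ∑ {suc s} (λ i → clique T * codegree (removeAt T i))
          ≡⟨ *-distribˡ-sum {suc s} (clique T) (λ i → codegree (removeAt T i)) ⟨
        clique T * ∑ {suc s} (λ i → codegree (removeAt T i))
          ≡⟨ cong (clique T *_) (∑-comm {suc s} {n} λ i w → joined w (removeAt T i)) ⟩
        clique T * ∑ (λ w → ∑ {suc s} λ i → joined w (removeAt T i))
          ≤⟨ *-monoʳ-≤ (clique T) (∑-mono λ w → joined-removeAt s w T) ⟩
        clique T * ∑ {n} (λ w → 1 + s * joined w T)
          ≡⟨ cong (clique T *_) (trans (∑-distrib-+ {n} (λ _ → 1) (λ w → s * joined w T))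
               (cong₂ _+_ (trans (∑-const n 1) (*-identityʳ n)) (sym (*-distribˡ-sum {n} s _)))) ⟩
        clique T * (n + s * codegree T)
          ≡⟨ arith (clique T) n s (codegree T) ⟩
        n * clique T + s * (codegree T * clique T) ∎
        where
        arith : ∀ c n s d → c * (n + s * d) ≡ n * c + s * (d * c)
        arith = solve-∀

    -- From r Σd² ≤ t Σd, summing (r d - t)² ≥ 0 over the ordered s-cliques.
    second-moment : ∀ r t s → r * ∑-codegree² s ≤ t * h (suc s) → t * (r * h (suc s)) ≤ t * (t * h s)
    second-moment r t s hyp = +-cancelʳ-≤ (t * (r * h (suc s))) _ _ (begin
      t * (r * h (suc s)) + t * (r * h (suc s))
        ≡⟨ cong (λ z → t * (r * z) + t * (r * z)) (h-suc s) ⟩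
      t * (r * Σd) + t * (r * Σd)
        ≡⟨ trans (double (t * (r * Σd))) (sym (trans (∑ᵛ-* s 2 _) (cong (2 *_) (trans (∑ᵛ-* s t _) (cong (t *_) (∑ᵛ-* s r _)))))) ⟩
      ∑ᵛ s (λ T → 2 * (t * (r * (codegree T * clique T))))
        ≤⟨ ∑ᵛ-mono s (λ T → square (codegree T) (clique T)) ⟩
      ∑ᵛ s (λ T → r * (r * (codegree T * (codegree T * clique T))) + t * (t * clique T))
        ≡⟨ trans (∑ᵛ-+ s _ _) (cong₂ _+_ (trans (∑ᵛ-* s r _) (cong (r *_) (∑ᵛ-* s r _)))
                                        (trans (∑ᵛ-* s t _) (cong (t *_) (∑ᵛ-* s t _)))) ⟩
      r * (r * ∑-codegree² s) + t * (t * h s)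
        ≤⟨ +-monoˡ-≤ _ (*-monoʳ-≤ r hyp) ⟩
      r * (t * h (suc s)) + t * (t * h s)
        ≡⟨ swap r t (h (suc s)) (t * (t * h s)) ⟩
      t * (t * h s) + t * (r * h (suc s)) ∎)
      where
      open ≤-Reasoning
      Σd = ∑ᵛ s λ T → codegree T * clique T
      double : ∀ x → x + x ≡ 2 * x
      double = solve-∀
      swap : ∀ r t h g → r * (t * h) + g ≡ g + t * (r * h)
      swap = solve-∀
      2ab≤a²+b² : ∀ a b → 2 * (a * b) ≤ a * a + b * b
      2ab≤a²+b² a b with ≤-total a b
      ... | inj₁ a≤b = go a b a≤b
        where
        go : ∀ a b → a ≤ b → 2 * (a * b) ≤ a * a + b * b
        go a b a≤b with k , refl ← m≤n⇒∃[o]m+o≡n a≤b = subst (2 * (a * (a + k)) ≤_) (id₁ a k) (m≤m+n _ (k * k))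
          where
          id₁ : ∀ a k → 2 * (a * (a + k)) + k * k ≡ a * a + (a + k) * (a + k)
          id₁ = solve-∀
      ... | inj₂ b≤a with k , refl ← m≤n⇒∃[o]m+o≡n b≤a = subst (2 * ((b + k) * b) ≤_) (id₂ b k) (m≤m+n _ (k * k))
          where
          id₂ : ∀ b k → 2 * ((b + k) * b) + k * k ≡ (b + k) * (b + k) + b * b
          id₂ = solve-∀
      square : ∀ d c → 2 * (t * (r * (d * c))) ≤ r * (r * (d * (d * c))) + t * (t * c)
      square d c = subst₂ _≤_ (lhs r t d c) (rhs r t d c) (*-monoˡ-≤ c (2ab≤a²+b² (r * d) t))
        where
        lhs : ∀ r t d c → 2 * (r * d * t) * c ≡ 2 * (t * (r * (d * c)))
        lhs = solve-∀
        rhs : ∀ r t d c → (r * d * (r * d) + t * t) * c ≡ r * (r * (d * (d * c))) + t * (t * c)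
        rhs = solve-∀

    -- Induction on j = r - s, hence downwards from s = r, where `none` makes the left side vanish.
    -- Inserting the bound for s + 1 into Moon-Moser gives the hypothesis of `second-moment` with t
    -- = (j + 1) n, because (s + j + 1) + s j = (s + 1)(j + 1).
    turán-ratio : .{{_ : NonZero n}} → ∀ r → h (suc r) ≡ 0 → ∀ j s → s + j ≡ r → r * h (suc s) ≤ j * (n * h s)
    turán-ratio r none zero s eq = ≤-reflexive (trans (cong (r *_) (trans (cong (λ z → h (suc z)) (trans (sym (+-identityʳ s)) eq)) none)) (*-zeroʳ r))
    turán-ratio r none (suc j) s eq = subst (r * h (suc s) ≤_) (*-assoc (suc j) n (h s))
      (*-cancelˡ-≤ t {{m*n≢0 (suc j) n}} (second-moment r t s (*-cancelˡ-≤ (suc s) (begin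
        suc s * (r * ∑-codegree² s)
          ≡⟨ left-comm (suc s) r (∑-codegree² s) ⟩
        r * (suc s * ∑-codegree² s)
          ≤⟨ *-monoʳ-≤ r (moon-moser s) ⟩
        r * (n * h (suc s) + s * h (suc (suc s)))
          ≡⟨ expand r n (h (suc s)) s (h (suc (suc s))) ⟩
        r * (n * h (suc s)) + s * (r * h (suc (suc s)))
          ≤⟨ +-monoʳ-≤ (r * (n * h (suc s))) (*-monoʳ-≤ s (turán-ratio r none j (suc s) (trans (sym (+-suc s j)) eq))) ⟩
        r * (n * h (suc s)) + s * (j * (n * h (suc s)))
          ≡⟨ cong (λ z → z * (n * h (suc s)) + s * (j * (n * h (suc s)))) (sym eq) ⟩
        (s + suc j) * (n * h (suc s)) + s * (j * (n * h (suc s)))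
          ≡⟨ factor s j n (h (suc s)) ⟩
        suc s * (t * h (suc s)) ∎))))
      where
      open ≤-Reasoning
      t = suc j * n
      left-comm : ∀ a b c → a * (b * c) ≡ b * (a * c)
      left-comm = solve-∀
      expand : ∀ r n h s g → r * (n * h + s * g) ≡ r * (n * h) + s * (r * g)
      expand = solve-∀
      factor : ∀ s j n h → (s + suc j) * (n * h) + s * (j * (n * h)) ≡ suc s * (suc j * n * h)
      factor = solve-∀

  -- Binomial coefficients.

  nC0≡1 : ∀ n → n C 0 ≡ 1
  nC0≡1 n = trans (nCk≡nC[n∸k] {0} {n} z≤n) (nCn≡1 n)

  -- The identity (k+1) C(n,k+1) = (n-k) C(n,k) with the subtraction moved across, so that Pascal's
  -- rule carries an induction on n.
  absorption : ∀ n k → suc k * (n C suc k) + k * (n C k) ≡ n * (n C k)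
  absorption zero    zero    = refl
  absorption zero    (suc k) = cong₂ (λ a b → suc (suc k) * a + suc k * b) (k>n⇒nCk≡0 {0} {suc (suc k)} z<s) (k>n⇒nCk≡0 {0} {suc k} z<s) ∙ zeros k
    where
    _∙_ : ∀ {a b c : ℕ} → a ≡ b → b ≡ c → a ≡ c
    _∙_ = trans
    zeros : ∀ k → suc (suc k) * 0 + suc k * 0 ≡ 0
    zeros = solve-∀
  absorption (suc n) zero    = begin
    1 * (suc n C 1) + 0  ≡⟨ cong (λ z → 1 * z + 0) (nC1≡n (suc n)) ⟩
    1 * suc n + 0        ≡⟨ arith n ⟩
    suc n * 1            ≡⟨ cong (suc n *_) (nC0≡1 (suc n)) ⟨
    suc n * (suc n C 0)  ∎
    where
    open ≡-Reasoning
    arith : ∀ n → 1 * suc n + 0 ≡ suc n * 1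
    arith = solve-∀
  absorption (suc n) (suc k) = begin
    suc (suc k) * (suc n C suc (suc k)) + suc k * (suc n C suc k)
      ≡⟨ cong₂ (λ a b → suc (suc k) * a + suc k * b) (sym (nCk+nC[k+1]≡[n+1]C[k+1] n (suc k))) (sym (nCk+nC[k+1]≡[n+1]C[k+1] n k)) ⟩
    suc (suc k) * (b + c) + suc k * (a + b)
      ≡⟨ regroup k a b c ⟩
    (suc (suc k) * c + suc k * b) + (suc k * b + k * a) + (a + b)
      ≡⟨ cong₂ (λ x y → x + y + (a + b)) (absorption n (suc k)) (absorption n k) ⟩
    n * b + n * a + (a + b)
      ≡⟨ collect n a b ⟩
    suc n * (a + b)
      ≡⟨ cong (suc n *_) (nCk+nC[k+1]≡[n+1]C[k+1] n k) ⟩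
    suc n * (suc n C suc k) ∎
    where
    open ≡-Reasoning
    a = n C k
    b = n C suc k
    c = n C suc (suc k)
    regroup : ∀ k a b c → suc (suc k) * (b + c) + suc k * (a + b) ≡ (suc (suc k) * c + suc k * b) + (suc k * b + k * a) + (a + b)
    regroup = solve-∀
    collect : ∀ n a b → n * b + n * a + (a + b) ≡ suc n * (a + b)
    collect = solve-∀

  absorption′ : ∀ {r} s j → s + j ≡ r → suc s * (r C suc s) ≡ j * (r C s)
  absorption′ {r} s j refl = +-cancelʳ-≡ (s * (r C s)) _ _ (begin
    suc s * (r C suc s) + s * (r C s)  ≡⟨ absorption r s ⟩
    (s + j) * (r C s)                  ≡⟨ arith s j (r C s) ⟩
    j * (r C s) + s * (r C s)          ∎)
    where
    open ≡-Reasoning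
    arith : ∀ s j c → (s + j) * c ≡ j * c + s * c
    arith = solve-∀

  0<nCk : ∀ {n k} → k ≤ n → 0 < n C k
  0<nCk {n}     {zero}  _         = subst (0 <_) (sym (nC0≡1 n)) z<s
  0<nCk {suc n} {suc k} (s≤s k≤n) = subst (0 <_) (nCk+nC[k+1]≡[n+1]C[k+1] n k) (≤-trans (0<nCk k≤n) (m≤m+n _ _))

  -- Unordered cliques in a list of vertices.

  module Unordered {A : Set} (adj : A → A → Bool) (adj-sym : ∀ u v → adj u v ≡ adj v u) (adj-irrefl : ∀ u → adj u u ≡ false) where

    keep : (A → Bool) → List A → List A
    keep p []       = []
    keep p (x ∷ xs) = if p x then x ∷ keep p xs else keep p xs

    -- Cliques are counted by their first vertex in the list. This recursion fits both the
    -- enumeration by `sublists` and the choice of a first vertex in an ordered clique.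
    K : ℕ → List A → ℕ
    K zero    _        = 1
    K (suc s) []       = 0
    K (suc s) (x ∷ xs) = K s (keep (adj x) xs) + K (suc s) xs

    ∑ˡ : List A → (A → ℕ) → ℕ
    ∑ˡ []       f = 0
    ∑ˡ (x ∷ xs) f = f x + ∑ˡ xs f

    ∑ˡ-cong : ∀ L {f g : A → ℕ} → (∀ x → f x ≡ g x) → ∑ˡ L f ≡ ∑ˡ L g
    ∑ˡ-cong []       e = refl
    ∑ˡ-cong (x ∷ xs) e = cong₂ _+_ (e x) (∑ˡ-cong xs e)

    ∑ˡ-+ : ∀ L (f g : A → ℕ) → ∑ˡ L (λ x → f x + g x) ≡ ∑ˡ L f + ∑ˡ L g
    ∑ˡ-+ []       f g = refl
    ∑ˡ-+ (x ∷ xs) f g = trans (cong (f x + g x +_) (∑ˡ-+ xs f g)) (arith (f x) (g x) (∑ˡ xs f) (∑ˡ xs g))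
      where
      arith : ∀ a b c d → a + b + (c + d) ≡ a + c + (b + d)
      arith = solve-∀

    ∑ˡ-keep : ∀ p L (f : A → ℕ) → ∑ˡ (keep p L) f ≡ ∑ˡ L λ x → ι (p x) * f x
    ∑ˡ-keep p []       f = refl
    ∑ˡ-keep p (x ∷ xs) f with p x
    ... | true  = cong₂ _+_ (sym (*-identityˡ (f x))) (∑ˡ-keep p xs f)
    ... | false = ∑ˡ-keep p xs f

    keep-keep : ∀ p q L → keep q (keep p L) ≡ keep (λ x → p x ∧ q x) L
    keep-keep p q []       = refl
    keep-keep p q (x ∷ xs) with p x
    ... | false = keep-keep p q xs
    ... | true  with q x
    ...   | false = keep-keep p q xs
    ...   | true  = cong (x ∷_) (keep-keep p q xs)

    keep-cong : ∀ {p q} L → (∀ x → p x ≡ q x) → keep p L ≡ keep q L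
    keep-cong []       e = refl
    keep-cong {p} {q} (x ∷ xs) e rewrite e x | keep-cong {p} {q} xs e = refl

    ∑ˡ-1 : ∀ L → ∑ˡ L (λ _ → 1) ≡ 1 * K 1 L
    ∑ˡ-1 []       = refl
    ∑ˡ-1 (x ∷ xs) = cong suc (∑ˡ-1 xs)

    -- Each (s+1)-clique is found once from each of its s + 1 vertices. The induction separates the
    -- cliques that contain the head x from those that do not.
    ∑-K-neighbourhood : ∀ s L → ∑ˡ L (λ w → K s (keep (adj w) L)) ≡ suc s * K (suc s) L
    ∑-K-neighbourhood zero    L        = ∑ˡ-1 L
    ∑-K-neighbourhood (suc s) []       = sym (*-zeroʳ s)
    ∑-K-neighbourhood (suc s) (x ∷ xs) = begin
      K (suc s) (keep (adj x) (x ∷ xs)) + ∑ˡ xs (λ w → K (suc s) (keep (adj w) (x ∷ xs)))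
        ≡⟨ cong₂ _+_ (cong (K (suc s)) self) (∑ˡ-cong xs split) ⟩
      K (suc s) X + ∑ˡ xs (λ w → ι (adj x w) * K s (keep (adj w) X) + K (suc s) (keep (adj w) xs))
        ≡⟨ cong (K (suc s) X +_) (trans (∑ˡ-+ xs _ _) (cong₂ _+_
             (trans (sym (∑ˡ-keep (adj x) xs λ w → K s (keep (adj w) X))) (∑-K-neighbourhood s X))
             (∑-K-neighbourhood (suc s) xs))) ⟩
      K (suc s) X + (suc s * K (suc s) X + suc (suc s) * K (suc (suc s)) xs)
        ≡⟨ arith s (K (suc s) X) (K (suc (suc s)) xs) ⟩
      suc (suc s) * (K (suc s) X + K (suc (suc s)) xs) ∎
      where
      open ≡-Reasoning
      X = keep (adj x) xs
      self : keep (adj x) (x ∷ xs) ≡ X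
      self rewrite adj-irrefl x = refl
      split : ∀ w → K (suc s) (keep (adj w) (x ∷ xs)) ≡ ι (adj x w) * K s (keep (adj w) X) + K (suc s) (keep (adj w) xs)
      split w rewrite adj-sym w x with adj x w
      ... | false = refl
      ... | true  = cong (_+ K (suc s) (keep (adj w) xs)) (trans
        (cong (K s) (trans (keep-keep (adj w) (adj x) xs) (trans (keep-cong xs λ y → Bool.∧-comm (adj w y) (adj x y)) (sym (keep-keep (adj x) (adj w) xs)))))
        (sym (*-identityˡ _)))
      arith : ∀ s a b → a + (suc s * a + suc (suc s) * b) ≡ suc (suc s) * (a + b)
      arith = solve-∀

  count : {A : Set} → (A → Bool) → List A → ℕ
  count p []       = 0
  count p (x ∷ xs) = ι (p x) + count p xs

  length-filter : {A : Set} {P : A → Set} (P? : Decidable P) (L : List A) → length (filter P? L) ≡ count (does ∘ P?) L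
  length-filter P? []       = refl
  length-filter P? (x ∷ xs) with does (P? x)
  ... | true  = cong suc (length-filter P? xs)
  ... | false = length-filter P? xs

  count-cong : {A : Set} {p q : A → Bool} (L : List A) → (∀ x → p x ≡ q x) → count p L ≡ count q L
  count-cong []       e = refl
  count-cong (x ∷ xs) e = cong₂ _+_ (cong ι (e x)) (count-cong xs e)

  count-false : {A : Set} (L : List A) → count (λ _ → false) L ≡ 0
  count-false []       = refl
  count-false (x ∷ xs) = count-false xs

  count-++ : {A : Set} (p : A → Bool) (L M : List A) → count p (L ++ M) ≡ count p L + count p M
  count-++ p []       M = refl
  count-++ p (x ∷ xs) M = trans (cong (ι (p x) +_) (count-++ p xs M)) (sym (+-assoc (ι (p x)) _ _))

  count-map : {A B : Set} (p : B → Bool) (f : A → B) (L : List A) → count p (map f L) ≡ count (p ∘ f) L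
  count-map p f []       = refl
  count-map p f (x ∷ xs) = cong (ι (p (f x)) +_) (count-map p f xs)

  -- Agreement of the clique counts, and cliques against edges.

  module Adjacency {n : ℕ} (G : Graph n) where
    open Graph G

    adj : Fin n → Fin n → Bool
    adj u v = does (u ~? v)

    adj-sym : ∀ u v → adj u v ≡ adj v u
    adj-sym u v = does-⇔ (mk⇔ ~-sym ~-sym) (u ~? v) (v ~? u)

    adj-irrefl : ∀ u → adj u u ≡ false
    adj-irrefl u = dec-false (u ~? u) (~-irrefl refl)

    adj⇒~ : ∀ {u v} → adj u v ≡ true → u ~ v
    adj⇒~ {u} {v} e with u ~? v
    ... | yes p = p
    adj⇒~ () | no _

    open Ordered adj adj-sym public
    open Unordered adj adj-sym adj-irrefl public

    everyᵇ : (Fin n → Bool) → List (Fin n) → Bool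
    everyᵇ p []       = true
    everyᵇ p (x ∷ xs) = p x ∧ everyᵇ p xs

    cliqueᵇ : ℕ → List (Fin n) → Bool
    cliqueᵇ zero    []       = true
    cliqueᵇ zero    (x ∷ xs) = false
    cliqueᵇ (suc s) []       = false
    cliqueᵇ (suc s) (x ∷ xs) = everyᵇ (adj x) xs ∧ cliqueᵇ s xs

    everyᵇ-does : ∀ x vs → does (all? (x ~?_) vs) ≡ everyᵇ (adj x) vs
    everyᵇ-does x []       = refl
    everyᵇ-does x (v ∷ vs) = cong (adj x v ∧_) (everyᵇ-does x vs)

    isClique?-does : ∀ s vs → does (isClique? G s vs) ≡ cliqueᵇ s vs
    isClique?-does zero    []       = refl
    isClique?-does zero    (x ∷ xs) = refl
    isClique?-does (suc s) []       = refl
    isClique?-does (suc s) (x ∷ xs) = trans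
      (∧-left-comm (does (length xs ≟ s)) (does (all? (x ~?_) xs)) (does (allPairs? _~?_ xs)))
      (cong₂ _∧_ (everyᵇ-does x xs) (isClique?-does s xs))
      where
      ∧-left-comm : ∀ a b c → a ∧ (b ∧ c) ≡ b ∧ (a ∧ c)
      ∧-left-comm false false c = refl
      ∧-left-comm false true  c = refl
      ∧-left-comm true  b     c = refl

    everyᵇ-∧ : ∀ p q vs → everyᵇ p vs ∧ everyᵇ q vs ≡ everyᵇ (λ x → p x ∧ q x) vs
    everyᵇ-∧ p q []       = refl
    everyᵇ-∧ p q (x ∷ xs) = trans (interchange (p x) (everyᵇ p xs) (q x) (everyᵇ q xs)) (cong ((p x ∧ q x) ∧_) (everyᵇ-∧ p q xs))
      where
      interchange : ∀ a b c d → (a ∧ b) ∧ (c ∧ d) ≡ (a ∧ c) ∧ (b ∧ d)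
      interchange false b c     d = refl
      interchange true  b true  d = refl
      interchange true  b false d = Bool.∧-zeroʳ b

    -- The predicate `p` makes the induction pass: once x is chosen, the remaining vertices must lie
    -- in `p` and be adjacent to x.
    count-sublists : ∀ s p L → count (λ vs → everyᵇ p vs ∧ cliqueᵇ s vs) (sublists L) ≡ K s (keep p L)
    count-sublists zero    p []       = refl
    count-sublists (suc s) p []       = refl
    count-sublists s       p (x ∷ xs) = trans (trans
      (count-++ (λ vs → everyᵇ p vs ∧ cliqueᵇ s vs) (map (x ∷_) (sublists xs)) (sublists xs))
      (cong₂ _+_ (count-map (λ vs → everyᵇ p vs ∧ cliqueᵇ s vs) (x ∷_) (sublists xs)) (count-sublists s p xs)))
      (head s)
      where
      head : ∀ s → count (λ vs → (p x ∧ everyᵇ p vs) ∧ cliqueᵇ s (x ∷ vs)) (sublists xs) + K s (keep p xs) ≡ K s (keep p (x ∷ xs))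
      head s       with p x
      head s       | false = cong (_+ K s (keep p xs)) (count-false (sublists xs))
      head zero    | true  = cong (_+ 1) (trans (count-cong (sublists xs) λ vs → Bool.∧-zeroʳ (everyᵇ p vs)) (count-false (sublists xs)))
      head (suc s) | true  = cong (_+ K (suc s) (keep p xs)) (trans
        (count-cong (sublists xs) λ vs → trans (sym (Bool.∧-assoc (everyᵇ p vs) (everyᵇ (adj x) vs) (cliqueᵇ s vs)))
          (cong (_∧ cliqueᵇ s vs) (everyᵇ-∧ p (adj x) vs)))
        (trans (count-sublists s (λ y → p y ∧ adj x y) xs) (cong (K s) (sym (keep-keep p (adj x) xs)))))

    keep-true : ∀ L → keep (λ _ → true) L ≡ L
    keep-true []       = refl
    keep-true (x ∷ xs) = cong (x ∷_) (keep-true xs)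

    everyᵇ-true : ∀ vs → everyᵇ (λ _ → true) vs ≡ true
    everyᵇ-true []       = refl
    everyᵇ-true (x ∷ xs) = everyᵇ-true xs

    cliqueCount≡K : ∀ s → cliqueCount G s ≡ K s (allFin n)
    cliqueCount≡K s = trans (length-filter (isClique? G s) (sublists (allFin n)))
      (trans (count-cong (sublists (allFin n)) λ vs → trans (isClique?-does s vs) (cong (_∧ cliqueᵇ s vs) (sym (everyᵇ-true vs))))
        (trans (count-sublists s (λ _ → true) (allFin n)) (cong (K s) (keep-true (allFin n)))))

    ∑ˡ-tabulate : ∀ {m} (g : Fin m → Fin n) (f : Fin n → ℕ) → ∑ˡ (tabulate g) f ≡ ∑ λ i → f (g i)
    ∑ˡ-tabulate {zero}  g f = refl
    ∑ˡ-tabulate {suc m} g f = cong (f (g zero) +_) (∑ˡ-tabulate (λ i → g (suc i)) f)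

    every : ∀ {s} → (Fin n → Bool) → Vec (Fin n) s → ℕ
    every p []      = 1
    every p (v ∷ T) = ι (p v) * every p T

    every-∧ : ∀ {s} p w (T : Vec (Fin n) s) → every (λ x → p x ∧ adj w x) T ≡ every p T * joined w T
    every-∧ p w []      = refl
    every-∧ p w (v ∷ T) = trans (cong₂ _*_ (ι-∧ (p v) (adj w v)) (every-∧ p w T))
      (interchange (ι (p v)) (ι (adj w v)) (every p T) (joined w T))
      where
      interchange : ∀ a b c d → a * b * (c * d) ≡ a * c * (b * d)
      interchange = solve-∀

    -- Again `p` is free, since the first vertex w of an ordered clique confines the others to its
    -- neighbourhood. The factor s + 1 of `∑-K-neighbourhood` builds up the factorial.
    ordered-in : ∀ s p → s ! * K s (keep p (allFin n)) ≡ ∑ᵛ s λ T → every p T * clique T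
    ordered-in zero    p = refl
    ordered-in (suc s) p = begin
      suc s * s ! * K (suc s) L
        ≡⟨ trans (cong (_* K (suc s) L) (*-comm (suc s) (s !))) (*-assoc (s !) (suc s) _) ⟩
      s ! * (suc s * K (suc s) L)
        ≡⟨ cong (s ! *_) (sym (∑-K-neighbourhood s L)) ⟩
      s ! * ∑ˡ L (λ w → K s (keep (adj w) L))
        ≡⟨ cong (s ! *_) (trans (∑ˡ-keep p (allFin n) _) (∑ˡ-tabulate (λ i → i) _)) ⟩
      s ! * ∑ (λ w → ι (p w) * K s (keep (adj w) L))
        ≡⟨ *-distribˡ-sum (s !) (λ w → ι (p w) * K s (keep (adj w) L)) ⟩
      ∑ (λ w → s ! * (ι (p w) * K s (keep (adj w) L)))
        ≡⟨ ∑-cong step ⟩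
      ∑ (λ w → ∑ᵛ s λ T → ι (p w) * every p T * (joined w T * clique T)) ∎
      where
      open ≡-Reasoning
      L = keep p (allFin n)
      left-comm : ∀ a b c → a * (b * c) ≡ b * (a * c)
      left-comm = solve-∀
      assoc₄ : ∀ a b c d → a * (b * c * d) ≡ a * b * (c * d)
      assoc₄ = solve-∀
      step : ∀ w → s ! * (ι (p w) * K s (keep (adj w) L)) ≡ ∑ᵛ s λ T → ι (p w) * every p T * (joined w T * clique T)
      step w = begin
        s ! * (ι (p w) * K s (keep (adj w) L))
          ≡⟨ left-comm (s !) (ι (p w)) _ ⟩
        ι (p w) * (s ! * K s (keep (adj w) L))
          ≡⟨ cong (ι (p w) *_) (trans (cong (λ M → s ! * K s M) (keep-keep p (adj w) (allFin n))) (ordered-in s (λ x → p x ∧ adj w x))) ⟩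
        ι (p w) * ∑ᵛ s (λ T → every (λ x → p x ∧ adj w x) T * clique T)
          ≡⟨ sym (∑ᵛ-* s (ι (p w)) _) ⟩
        ∑ᵛ s (λ T → ι (p w) * (every (λ x → p x ∧ adj w x) T * clique T))
          ≡⟨ ∑ᵛ-cong s (λ T → trans (cong (λ z → ι (p w) * (z * clique T)) (every-∧ p w T)) (assoc₄ (ι (p w)) (every p T) (joined w T) (clique T))) ⟩
        ∑ᵛ s (λ T → ι (p w) * every p T * (joined w T * clique T)) ∎

    every-true : ∀ {s} (T : Vec (Fin n) s) → every (λ _ → true) T ≡ 1
    every-true []      = refl
    every-true (v ∷ T) = trans (*-identityˡ _) (every-true T)

    h≡s!k : ∀ s → h s ≡ s ! * cliqueCount G s
    h≡s!k s = sym (begin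
      s ! * cliqueCount G s
        ≡⟨ cong (s ! *_) (trans (cliqueCount≡K s) (cong (K s) (sym (keep-true (allFin n))))) ⟩
      s ! * K s (keep (λ _ → true) (allFin n))
        ≡⟨ ordered-in s (λ _ → true) ⟩
      ∑ᵛ s (λ T → every (λ _ → true) T * clique T)
        ≡⟨ ∑ᵛ-cong s (λ T → trans (cong (_* clique T) (every-true T)) (*-identityˡ (clique T))) ⟩
      h s ∎)
      where open ≡-Reasoning

    ∑∑-adj : ∑∑ (λ u v → ι (adj u v)) ≡ 2 * cliqueCount G 2
    ∑∑-adj = trans (∑∑-cong λ u v → unit (ι (adj u v))) (h≡s!k 2)
      where
      unit : ∀ a → a ≡ a * 1 * (1 * 1)
      unit = solve-∀

    cliqueFree⇒h≡0 : ∀ s → CliqueFree G s → h s ≡ 0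
    cliqueFree⇒h≡0 s free = trans (h≡s!k s) (trans (cong (s ! *_)
      (trans (length-filter (isClique? G s) (sublists (allFin n)))
        (trans (count-cong (sublists (allFin n)) λ vs → dec-false (isClique? G s vs) (free vs)) (count-false (sublists (allFin n))))))
      (*-zeroʳ (s !)))

    -- The bounds turán-ratio telescope.
    cliques≤edges : .{{_ : NonZero n}} → ∀ r → CliqueFree G (suc r) → ∀ t → 2 + t ≤ r →
                    (r C 2) * (r ^ t * cliqueCount G (2 + t)) ≤ (r C (2 + t)) * (n ^ t * cliqueCount G 2)
    cliques≤edges r free zero    _   = ≤-refl
    cliques≤edges r free (suc t) s<r = *-cancelˡ-≤ (suc s) (begin
      suc s * ((r C 2) * (r * r ^ t * k (suc s)))
        ≡⟨ front (suc s) (r C 2) r (r ^ t) (k (suc s)) ⟩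
      (r C 2) * r ^ t * (r * (suc s * k (suc s)))
        ≤⟨ *-monoʳ-≤ ((r C 2) * r ^ t) ratio ⟩
      (r C 2) * r ^ t * (j * (n * k s))
        ≡⟨ middle (r C 2) (r ^ t) j n (k s) ⟩
      j * (n * ((r C 2) * (r ^ t * k s)))
        ≤⟨ *-monoʳ-≤ j (*-monoʳ-≤ n (cliques≤edges r free t (<⇒≤ s<r))) ⟩
      j * (n * ((r C s) * (n ^ t * k 2)))
        ≡⟨ back j n (r C s) (n ^ t) (k 2) ⟩
      j * (r C s) * (n * n ^ t * k 2)
        ≡⟨ cong (_* (n * n ^ t * k 2)) (sym (absorption′ s j s+j≡r)) ⟩
      suc s * (r C suc s) * (n * n ^ t * k 2)
        ≡⟨ *-assoc (suc s) (r C suc s) _ ⟩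
      suc s * ((r C suc s) * (n * n ^ t * k 2)) ∎)
      where
      open ≤-Reasoning
      s = 2 + t
      k = cliqueCount G
      j = r ∸ s
      s+j≡r : s + j ≡ r
      s+j≡r = m+[n∸m]≡n (<⇒≤ s<r)
      ratio : r * (suc s * k (suc s)) ≤ j * (n * k s)
      ratio = *-cancelˡ-≤ (s !) {{s !≢0}} (subst₂ _≤_
        (trans (cong (r *_) (h≡s!k (suc s))) (lhs r (suc s) (s !) (k (suc s))))
        (trans (cong (λ z → j * (n * z)) (h≡s!k s)) (rhs j n (s !) (k s)))
        (turán-ratio r (cliqueFree⇒h≡0 (suc r) free) j s s+j≡r))
        where
        lhs : ∀ r s f k → r * (s * f * k) ≡ f * (r * (s * k))
        lhs = solve-∀
        rhs : ∀ j n f k → j * (n * (f * k)) ≡ f * (j * (n * k))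
        rhs = solve-∀
      front : ∀ s c r p k → s * (c * (r * p * k)) ≡ c * p * (r * (s * k))
      front = solve-∀
      middle : ∀ c p j n k → c * p * (j * (n * k)) ≡ j * (n * (c * (p * k)))
      middle = solve-∀
      back : ∀ j n c p k → j * (n * (c * (p * k))) ≡ j * c * (n * p * k)
      back = solve-∀

  -- Füredi's partition and its improvement by local search.

  module Partition {n : ℕ} (G : Graph n) where
    open Graph G
    open Adjacency G

    NoClique : ℕ → (Fin n → Bool) → Set
    NoClique k p = ∀ vs → All (λ v → p v ≡ true) vs → ¬ IsClique G k vs

    neighbourhood-NoClique : ∀ {k p x} → NoClique (suc k) p → p x ≡ true → NoClique k (λ u → p u ∧ adj x u)
    neighbourhood-NoClique {p = p} {x} free px vs in-p (len , pairs) = free (x ∷ vs)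
      (px ∷ All.map (λ {u} → ∧-left (p u)) in-p)
      (cong suc len , All.map (λ {u} e → adj⇒~ (∧-right (p u) e)) in-p ∷ pairs)

    -- Füredi's argument: put the non-neighbours of a vertex of maximum degree
    -- into one class, and continue inside its neighbourhood.
    füredi : ∀ q p → NoClique (2 + q) p → Σ[ c ∈ (Fin n → Fin (suc q)) ]
      ∑∑ (λ u v → ι (p u ∧ p v) * (ι (adj u v) + ι (adj u v ∧ (c u ≡ᶠ c v))))
        ≤ ∑∑ (λ u v → ι (p u ∧ p v) * ι (not (c u ≡ᶠ c v)))
    füredi zero p free = (λ _ → zero) , ∑∑-mono λ u v → none u v
      where
      none : ∀ u v → ι (p u ∧ p v) * (ι (adj u v) + ι (adj u v ∧ true)) ≤ ι (p u ∧ p v) * 0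
      none u v with p u in pu | p v in pv | adj u v in uv
      ... | false | _     | _     = z≤n
      ... | true  | false | _     = z≤n
      ... | true  | true  | false = z≤n
      ... | true  | true  | true  = ⊥-elim (free (u ∷ v ∷ []) (pu ∷ pv ∷ []) (refl , (adj⇒~ uv ∷ []) ∷ [] ∷ []))
    füredi (suc q) p free with Fin.any? (λ x → p x Bool.≟ true)
    ... | no ∄x = (λ _ → zero) , ∑∑-mono λ u v → none u v
      where
      none : ∀ u v → ι (p u ∧ p v) * (ι (adj u v) + ι (adj u v ∧ true)) ≤ ι (p u ∧ p v) * 0
      none u v with p u in pu
      ... | false = z≤n
      ... | true  = ⊥-elim (∄x (u , pu))
    ... | yes (x₀ , px₀) = c , (begin
        ∑∑ (λ u v → ι (p u ∧ p v) * (ι (adj u v) + ι (adj u v ∧ (c u ≡ᶠ c v))))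
          ≤⟨ ∑∑-mono lower ⟩
        ∑∑ (λ u v → inner u v + (O u v + O v u))
          ≡⟨ trans (∑∑-distrib-+ inner _) (cong (∑∑ inner +_) (trans (∑∑-distrib-+ O _) (cong (∑∑ O +_) (sym (∑-comm {n} {n} O))))) ⟩
        ∑∑ inner + (∑∑ O + ∑∑ O)
          ≤⟨ +-mono-≤ (proj₂ IH) (+-mono-≤ degree-bound degree-bound) ⟩
        ∑∑ inner′ + (∑∑ R + ∑∑ R)
          ≡⟨ trans (∑∑-distrib-+ inner′ _) (cong (∑∑ inner′ +_) (trans (∑∑-distrib-+ R _) (cong (∑∑ R +_) (sym (∑-comm {n} {n} R))))) ⟨
        ∑∑ (λ u v → inner′ u v + (R u v + R v u))
          ≤⟨ ∑∑-mono upper ⟩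
        ∑∑ (λ u v → ι (p u ∧ p v) * ι (not (c u ≡ᶠ c v))) ∎)
      where
      open ≤-Reasoning
      deg : Fin n → ℕ
      deg u = ∑ λ v → ι (p v ∧ adj u v)
      best = argmax-on p deg x₀ px₀
      x = proj₁ best
      p′ : Fin n → Bool
      p′ u = p u ∧ adj x u
      out : Fin n → Bool
      out u = p u ∧ not (adj x u)
      IH = füredi q p′ (neighbourhood-NoClique {p = p} free (proj₁ (proj₂ best)))
      c′ = proj₁ IH
      c : Fin n → Fin (suc (suc q))
      c u = if adj x u then suc (c′ u) else zero
      inner inner′ O R : Fin n → Fin n → ℕ
      inner u v = ι (p′ u ∧ p′ v) * (ι (adj u v) + ι (adj u v ∧ (c′ u ≡ᶠ c′ v)))
      inner′ u v = ι (p′ u ∧ p′ v) * ι (not (c′ u ≡ᶠ c′ v))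
      O u v = ι (out u) * ι (p v ∧ adj u v)
      R u v = ι (out u) * ι (p′ v)
      -- An edge inside `out` is monochromatic and weighs 2, and both `O u v` and `O v u` count it;
      -- an edge between `out` and `p′` weighs 1 and is counted once. So the degrees of the vertices
      -- of `out` pay for all of these edges.
      lower : ∀ u v → ι (p u ∧ p v) * (ι (adj u v) + ι (adj u v ∧ (c u ≡ᶠ c v))) ≤ inner u v + (O u v + O v u)
      lower u v rewrite adj-sym v u with p u | p v | adj x u | adj x v | adj u v
      ... | false | _     | _     | _     | _     = z≤n
      ... | true  | false | _     | _     | _     = z≤n
      ... | true  | true  | true  | true  | _     = m≤m+n _ _
      ... | true  | true  | true  | false | false = z≤n
      ... | true  | true  | true  | false | true  = ≤-refl
      ... | true  | true  | false | true  | false = z≤n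
      ... | true  | true  | false | true  | true  = ≤-refl
      ... | true  | true  | false | false | false = z≤n
      ... | true  | true  | false | false | true  = ≤-refl
      upper : ∀ u v → inner′ u v + (R u v + R v u) ≤ ι (p u ∧ p v) * ι (not (c u ≡ᶠ c v))
      upper u v with p u | p v | adj x u | adj x v
      ... | false | false | _     | _     = z≤n
      ... | false | true  | _     | true  = z≤n
      ... | false | true  | _     | false = z≤n
      ... | true  | false | true  | true  = z≤n
      ... | true  | false | true  | false = z≤n
      ... | true  | false | false | true  = z≤n
      ... | true  | false | false | false = z≤n
      ... | true  | true  | true  | true  = ≤-reflexive (+-identityʳ _)
      ... | true  | true  | true  | false = ≤-refl
      ... | true  | true  | false | true  = ≤-refl
      ... | true  | true  | false | false = z≤n
      -- A vertex of `out` has degree at most that of `x`, and the degree of `x` is the size of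
      -- `p′`.
      degree-bound : ∑∑ O ≤ ∑∑ R
      degree-bound = ∑-mono λ u → subst₂ _≤_ (*-distribˡ-sum {n} (ι (out u)) _) (*-distribˡ-sum {n} (ι (out u)) _) (row u)
        where
        row : ∀ u → ι (out u) * deg u ≤ ι (out u) * deg x
        row u with p u in pu | adj x u
        ... | false | _     = z≤n
        ... | true  | true  = z≤n
        ... | true  | false = *-monoʳ-≤ 1 (proj₂ (proj₂ best) u pu)

    module _ {r : ℕ} where

      -- Ordered pairs are counted, so this is twice the number of monochromatic edges.
      loss : (Fin n → Fin r) → ℕ
      loss c = ∑∑ λ u v → ι (adj u v ∧ (c u ≡ᶠ c v))

      degreeTo : (Fin n → Fin r) → Fin n → Fin r → ℕ
      degreeTo c v j = ∑ λ w → ι (adj v w ∧ (j ≡ᶠ c w))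

      recolour : (Fin n → Fin r) → Fin n → Fin r → Fin n → Fin r
      recolour c v j u = if v ≡ᶠ u then j else c u

      -- Only the ordered pairs (v, w) and (w, v) change, hence the factors 2. Irreflexivity
      -- disposes of the pair (v, v).
      loss-recolour : ∀ c v j → loss (recolour c v j) + 2 * degreeTo c v (c v) ≡ loss c + 2 * degreeTo c v j
      loss-recolour c v j = begin
        loss c′ + 2 * degreeTo c v (c v)
          ≡⟨ cong (loss c′ +_) (sym (both (c v))) ⟩
        loss c′ + (∑∑ (A (c v)) + ∑∑ (B (c v)))
          ≡⟨ trans (∑∑-distrib-+ {n} {n} _ _) (cong (loss c′ +_) (∑∑-distrib-+ (A (c v)) (B (c v)))) ⟨
        ∑∑ (λ u w → ι (adj u w ∧ (c′ u ≡ᶠ c′ w)) + (A (c v) u w + B (c v) u w))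
          ≡⟨ ∑∑-cong pointwise ⟩
        ∑∑ (λ u w → ι (adj u w ∧ (c u ≡ᶠ c w)) + (A j u w + B j u w))
          ≡⟨ trans (∑∑-distrib-+ {n} {n} _ _) (cong (loss c +_) (∑∑-distrib-+ (A j) (B j))) ⟩
        loss c + (∑∑ (A j) + ∑∑ (B j))
          ≡⟨ cong (loss c +_) (both j) ⟩
        loss c + 2 * degreeTo c v j ∎
        where
        open ≡-Reasoning
        c′ = recolour c v j
        A B : Fin r → Fin n → Fin n → ℕ
        A i u w = ι (v ≡ᶠ u) * ι (adj u w ∧ (i ≡ᶠ c w))
        B i u w = ι (v ≡ᶠ w) * ι (adj w u ∧ (i ≡ᶠ c u))
        ∑∑A : ∀ i → ∑∑ (A i) ≡ degreeTo c v i
        ∑∑A i = trans (∑-cong λ u → sym (*-distribˡ-sum {n} (ι (v ≡ᶠ u)) _)) (∑-≡ᶠ {n} (λ u → degreeTo c u i) v)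
        both : ∀ i → ∑∑ (A i) + ∑∑ (B i) ≡ 2 * degreeTo c v i
        both i = trans (cong₂ _+_ (∑∑A i) (trans (∑-comm {n} {n} (B i)) (∑∑A i))) (double (degreeTo c v i))
          where
          double : ∀ a → a + a ≡ 2 * a
          double = solve-∀
        pointwise : ∀ u w → ι (adj u w ∧ (c′ u ≡ᶠ c′ w)) + (A (c v) u w + B (c v) u w)
                          ≡ ι (adj u w ∧ (c u ≡ᶠ c w)) + (A j u w + B j u w)
        pointwise u w with v Fin.≟ u | v Fin.≟ w
        ... | no _     | no _     = refl
        ... | yes refl | yes refl rewrite adj-irrefl v = refl
        ... | yes refl | no _     = swap (ι (adj v w ∧ (j ≡ᶠ c w))) (ι (adj v w ∧ (c v ≡ᶠ c w)))
          where
          swap : ∀ a b → a + (b + 0 + 0) ≡ b + (a + 0 + 0)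
          swap = solve-∀
        ... | no _     | yes refl rewrite adj-sym u v | ≡ᶠ-sym (c u) j | ≡ᶠ-sym (c u) (c v) =
          swap (ι (adj v u ∧ (j ≡ᶠ c u))) (ι (adj v u ∧ (c v ≡ᶠ c u)))
          where
          swap : ∀ a b → a + (0 + (b + 0)) ≡ b + (0 + (a + 0))
          swap = solve-∀

      Optimal : (Fin n → Fin r) → Set
      Optimal c = ∀ v j → degreeTo c v (c v) ≤ degreeTo c v j

      -- The bound `b` is the fuel of the local search: every improving move lowers the loss, so the
      -- next call needs one unit less.
      descend : ∀ b c → loss c < b → Σ[ c′ ∈ (Fin n → Fin r) ] loss c′ ≤ loss c × Optimal c′
      descend zero    c ()
      descend (suc b) c (s≤s lt) with Fin.any? (λ v → Fin.any? λ j → degreeTo c v j <? degreeTo c v (c v))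
      ... | no  opt = c , ≤-refl , λ v j → ≮⇒≥ (λ improve → opt (v , j , improve))
      ... | yes (v , j , improve) =
        let c′ , le , opt = descend b (recolour c v j) (<-≤-trans decrease lt)
        in c′ , ≤-trans le (<⇒≤ decrease) , opt
        where
        decrease : loss (recolour c v j) < loss c
        decrease = +-cancelʳ-< (2 * degreeTo c v j) _ _ (subst (loss (recolour c v j) + 2 * degreeTo c v j <_)
          (loss-recolour c v j) (+-monoʳ-< (loss (recolour c v j)) (*-monoʳ-< 2 improve)))

    furedi-loss : ∀ r → CliqueFree G (suc (suc r)) → Σ[ c ∈ (Fin n → Fin (suc r)) ]
      ∑∑ (λ u v → ι (adj u v)) + loss c ≤ ∑∑ (λ u v → ι (not (c u ≡ᶠ c v)))
    furedi-loss r free =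
      let c , le = füredi r (λ _ → true) (λ vs _ → free vs)
      in c , subst₂ _≤_
        (trans (∑∑-cong {n} {n} λ u v → *-identityˡ (ι (adj u v) + ι (adj u v ∧ (c u ≡ᶠ c v)))) (∑∑-distrib-+ {n} {n} (λ u v → ι (adj u v)) _))
        (∑∑-cong {n} {n} λ u v → *-identityˡ (ι (not (c u ≡ᶠ c v)))) le

  -- Missing pairs found by averaging over transversals.

  module Transversal {n : ℕ} (G : Graph n) where
    open Graph G
    open Adjacency G

    nonadj : Fin n → Fin n → ℕ
    nonadj u v = ι (not (adj u v))

    -- W is a family of q vertex sets; ∑ᵗ sums over its transversals.
    ∑ᵗ : ∀ {q} → (Fin q → Fin n → Bool) → (Vec (Fin n) q → ℕ) → ℕ
    ∑ᵗ {zero}  W F = F []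
    ∑ᵗ {suc q} W F = ∑ λ w → ι (W zero w) * ∑ᵗ (λ i → W (suc i)) (λ T → F (w ∷ T))

    missed : ∀ {q} → Fin n → Vec (Fin n) q → ℕ
    missed w []      = 0
    missed w (v ∷ T) = nonadj w v + missed w T

    defect : ∀ {q} → Vec (Fin n) q → ℕ
    defect []      = 0
    defect (w ∷ T) = missed w T + defect T

    ∑ᵗ-mono : ∀ {q} (W : Fin q → Fin n → Bool) {F F′ : Vec (Fin n) q → ℕ} →
              (∀ T → (∀ i → W i (lookup T i) ≡ true) → F T ≤ F′ T) → ∑ᵗ W F ≤ ∑ᵗ W F′
    ∑ᵗ-mono {zero}  W h = h [] λ ()
    ∑ᵗ-mono {suc q} W {F} {F′} h = ∑-mono row
      where
      row : ∀ w → ι (W zero w) * ∑ᵗ (λ i → W (suc i)) (λ T → F (w ∷ T))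
                ≤ ι (W zero w) * ∑ᵗ (λ i → W (suc i)) (λ T → F′ (w ∷ T))
      row w with W zero w in e
      ... | false = z≤n
      ... | true  = *-monoʳ-≤ 1 (∑ᵗ-mono (λ i → W (suc i)) λ T inT → h (w ∷ T) λ { zero → e ; (suc i) → inT i })

    ∑ᵗ-+ : ∀ {q} (W : Fin q → Fin n → Bool) (F F′ : Vec (Fin n) q → ℕ) → ∑ᵗ W (λ T → F T + F′ T) ≡ ∑ᵗ W F + ∑ᵗ W F′
    ∑ᵗ-+ {zero}  W F F′ = refl
    ∑ᵗ-+ {suc q} W F F′ = trans
      (∑-cong λ w → trans (cong (ι (W zero w) *_) (∑ᵗ-+ (λ i → W (suc i)) (λ T → F (w ∷ T)) (λ T → F′ (w ∷ T))))
                          (*-distribˡ-+ (ι (W zero w)) _ _))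
      (∑-distrib-+ {n} _ _)

    module Uniform (k : ℕ) where

      row : ∀ {q} → (Fin q → Fin n → Bool) → Fin n → ℕ
      row {zero}  W w = 0
      row {suc q} W w = ∑ (λ v → ι (W zero v) * nonadj w v) + row (λ i → W (suc i)) w

      total : ∀ {q} → (Fin q → Fin n → Bool) → ℕ
      total {zero}  W = 0
      total {suc q} W = ∑ (λ w → ι (W zero w) * row (λ i → W (suc i)) w) + total (λ i → W (suc i))

      ∑ᵗ-const : ∀ {q} (W : Fin q → Fin n → Bool) → (∀ i → ∑ (λ v → ι (W i v)) ≡ k) → ∀ a → ∑ᵗ W (λ _ → a) ≡ k ^ q * a
      ∑ᵗ-const {zero}  W size a = sym (*-identityˡ a)
      ∑ᵗ-const {suc q} W size a = begin
        ∑ (λ w → ι (W zero w) * ∑ᵗ (λ i → W (suc i)) (λ _ → a))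
          ≡⟨ ∑-cong (λ w → cong (ι (W zero w) *_) (∑ᵗ-const (λ i → W (suc i)) (λ i → size (suc i)) a)) ⟩
        ∑ (λ w → ι (W zero w) * (k ^ q * a))
          ≡⟨ *-distribʳ-sum {n} (k ^ q * a) _ ⟨
        ∑ (λ w → ι (W zero w)) * (k ^ q * a)
          ≡⟨ cong (_* (k ^ q * a)) (size zero) ⟩
        k * (k ^ q * a)
          ≡⟨ *-assoc k (k ^ q) a ⟨
        k * k ^ q * a ∎
        where open ≡-Reasoning

      -- A vertex of one of the sets lies on k^(q-1) transversals. The factor `k` on the left keeps
      -- the exponent at `q`, so that the empty family needs no special form.
      ∑ᵗ-missed : ∀ {q} (W : Fin q → Fin n → Bool) → (∀ i → ∑ (λ v → ι (W i v)) ≡ k) → ∀ w →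
                  k * ∑ᵗ W (missed w) ≡ k ^ q * row W w
      ∑ᵗ-missed {zero}  W size w = *-zeroʳ k
      ∑ᵗ-missed {suc q} W size w = begin
        k * ∑ (λ v → ι (W zero v) * ∑ᵗ W′ (λ T → nonadj w v + missed w T))
          ≡⟨ cong (k *_) (trans (∑-cong λ v → trans (cong (ι (W zero v) *_) (trans (∑ᵗ-+ W′ _ _)
               (cong (_+ ∑ᵗ W′ (missed w)) (∑ᵗ-const W′ size′ (nonadj w v))))) (expand (ι (W zero v)) (k ^ q) (nonadj w v) _))
               (∑-distrib-+ {n} _ _)) ⟩
        k * (∑ (λ v → k ^ q * (ι (W zero v) * nonadj w v)) + ∑ (λ v → ι (W zero v) * ∑ᵗ W′ (missed w)))
          ≡⟨ cong₂ (λ a b → k * (a + b)) (sym (*-distribˡ-sum {n} (k ^ q) _)) (trans (sym (*-distribʳ-sum {n} (∑ᵗ W′ (missed w)) _)) (cong (_* ∑ᵗ W′ (missed w)) (size zero))) ⟩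
        k * (k ^ q * ∑ (λ v → ι (W zero v) * nonadj w v) + k * ∑ᵗ W′ (missed w))
          ≡⟨ cong (λ z → k * (k ^ q * ∑ (λ v → ι (W zero v) * nonadj w v) + z)) (∑ᵗ-missed W′ size′ w) ⟩
        k * (k ^ q * ∑ (λ v → ι (W zero v) * nonadj w v) + k ^ q * row W′ w)
          ≡⟨ factor k (k ^ q) _ (row W′ w) ⟩
        k * k ^ q * (∑ (λ v → ι (W zero v) * nonadj w v) + row W′ w) ∎
        where
        open ≡-Reasoning
        W′ = λ i → W (suc i)
        size′ = λ i → size (suc i)
        expand : ∀ a p b c → a * (p * b + c) ≡ p * (a * b) + a * c
        expand = solve-∀
        factor : ∀ k p a b → k * (p * a + p * b) ≡ k * p * (a + b)
        factor = solve-∀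

      -- A pair from two different sets lies on k^(q-2) transversals, whence two factors `k` on the
      -- left.
      ∑ᵗ-defect : ∀ {q} (W : Fin q → Fin n → Bool) → (∀ i → ∑ (λ v → ι (W i v)) ≡ k) →
                  k * (k * ∑ᵗ W defect) ≡ k ^ q * total W
      ∑ᵗ-defect {zero}  W size = trans (cong (k *_) (*-zeroʳ k)) (*-zeroʳ k)
      ∑ᵗ-defect {suc q} W size = begin
        k * (k * ∑ (λ w → ι (W zero w) * ∑ᵗ W′ (λ T → missed w T + defect T)))
          ≡⟨ cong (λ z → k * (k * z)) (trans (∑-cong λ w → trans (cong (ι (W zero w) *_) (∑ᵗ-+ W′ _ _)) (*-distribˡ-+ (ι (W zero w)) _ _)) (∑-distrib-+ {n} _ _)) ⟩
        k * (k * (∑ (λ w → ι (W zero w) * ∑ᵗ W′ (missed w)) + ∑ (λ w → ι (W zero w) * ∑ᵗ W′ defect)))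
          ≡⟨ cong (λ z → k * (k * (∑ (λ w → ι (W zero w) * ∑ᵗ W′ (missed w)) + z))) (trans (sym (*-distribʳ-sum {n} (∑ᵗ W′ defect) _)) (cong (_* ∑ᵗ W′ defect) (size zero))) ⟩
        k * (k * (∑ (λ w → ι (W zero w) * ∑ᵗ W′ (missed w)) + k * ∑ᵗ W′ defect))
          ≡⟨ distribute k _ (∑ᵗ W′ defect) ⟩
        k * (k * ∑ (λ w → ι (W zero w) * ∑ᵗ W′ (missed w)) + k * (k * ∑ᵗ W′ defect))
          ≡⟨ cong₂ (λ a b → k * (a + b))
               (trans (*-distribˡ-sum {n} k _) (trans (∑-cong λ w → trans (left-comm k (ι (W zero w)) _)
                 (trans (cong (ι (W zero w) *_) (∑ᵗ-missed W′ size′ w)) (left-comm (ι (W zero w)) (k ^ q) _))) (sym (*-distribˡ-sum {n} (k ^ q) _))))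
               (∑ᵗ-defect W′ size′) ⟩
        k * (k ^ q * ∑ (λ w → ι (W zero w) * row W′ w) + k ^ q * total W′)
          ≡⟨ factor k (k ^ q) _ (total W′) ⟩
        k * k ^ q * (∑ (λ w → ι (W zero w) * row W′ w) + total W′) ∎
        where
        open ≡-Reasoning
        W′ = λ i → W (suc i)
        size′ = λ i → size (suc i)
        distribute : ∀ k a b → k * (k * (a + k * b)) ≡ k * (k * a + k * (k * b))
        distribute = solve-∀
        left-comm : ∀ a b c → a * (b * c) ≡ b * (a * c)
        left-comm = solve-∀
        factor : ∀ k p a b → k * (p * a + p * b) ≡ k * p * (a + b)
        factor = solve-∀

      -- `total` runs over i < j. Doubled, it becomes symmetric in i and j, a form in which the sums
      -- over sets and over vertices can be exchanged.
      2total : ∀ {q} (W : Fin q → Fin n → Bool) →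
               2 * total W ≡ ∑∑ λ i j → ι (not (i ≡ᶠ j)) * ∑∑ λ u v → ι (W i u) * (ι (W j v) * nonadj u v)
      2total {zero}  W = refl
      2total {suc q} W = begin
        2 * (X + total W′)
          ≡⟨ expand X (total W′) ⟩
        X + (X + 2 * total W′)
          ≡⟨ cong₂ _+_ X≡ (cong₂ _+_ X≡ (2total W′)) ⟩
        ∑ (λ j → M zero (suc j)) + (∑ (λ j → M zero (suc j)) + ∑∑ (λ i j → ι (not (i ≡ᶠ j)) * M (suc i) (suc j)))
          ≡⟨ cong₂ _+_ (∑-cong λ j → sym (*-identityˡ (M zero (suc j)))) (trans
               (cong (_+ ∑∑ (λ i j → ι (not (i ≡ᶠ j)) * M (suc i) (suc j))) (∑-cong λ j → trans (M-sym zero (suc j)) (sym (*-identityˡ (M (suc j) zero)))))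
               (sym (∑-distrib-+ {q} _ _))) ⟩
        ∑∑ (λ i j → ι (not (i ≡ᶠ j)) * M i j) ∎
        where
        open ≡-Reasoning
        W′ = λ i → W (suc i)
        X = ∑ (λ w → ι (W zero w) * row W′ w)
        M : Fin (suc q) → Fin (suc q) → ℕ
        M i j = ∑∑ λ u v → ι (W i u) * (ι (W j v) * nonadj u v)
        M-sym : ∀ i j → M i j ≡ M j i
        M-sym i j = trans (∑-comm {n} {n} _) (∑∑-cong λ v u → trans (swap (ι (W i u)) (ι (W j v)) (nonadj u v))
          (cong (λ b → ι (W j v) * (ι (W i u) * ι (not b))) (adj-sym u v)))
          where
          swap : ∀ a b c → a * (b * c) ≡ b * (a * c)
          swap = solve-∀
        row≡ : ∀ {p} (V : Fin p → Fin n → Bool) w → row V w ≡ ∑∑ λ j v → ι (V j v) * nonadj w v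
        row≡ {zero}  V w = refl
        row≡ {suc p} V w = cong (∑ (λ v → ι (V zero v) * nonadj w v) +_) (row≡ (λ j → V (suc j)) w)
        X≡ : X ≡ ∑ λ j → M zero (suc j)
        X≡ = trans (∑-cong λ w → trans (cong (ι (W zero w) *_) (row≡ W′ w)) (*-distribˡ-sum {q} (ι (W zero w)) _))
          (trans (∑-comm {n} {q} _) (∑∑-cong {q} {n} λ j u → *-distribˡ-sum {n} (ι (W zero u)) λ v → ι (W (suc j) v) * nonadj u v))
        expand : ∀ x t → 2 * (x + t) ≡ x + (x + 2 * t)
        expand = solve-∀

    joined-all : ∀ {q} x (T : Vec (Fin n) q) → (∀ i → adj x (lookup T i) ≡ true) → All (x ~_) (toList T)
    joined-all x []      h = []
    joined-all x (v ∷ T) h = adj⇒~ (h zero) ∷ joined-all x T (λ i → h (suc i))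

    missed≡0 : ∀ {q} w (T : Vec (Fin n) q) → missed w T ≡ 0 → All (w ~_) (toList T)
    missed≡0 w []      e = []
    missed≡0 w (v ∷ T) e with adj w v in a
    ... | true = adj⇒~ a ∷ missed≡0 w T e

    defect≡0 : ∀ {q} (T : Vec (Fin n) q) → defect T ≡ 0 → AllPairs _~_ (toList T)
    defect≡0 []      e = []
    defect≡0 (w ∷ T) e = missed≡0 w T (m+n≡0⇒m≡0 (missed w T) e) ∷ defect≡0 T (m+n≡0⇒n≡0 (missed w T) e)

    -- Averaging over the k^q transversals, each of which contains a missing pair.
    k²≤total : ∀ k {q} (W : Fin q → Fin n → Bool) → (∀ i → ∑ (λ v → ι (W i v)) ≡ k) →
               (∀ T → (∀ i → W i (lookup T i) ≡ true) → ¬ AllPairs _~_ (toList T)) → k * k ≤ Uniform.total k W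
    k²≤total zero    W size none = z≤n
    k²≤total k@(suc _) {q} W size none = *-cancelˡ-≤ (k ^ q) {{m^n≢0 k q}} (begin
      k ^ q * (k * k)            ≡⟨ arith (k ^ q) k ⟩
      k * (k * (k ^ q * 1))      ≡⟨ cong (λ z → k * (k * z)) (∑ᵗ-const W size 1) ⟨
      k * (k * ∑ᵗ W (λ _ → 1))   ≤⟨ *-monoʳ-≤ k (*-monoʳ-≤ k (∑ᵗ-mono W λ T inT → n≢0⇒n>0 (λ e → none T inT (defect≡0 T e)))) ⟩
      k * (k * ∑ᵗ W defect)      ≡⟨ ∑ᵗ-defect W size ⟩
      k ^ q * total W            ∎)
      where
      open ≤-Reasoning
      open Uniform k
      arith : ∀ p k → p * (k * k) ≡ k * (k * (p * 1))
      arith = solve-∀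

    -- The sets `p i` lie in different colour classes. They are therefore disjoint, and a
    -- nonadjacent pair between two of them is bichromatic. The function `χ` is the indicator of the
    -- union of the sets after `thin`; forgetting which set a vertex came from lets it be compared
    -- with any other set of vertices.
    missing-pairs : ∀ {q r} (c : Fin n → Fin r) (φ : Fin q → Fin r) → (∀ {i j} → φ i ≡ φ j → i ≡ j) →
      (p : Fin q → Fin n → Bool) → (∀ i u → p i u ≡ true → φ i ≡ c u) →
      ∀ k → (∀ i → k ≤ ∑ (λ u → ι (p i u))) →
      (∀ T → (∀ i → p i (lookup T i) ≡ true) → ¬ AllPairs _~_ (toList T)) →
      Σ[ χ ∈ (Fin n → ℕ) ] (∀ u → χ u ≤ ∑ λ i → ι (φ i ≡ᶠ c u)) × ∑ χ ≡ q * k ×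
        2 * (k * k) ≤ ∑∑ λ u v → χ u * (χ v * ι (not (adj u v) ∧ not (c u ≡ᶠ c v)))
    missing-pairs {q} c φ φ-inj p p-colour k large none = χ , χ≤ , ∑χ , (begin
      2 * (k * k)
        ≤⟨ *-monoʳ-≤ 2 (k²≤total k W size λ T inT → none T (λ i → W⊆p i (lookup T i) (inT i))) ⟩
      2 * Uniform.total k W
        ≡⟨ Uniform.2total k W ⟩
      ∑∑ (λ i j → ι (not (i ≡ᶠ j)) * ∑∑ λ u v → ι (W i u) * (ι (W j v) * nonadj u v))
        ≤⟨ ∑∑-mono (λ i j → subst (_≤ ∑∑ λ u v → ι (W i u) * (ι (W j v) * miss u v)) (sym (pull (ι (not (i ≡ᶠ j))) λ u v → ι (W i u) * (ι (W j v) * nonadj u v))) (∑∑-mono (pair i j))) ⟩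
      ∑∑ (λ i j → ∑∑ λ u v → ι (W i u) * (ι (W j v) * miss u v))
        ≡⟨ exchange ⟩
      ∑∑ (λ u v → χ u * (χ v * miss u v)) ∎)
      where
      open ≤-Reasoning
      miss : Fin n → Fin n → ℕ
      miss u v = ι (not (adj u v) ∧ not (c u ≡ᶠ c v))
      thinned = λ i → thin (p i) k (large i)
      W : Fin q → Fin n → Bool
      W i = proj₁ (thinned i)
      W⊆p : ∀ i u → W i u ≡ true → p i u ≡ true
      W⊆p i = proj₁ (proj₂ (thinned i))
      size : ∀ i → ∑ (λ u → ι (W i u)) ≡ k
      size i = proj₂ (proj₂ (thinned i))
      W-colour : ∀ i u → W i u ≡ true → φ i ≡ c u
      W-colour i u e = p-colour i u (W⊆p i u e)
      χ : Fin n → ℕ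
      χ u = ∑ λ i → ι (W i u)
      χ≤ : ∀ u → χ u ≤ ∑ λ i → ι (φ i ≡ᶠ c u)
      χ≤ u = ∑-mono bound
        where
        bound : ∀ i → ι (W i u) ≤ ι (φ i ≡ᶠ c u)
        bound i with W i u in e
        ... | false = z≤n
        ... | true  rewrite W-colour i u e | ≡ᶠ-refl (c u) = ≤-refl
      ∑χ : ∑ χ ≡ q * k
      ∑χ = trans (∑-comm {n} {q} λ u i → ι (W i u)) (trans (∑-cong size) (∑-const q k))
      pull : ∀ a (f : Fin n → Fin n → ℕ) → a * ∑∑ f ≡ ∑∑ λ u v → a * f u v
      pull a f = trans (*-distribˡ-sum {n} a _) (∑-cong λ u → *-distribˡ-sum {n} a (f u))
      pair : ∀ i j u v → ι (not (i ≡ᶠ j)) * (ι (W i u) * (ι (W j v) * nonadj u v)) ≤ ι (W i u) * (ι (W j v) * miss u v)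
      pair i j u v with i Fin.≟ j
      ... | yes _  = z≤n
      ... | no i≢j with W i u in e | W j v in e′
      ...   | false | _     = z≤n
      ...   | true  | false = z≤n
      ...   | true  | true  rewrite ≢⇒≡ᶠ {i = c u} {c v} (λ eq → i≢j (φ-inj (trans (W-colour i u e) (trans eq (sym (W-colour j v e′)))))) | Bool.∧-identityʳ (not (adj u v)) = ≤-reflexive (+-identityʳ _)
      F : Fin q → Fin q → Fin n → Fin n → ℕ
      F i j u v = ι (W i u) * (ι (W j v) * miss u v)
      exchange : ∑∑ (λ i j → ∑∑ λ u v → ι (W i u) * (ι (W j v) * miss u v)) ≡ ∑∑ (λ u v → χ u * (χ v * miss u v))
      exchange = begin-equality
        ∑∑ (λ i j → ∑∑ λ u v → ι (W i u) * (ι (W j v) * miss u v))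
          ≡⟨ ∑-cong {q} (λ i → trans (∑-comm {q} {n} λ j u → ∑ λ v → F i j u v) (∑-cong {n} λ u → ∑-comm {q} {n} λ j v → F i j u v)) ⟩
        ∑ (λ i → ∑∑ λ u v → ∑ λ j → ι (W i u) * (ι (W j v) * miss u v))
          ≡⟨ trans (∑-comm {q} {n} λ i u → ∑∑ λ v j → F i j u v) (∑-cong {n} λ u → ∑-comm {q} {n} λ i v → ∑ λ j → F i j u v) ⟩
        ∑∑ (λ u v → ∑∑ λ i j → ι (W i u) * (ι (W j v) * miss u v))
          ≡⟨ ∑∑-cong (λ u v → trans (∑*∑ (λ i → ι (W i u)) (λ j → ι (W j v) * miss u v)) (cong (χ u *_) (sym (*-distribʳ-sum {q} (miss u v) λ j → ι (W j v))))) ⟩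
        ∑∑ (λ u v → χ u * (χ v * miss u v)) ∎

  -- Counting in lists of pairs.

  count-tabulate : {A : Set} (p : A → Bool) {m : ℕ} (f : Fin m → A) → count p (tabulate f) ≡ ∑ λ i → ι (p (f i))
  count-tabulate p {zero}  f = refl
  count-tabulate p {suc m} f = cong (ι (p (f zero)) +_) (count-tabulate p (λ i → f (suc i)))

  count-cartesianProduct : {A B : Set} (p : A × B → Bool) {m l : ℕ} (f : Fin m → A) (g : Fin l → B) →
                           count p (cartesianProduct (tabulate f) (tabulate g)) ≡ ∑∑ λ i j → ι (p (f i , g j))
  count-cartesianProduct p {zero}  f g = refl
  count-cartesianProduct p {suc m} f g = trans
    (count-++ p (map (f zero ,_) (tabulate g)) (cartesianProduct (tabulate (λ i → f (suc i))) (tabulate g)))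
    (cong₂ _+_ (trans (count-map p (f zero ,_) (tabulate g)) (count-tabulate (λ b → p (f zero , b)) g))
               (count-cartesianProduct p (λ i → f (suc i)) g))

  count-filter : {A : Set} {P : A → Set} (P? : Decidable P) (q : A → Bool) (L : List A) →
                 count q (filter P? L) ≡ count (λ x → does (P? x) ∧ q x) L
  count-filter P? q []       = refl
  count-filter P? q (x ∷ xs) with does (P? x)
  ... | true  = cong (ι (q x) +_) (count-filter P? q xs)
  ... | false = count-filter P? q xs

  filter∈sublists : {A : Set} {P : A → Set} (P? : Decidable P) (L : List A) → filter P? L ∈ sublists L
  filter∈sublists P? []       = here refl
  filter∈sublists P? (x ∷ xs) with does (P? x)
  ... | true  = ∈.∈-++⁺ˡ (∈.∈-map⁺ (x ∷_) (filter∈sublists P? xs))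
  ... | false = ∈.∈-++⁺ʳ (map (x ∷_) (sublists xs)) (filter∈sublists P? xs)

  -- Pair counts for a fixed colouring.

  module Structure {n : ℕ} (G : Graph n) {r : ℕ} (c : Fin n → Fin r) where
    open Graph G
    open Adjacency G
    open Partition G

    -- The list of monochromatic edges is an admissible deletion set, since `c` is proper once they
    -- are gone.
    D≤loss : 2 * D r G ≤ loss c
    D≤loss = ≤-trans (*-monoʳ-≤ 2 (min≤v⁺ (length (edges G)) (map length (filter (λ F → colorable? (delete G F) r) (sublists (edges G))))
        (inj₂ (Any.map⁺ (lose (∈.∈-filter⁺ (λ F → colorable? (delete G F) r) (filter∈sublists mono? (edges G)) (c , proper)) ≤-refl)))))
      (≤-reflexive length-mono)
      where
      mono? : Decidable (λ ((i , j) : Fin n × Fin n) → c i ≡ c j)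
      mono? (i , j) = c i Fin.≟ c j
      edge? = λ ((i , j) : Fin n × Fin n) → (i Fin.<? j) ×-dec (i ~? j)
      F = filter mono? (edges G)
      proper : ∀ i j → Graph._~_ (delete G F) i j → c i ≢ c j
      proper i j (i~j , ij∉F , ji∉F) ci≡cj with Fin.<-cmp i j
      ... | tri< i<j _ _ = ij∉F (∈.∈-filter⁺ mono? (∈.∈-filter⁺ edge? (∈.∈-cartesianProduct⁺ (∈.∈-allFin i) (∈.∈-allFin j)) (i<j , i~j)) ci≡cj)
      ... | tri≈ _ i≡j _ = ~-irrefl i≡j i~j
      ... | tri> _ _ j<i = ji∉F (∈.∈-filter⁺ mono? (∈.∈-filter⁺ edge? (∈.∈-cartesianProduct⁺ (∈.∈-allFin j) (∈.∈-allFin i)) (j<i , ~-sym i~j)) (sym ci≡cj))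
      below : Fin n → Fin n → ℕ
      below i j = ι ((does (i Fin.<? j) ∧ adj i j) ∧ (c i ≡ᶠ c j))
      symmetrise : ∀ i j → below i j + below j i ≡ ι (adj i j ∧ (c i ≡ᶠ c j))
      symmetrise i j with Fin.<-cmp i j
      ... | tri< i<j _ j≮i rewrite dec-true (i Fin.<? j) i<j | dec-false (j Fin.<? i) j≮i = +-identityʳ _
      ... | tri> i≮j _ j<i rewrite dec-true (j Fin.<? i) j<i | dec-false (i Fin.<? j) i≮j | adj-sym i j | ≡ᶠ-sym (c i) (c j) = refl
      ... | tri≈ i≮i refl _ rewrite dec-false (i Fin.<? i) i≮i | adj-irrefl i = refl
      length-mono : 2 * length F ≡ loss c
      length-mono = begin
        2 * length F
          ≡⟨ cong (2 *_) (trans (length-filter mono? (edges G)) (trans (count-filter edge? (does ∘ mono?) (cartesianProduct (allFin n) (allFin n)))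
               (count-cartesianProduct (λ x → does (edge? x) ∧ does (mono? x)) {n} {n} (λ i → i) (λ j → j)))) ⟩
        2 * ∑∑ below
          ≡⟨ double (∑∑ below) ⟩
        ∑∑ below + ∑∑ below
          ≡⟨ cong (∑∑ below +_) (∑-comm {n} {n} below) ⟩
        ∑∑ below + ∑∑ (λ i j → below j i)
          ≡⟨ ∑∑-distrib-+ {n} {n} below _ ⟨
        ∑∑ (λ i j → below i j + below j i)
          ≡⟨ ∑∑-cong symmetrise ⟩
        loss c ∎
        where
        open ≡-Reasoning
        double : ∀ a → 2 * a ≡ a + a
        double = solve-∀

    miss : Fin n → Fin n → ℕ
    miss u v = ι (not (adj u v) ∧ not (c u ≡ᶠ c v))

    missing : Fin n → ℕ
    missing u = ∑ (miss u)

    size : Fin r → ℕ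
    size j = ∑ λ u → ι (j ≡ᶠ c u)

    miss-sym : ∀ u v → miss u v ≡ miss v u
    miss-sym u v = cong₂ (λ a b → ι (not a ∧ not b)) (adj-sym u v) (≡ᶠ-sym (c u) (c v))

    ∑-size² : ∑ (λ j → size j * size j) ≡ ∑∑ λ u v → ι (c u ≡ᶠ c v)
    ∑-size² = begin
      ∑ (λ j → size j * size j)
        ≡⟨ ∑-cong (λ j → sym (∑*∑ (λ u → ι (j ≡ᶠ c u)) (λ v → ι (j ≡ᶠ c v)))) ⟩
      ∑ (λ j → ∑∑ λ u v → ι (j ≡ᶠ c u) * ι (j ≡ᶠ c v))
        ≡⟨ trans (∑-comm {r} {n} λ j u → ∑ λ v → ι (j ≡ᶠ c u) * ι (j ≡ᶠ c v)) (∑-cong {n} λ u → ∑-comm {r} {n} λ j v → ι (j ≡ᶠ c u) * ι (j ≡ᶠ c v)) ⟩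
      ∑∑ (λ u v → ∑ λ j → ι (j ≡ᶠ c u) * ι (j ≡ᶠ c v))
        ≡⟨ ∑∑-cong (λ u v → trans (∑-cong λ j → cong (λ b → ι b * ι (j ≡ᶠ c v)) (≡ᶠ-sym j (c u))) (∑-≡ᶠ (λ j → ι (j ≡ᶠ c v)) (c u))) ⟩
      ∑∑ (λ u v → ι (c u ≡ᶠ c v)) ∎
      where open ≡-Reasoning

    ∑∑-1 : ∑∑ {n} {n} (λ _ _ → 1) ≡ n * n
    ∑∑-1 = trans (∑-cong {n} λ _ → trans (∑-const n 1) (*-identityʳ n)) (∑-const n n)

    cross+size² : ∑∑ (λ u v → ι (not (c u ≡ᶠ c v))) + ∑ (λ j → size j * size j) ≡ n * n
    cross+size² = trans (cong (∑∑ (λ u v → ι (not (c u ≡ᶠ c v))) +_) ∑-size²)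
      (trans (sym (∑∑-distrib-+ {n} {n} _ _)) (trans (∑∑-cong λ u v → complement (c u ≡ᶠ c v)) ∑∑-1))
      where
      complement : ∀ b → ι (not b) + ι b ≡ 1
      complement false = refl
      complement true  = refl

    -- Every ordered pair is an edge, a missing pair between classes or a pair inside a class. Only
    -- the monochromatic edges are of two of these kinds.
    count-pairs : ∑∑ (λ u v → ι (adj u v)) + ∑∑ miss + ∑ (λ j → size j * size j) ≡ loss c + n * n
    count-pairs = begin
      ∑∑ (λ u v → ι (adj u v)) + ∑∑ miss + ∑ (λ j → size j * size j)
        ≡⟨ cong₂ _+_ (sym (∑∑-distrib-+ {n} {n} (λ u v → ι (adj u v)) miss)) ∑-size² ⟩
      ∑∑ (λ u v → ι (adj u v) + miss u v) + ∑∑ (λ u v → ι (c u ≡ᶠ c v))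
        ≡⟨ ∑∑-distrib-+ {n} {n} (λ u v → ι (adj u v) + miss u v) (λ u v → ι (c u ≡ᶠ c v)) ⟨
      ∑∑ (λ u v → ι (adj u v) + miss u v + ι (c u ≡ᶠ c v))
        ≡⟨ ∑∑-cong (λ u v → cases (adj u v) (c u ≡ᶠ c v)) ⟩
      ∑∑ (λ u v → ι (adj u v ∧ (c u ≡ᶠ c v)) + 1)
        ≡⟨ trans (∑∑-distrib-+ {n} {n} _ _) (cong (loss c +_) ∑∑-1) ⟩
      loss c + n * n ∎
      where
      open ≡-Reasoning
      cases : ∀ a b → ι a + ι (not a ∧ not b) + ι b ≡ ι (a ∧ b) + 1
      cases false false = refl
      cases false true  = refl
      cases true  false = refl
      cases true  true  = refl

    -- Inclusion-exclusion: a missing pair is counted once for each end in σ and once more when it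
    -- lies inside χ. Any count beyond the first is paid for by the pair lying inside σ or joining σ
    -- to χ.
    missing-twice : (σ : Fin n → Bool) (χ : Fin n → ℕ) → (∀ u → χ u ≤ 1) →
      2 * ∑ (λ u → ι (σ u) * missing u) + ∑∑ (λ u v → χ u * (χ v * miss u v))
        ≤ ∑∑ miss + ∑ (λ u → ι (σ u)) * ∑ (λ u → ι (σ u)) + 2 * (∑ (λ u → ι (σ u)) * ∑ χ)
    missing-twice σ χ χ≤1 = begin
      2 * ∑ (λ u → ι (σ u) * missing u) + X
        ≡⟨ cong (λ z → 2 * z + X) (∑-cong {n} λ u → *-distribˡ-sum {n} (ι (σ u)) (miss u)) ⟩
      2 * ∑∑ A + X
        ≡⟨ cong (_+ X) (double (∑∑ A)) ⟩
      ∑∑ A + ∑∑ A + X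
        ≡⟨ cong (λ z → ∑∑ A + z + X) (∑-comm {n} {n} A) ⟩
      ∑∑ A + ∑∑ (λ u v → A v u) + X
        ≡⟨ trans (∑∑-distrib-+ {n} {n} (λ u v → A u v + A v u) (λ u v → χ u * (χ v * miss u v))) (cong (_+ X) (∑∑-distrib-+ {n} {n} A (λ u v → A v u))) ⟨
      ∑∑ (λ u v → A u v + A v u + χ u * (χ v * miss u v))
        ≤⟨ ∑∑-mono pointwise ⟩
      ∑∑ (λ u v → miss u v + ι (σ u) * ι (σ v) + (B u v + B v u))
        ≡⟨ trans (∑∑-distrib-+ {n} {n} (λ u v → miss u v + ι (σ u) * ι (σ v)) (λ u v → B u v + B v u))
             (cong₂ _+_ (trans (∑∑-distrib-+ {n} {n} miss (λ u v → ι (σ u) * ι (σ v))) (cong (∑∑ miss +_) (∑*∑ (λ u → ι (σ u)) (λ v → ι (σ v)))))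
               (trans (∑∑-distrib-+ {n} {n} B (λ u v → B v u)) (trans (cong (∑∑ B +_) (sym (∑-comm {n} {n} B))) (trans (sym (double (∑∑ B))) (cong (2 *_) (∑*∑ (λ u → ι (σ u)) χ)))))) ⟩
      ∑∑ miss + ∑ (λ u → ι (σ u)) * ∑ (λ u → ι (σ u)) + 2 * (∑ (λ u → ι (σ u)) * ∑ χ) ∎
      where
      open ≤-Reasoning
      A B : Fin n → Fin n → ℕ
      A u v = ι (σ u) * miss u v
      B u v = ι (σ u) * χ v
      X = ∑∑ λ u v → χ u * (χ v * miss u v)
      double : ∀ a → 2 * a ≡ a + a
      double = solve-∀
      bounds : ∀ s t x y m → x ≤ 1 → y ≤ 1 → m ≤ 1 →
               ι s * m + ι t * m + x * (y * m) ≤ m + ι s * ι t + (ι s * y + ι t * x)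
      bounds s t x y zero _ _ _ rewrite *-zeroʳ (ι s) | *-zeroʳ (ι t) | *-zeroʳ y | *-zeroʳ x = z≤n
      bounds s t zero y (suc zero) _ _ _ = small s t
        where
        small : ∀ s t → ι s * 1 + ι t * 1 + 0 ≤ 1 + ι s * ι t + (ι s * y + ι t * 0)
        small false false = z≤n
        small false true  = s≤s z≤n
        small true  false = s≤s z≤n
        small true  true  = s≤s (s≤s z≤n)
      bounds s t (suc zero) y (suc zero) _ y≤1 _ = case y≤1 s t
        where
        case : ∀ {y} → y ≤ 1 → ∀ s t → ι s * 1 + ι t * 1 + 1 * (y * 1) ≤ 1 + ι s * ι t + (ι s * y + ι t * 1)
        case {zero}     _ false false = z≤n
        case {zero}     _ false true  = s≤s z≤n
        case {zero}     _ true  false = s≤s z≤n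
        case {zero}     _ true  true  = s≤s (s≤s z≤n)
        case {suc zero} _ false false = s≤s z≤n
        case {suc zero} _ false true  = s≤s (s≤s z≤n)
        case {suc zero} _ true  false = s≤s (s≤s z≤n)
        case {suc zero} _ true  true  = s≤s (s≤s (s≤s z≤n))
        case {suc (suc _)} (s≤s ()) _ _
      bounds s t (suc (suc _)) y (suc zero) (s≤s ()) _ _
      bounds s t x y (suc (suc _)) _ _ (s≤s ())
      pointwise : ∀ u v → A u v + A v u + χ u * (χ v * miss u v) ≤ miss u v + ι (σ u) * ι (σ v) + (B u v + B v u)
      pointwise u v = subst (λ z → A u v + ι (σ v) * z + χ u * (χ v * miss u v) ≤ miss u v + ι (σ u) * ι (σ v) + (B u v + B v u))
        (miss-sym u v) (bounds (σ u) (σ v) (χ u) (χ v) (miss u v) (χ≤1 u) (χ≤1 v) (ι≤1 (not (adj u v) ∧ not (c u ≡ᶠ c v))))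

    -- A monochromatic edge not inside S is charged to an end in σ, which has at most k neighbours
    -- in its own class.
    loss-cover : (S σ : Fin n → Bool) → (∀ u v → u ~ v → c u ≡ c v → (S u ≡ true × S v ≡ true) ⊎ σ u ≡ true ⊎ σ v ≡ true) →
      ∀ k → (∀ u → degreeTo c u (c u) ≤ k) →
      loss c ≤ ∑ (λ u → ι (S u)) * ∑ (λ u → ι (S u)) + 2 * (∑ (λ u → ι (σ u)) * k)
    loss-cover S σ covered k deg≤k = begin
      loss c
        ≤⟨ ∑∑-mono pointwise ⟩
      ∑∑ (λ u v → ι (S u) * ι (S v) + (A u v + A v u))
        ≡⟨ trans (∑∑-distrib-+ {n} {n} (λ u v → ι (S u) * ι (S v)) (λ u v → A u v + A v u)) (cong₂ _+_ (∑*∑ (λ u → ι (S u)) (λ v → ι (S v)))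
             (trans (∑∑-distrib-+ {n} {n} A (λ u v → A v u)) (trans (cong (∑∑ A +_) (sym (∑-comm {n} {n} A))) (sym (double (∑∑ A)))))) ⟩
      ∑ (λ u → ι (S u)) * ∑ (λ u → ι (S u)) + 2 * ∑∑ A
        ≤⟨ +-monoʳ-≤ (∑ (λ u → ι (S u)) * ∑ (λ u → ι (S u))) (*-monoʳ-≤ 2 (begin
             ∑∑ A                                       ≡⟨ ∑-cong {n} (λ u → sym (*-distribˡ-sum {n} (ι (σ u)) (bad u))) ⟩
             ∑ (λ u → ι (σ u) * degreeTo c u (c u))     ≤⟨ ∑-mono {n} (λ u → *-monoʳ-≤ (ι (σ u)) (deg≤k u)) ⟩
             ∑ (λ u → ι (σ u) * k)                      ≡⟨ *-distribʳ-sum {n} k (λ u → ι (σ u)) ⟨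
             ∑ (λ u → ι (σ u)) * k                      ∎)) ⟩
      ∑ (λ u → ι (S u)) * ∑ (λ u → ι (S u)) + 2 * (∑ (λ u → ι (σ u)) * k) ∎
      where
      open ≤-Reasoning
      bad A : Fin n → Fin n → ℕ
      bad u v = ι (adj u v ∧ (c u ≡ᶠ c v))
      A u v = ι (σ u) * bad u v
      double : ∀ a → 2 * a ≡ a + a
      double = solve-∀
      pointwise : ∀ u v → bad u v ≤ ι (S u) * ι (S v) + (A u v + A v u)
      pointwise u v rewrite adj-sym v u | ≡ᶠ-sym (c v) (c u) with adj u v in a | c u ≡ᶠ c v in e
      ... | false | _     = z≤n
      ... | true  | false = z≤n
      ... | true  | true  with covered u v (adj⇒~ a) (≡ᶠ⇒≡ e)
      ...   | inj₁ (Su , Sv) rewrite Su | Sv = s≤s z≤n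
      ...   | inj₂ (inj₁ σu) rewrite σu = ≤-trans (s≤s z≤n) (m≤n+m (1 + ι (σ v) * 1) (ι (S u) * ι (S v)))
      ...   | inj₂ (inj₂ σv) rewrite σv = ≤-trans (m≤n+m 1 (ι (σ u) * 1)) (m≤n+m (ι (σ u) * 1 + 1) (ι (S u) * ι (S v)))

  -- Missing pairs forced by the absence of a large clique.

  module Peak {n r : ℕ} (G : Graph n) (c : Fin n → Fin r) (free : CliqueFree G (suc r)) where
    open Graph G
    open Adjacency G
    open Partition G
    open Transversal G
    open Structure G c

    -- By optimality, every class contains at least k neighbours of a vertex
    -- whose degree into its own class is the maximum k.
    peak : Fin n → Optimal c →
      Σ[ k ∈ ℕ ] (∀ u → degreeTo c u (c u) ≤ k) × Σ[ χ ∈ (Fin n → ℕ) ] (∀ u → χ u ≤ 1) × ∑ χ ≡ r * k ×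
        2 * (k * k) ≤ ∑∑ λ u v → χ u * (χ v * miss u v)
    peak x₀ opt =
      let x , _ , max = argmax-on (λ _ → true) (λ u → degreeTo c u (c u)) x₀ refl
          χ , χ≤ , ∑χ , pairs = missing-pairs c (λ j → j) (λ e → e)
            (λ j w → adj x w ∧ (j ≡ᶠ c w)) (λ j w e → ≡ᶠ⇒≡ (∧-right (adj x w) e))
            (degreeTo c x (c x)) (opt x)
            -- A clique transversal together with `x` would be a clique on r + 1 vertices.
            (λ T inT pairs → free (x ∷ toList T)
              (cong suc (Vec.length-toList T) , joined-all x T (λ i → ∧-left (adj x (lookup T i)) (inT i)) ∷ pairs))
      in degreeTo c x (c x) , (λ u → max u refl) , χ , (λ u → ≤-trans (χ≤ u) (one u)) , ∑χ , pairs
      where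
      one : ∀ u → ∑ (λ j → ι (j ≡ᶠ c u)) ≤ 1
      one u = ≤-reflexive (trans (∑-cong λ j → trans (cong ι (≡ᶠ-sym j (c u))) (sym (*-identityʳ _))) (∑-≡ᶠ (λ _ → 1) (c u)))

  module Cover {n r : ℕ} (G : Graph n) (c : Fin n → Fin (2 + r)) (free : CliqueFree G (3 + r)) where
    open Graph G
    open Adjacency G
    open Partition G
    open Transversal G
    open Structure G c

    -- k is the smallest size of the common neighbourhood of u and v in another class.
    monochromatic-edge : ∀ u v → u ~ v → c u ≡ c v →
      Σ[ j ∈ Fin (2 + r) ] Σ[ k ∈ ℕ ] size j ≤ missing u + missing v + k × 2 * (k * k) ≤ ∑∑ miss
    monochromatic-edge u v u~v cu≡cv =
      let i , min = argmin (λ i → ∑ λ w → ι (p i w))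
          k = ∑ (λ w → ι (p i w))
          χ , χ≤ , _ , pairs = missing-pairs c (punchIn (c u)) (λ {i} {j} → Fin.punchIn-injective (c u) i j)
            p (λ i w e → ≡ᶠ⇒≡ (∧-right (adj u w ∧ adj v w) e)) k min
            -- The other classes number r + 1, so a clique transversal of the common neighbourhoods
            -- and the edge uv would form a clique on r + 3 vertices.
            (λ T inT pairs → free (u ∷ v ∷ toList T)
              (cong (λ l → 2 + l) (Vec.length-toList T)
              , (u~v ∷ joined-all u T (λ i → ∧-left (adj u (lookup T i)) (∧-left (adj u (lookup T i) ∧ adj v (lookup T i)) (inT i))))
              ∷ joined-all v T (λ i → ∧-right (adj u (lookup T i)) (∧-left (adj u (lookup T i) ∧ adj v (lookup T i)) (inT i)))
              ∷ pairs))
      in punchIn (c u) i , k , class i , ≤-trans pairs (∑∑-mono λ a b →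
           *-weight (≤-trans (χ≤ a) (one a)) (*-weight (≤-trans (χ≤ b) (one b)) ≤-refl))
      where
      open ≤-Reasoning
      p : Fin (suc r) → Fin n → Bool
      p i w = (adj u w ∧ adj v w) ∧ (punchIn (c u) i ≡ᶠ c w)
      *-weight : ∀ {x a b} → x ≤ 1 → a ≤ b → x * a ≤ b
      *-weight {a = a} {b} x≤1 a≤b = ≤-trans (*-mono-≤ x≤1 a≤b) (≤-reflexive (*-identityˡ b))
      one : ∀ w → ∑ (λ i → ι (punchIn (c u) i ≡ᶠ c w)) ≤ 1
      one w = begin
        ∑ (λ i → ι (punchIn (c u) i ≡ᶠ c w))
          ≤⟨ m≤n+m _ (ι (c u ≡ᶠ c w)) ⟩
        ι (c u ≡ᶠ c w) + ∑ (λ i → ι (punchIn (c u) i ≡ᶠ c w))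
          ≡⟨ Sum.sum-remove {i = c u} (λ j → ι (j ≡ᶠ c w)) ⟨
        ∑ (λ j → ι (j ≡ᶠ c w))
          ≡⟨ trans (∑-cong λ j → trans (cong ι (≡ᶠ-sym j (c w))) (sym (*-identityʳ _))) (∑-≡ᶠ (λ _ → 1) (c w)) ⟩
        1 ∎
      class : ∀ i → size (punchIn (c u) i) ≤ missing u + missing v + ∑ (λ w → ι (p i w))
      class i = begin
        size (punchIn (c u) i)
          ≤⟨ ∑-mono {n} pointwise ⟩
        ∑ (λ w → miss u w + miss v w + ι (p i w))
          ≡⟨ trans (∑-distrib-+ {n} _ _) (cong (_+ ∑ (λ w → ι (p i w))) (∑-distrib-+ {n} (miss u) (miss v))) ⟩
        missing u + missing v + ∑ (λ w → ι (p i w)) ∎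
        where
        pointwise : ∀ w → ι (punchIn (c u) i ≡ᶠ c w) ≤ miss u w + miss v w + ι (p i w)
        pointwise w with punchIn (c u) i ≡ᶠ c w in e
        ... | false = z≤n
        ... | true  rewrite sym cu≡cv | ≢⇒≡ᶠ {i = c u} {c w} (λ cu≡cw → Fin.punchInᵢ≢i (c u) i (trans (≡ᶠ⇒≡ e) (sym cu≡cw))) =
          cases (adj u w) (adj v w)
          where
          cases : ∀ a b → 1 ≤ ι (not a ∧ true) + ι (not b ∧ true) + ι ((a ∧ b) ∧ true)
          cases false _     = s≤s z≤n
          cases true  false = s≤s z≤n
          cases true  true  = s≤s z≤n

  -- Class sizes and the optimal colouring.

  2ab+[b∸a]²≤a²+b² : ∀ a b → 2 * (a * b) + (b ∸ a) * (b ∸ a) ≤ a * a + b * b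
  2ab+[b∸a]²≤a²+b² a b with ≤-total b a
  -- Truncation makes the square vanish here; in the other case both sides are equal.
  ... | inj₁ b≤a rewrite m≤n⇒m∸n≡0 b≤a with k , refl ← m≤n⇒∃[o]m+o≡n b≤a =
    subst (2 * ((b + k) * b) + 0 ≤_) (id₁ b k) (m≤m+n _ (k * k))
    where
    id₁ : ∀ b k → 2 * ((b + k) * b) + 0 + k * k ≡ (b + k) * (b + k) + b * b
    id₁ = solve-∀
  ... | inj₂ a≤b with k , refl ← m≤n⇒∃[o]m+o≡n a≤b rewrite m+n∸m≡n a k = ≤-reflexive (id₂ a k)
    where
    id₂ : ∀ a k → 2 * (a * (a + k)) + k * k ≡ a * a + (a + k) * (a + k)
    id₂ = solve-∀

  module Sizes {n : ℕ} (G : Graph n) {r : ℕ} (c : Fin n → Fin r) where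
    open Structure G c

    ∑-size : ∑ size ≡ n
    ∑-size = trans (∑-comm {r} {n} λ j u → ι (j ≡ᶠ c u)) (trans
      (∑-cong {n} λ u → trans (∑-cong λ j → trans (cong ι (≡ᶠ-sym j (c u))) (sym (*-identityʳ _))) (∑-≡ᶠ (λ _ → 1) (c u)))
      (trans (∑-const n 1) (*-identityʳ n)))

    -- Summing 2 (r |V_i|) n ≤ (r |V_i|)² + n², where the term i = j is sharpened.
    size-variance : ∀ j → r * (n * n) + (n ∸ r * size j) * (n ∸ r * size j) ≤ r * r * ∑ λ i → size i * size i
    size-variance j = +-cancelʳ-≤ (r * (n * n)) _ _ (begin
      r * (n * n) + d j * d j + r * (n * n)
        ≡⟨ arith r n (d j * d j) ⟩
      2 * r * n * n + d j * d j
        ≡⟨ cong₂ _+_ (cong (2 * r * n *_) (sym ∑-size)) (sym (∑-≡ᶠ (λ i → d i * d i) j)) ⟩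
      2 * r * n * ∑ size + ∑ (λ i → ι (j ≡ᶠ i) * (d i * d i))
        ≡⟨ trans (∑-distrib-+ {r} _ _) (cong (_+ ∑ (λ i → ι (j ≡ᶠ i) * (d i * d i))) (sym (*-distribˡ-sum {r} (2 * r * n) size))) ⟨
      ∑ (λ i → 2 * r * n * size i + ι (j ≡ᶠ i) * (d i * d i))
        ≤⟨ ∑-mono pointwise ⟩
      ∑ {r} (λ i → r * r * (size i * size i) + n * n)
        ≡⟨ trans (∑-distrib-+ {r} (λ i → r * r * (size i * size i)) (λ _ → n * n))
             (cong₂ _+_ (sym (*-distribˡ-sum {r} (r * r) (λ i → size i * size i))) (∑-const r (n * n))) ⟩
      r * r * ∑ (λ i → size i * size i) + r * (n * n) ∎)
      where
      open ≤-Reasoning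
      d : Fin r → ℕ
      d i = n ∸ r * size i
      arith : ∀ r n d → r * (n * n) + d + r * (n * n) ≡ 2 * r * n * n + d
      arith = solve-∀
      lhs : ∀ r n x → 2 * (r * x * n) ≡ 2 * r * n * x
      lhs = solve-∀
      rhs : ∀ r x n → r * x * (r * x) + n * n ≡ r * r * (x * x) + n * n
      rhs = solve-∀
      pointwise : ∀ i → 2 * r * n * size i + ι (j ≡ᶠ i) * (d i * d i) ≤ r * r * (size i * size i) + n * n
      pointwise i = begin
        2 * r * n * size i + ι (j ≡ᶠ i) * (d i * d i)
          ≤⟨ +-monoʳ-≤ (2 * r * n * size i) (≤-trans (*-monoˡ-≤ (d i * d i) (ι≤1 (j ≡ᶠ i))) (≤-reflexive (*-identityˡ (d i * d i)))) ⟩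
        2 * r * n * size i + d i * d i
          ≡⟨ cong (_+ d i * d i) (sym (lhs r n (size i))) ⟩
        2 * (r * size i * n) + d i * d i
          ≤⟨ 2ab+[b∸a]²≤a²+b² (r * size i) n ⟩
        r * size i * (r * size i) + n * n
          ≡⟨ rhs r (size i) n ⟩
        r * r * (size i * size i) + n * n ∎

  module Optimum {n r : ℕ} (G : Graph n) (free : CliqueFree G (2 + r)) where
    open Adjacency G
    open Partition G

    E : ℕ
    E = ∑∑ λ u v → ι (adj u v)

    -- Füredi's partition bounds E + loss by the number of pairs between classes, which convexity of
    -- the sum of squared class sizes bounds in turn. The local search comes last: it only lowers
    -- the loss, so the bound survives although the classes change.
    optimum : Σ[ c ∈ (Fin n → Fin (suc r)) ] Optimal c × suc r * (E + loss c) + n * n ≤ suc r * (n * n)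
    optimum =
      let c₀ , le = furedi-loss r free
          c , better , opt = descend (suc (loss c₀)) c₀ ≤-refl
          module S = Structure G c₀
          Σ₀ = ∑ λ j → S.size j * S.size j
          n²≤rΣ : n * n ≤ suc r * Σ₀
          n²≤rΣ = *-cancelˡ-≤ (suc r) (≤-trans (≤-trans (m≤m+n _ _) (Sizes.size-variance G c₀ zero)) (≤-reflexive (*-assoc (suc r) (suc r) Σ₀)))
      in c , opt , (begin
        suc r * (E + loss c) + n * n    ≤⟨ +-mono-≤ (*-monoʳ-≤ (suc r) (≤-trans (+-monoʳ-≤ E better) le)) n²≤rΣ ⟩
        suc r * cross c₀ + suc r * Σ₀   ≡⟨ *-distribˡ-+ (suc r) (cross c₀) Σ₀ ⟨
        suc r * (cross c₀ + Σ₀)         ≡⟨ cong (suc r *_) S.cross+size² ⟩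
        suc r * (n * n)                 ∎)
      where
      open ≤-Reasoning
      cross : (Fin n → Fin (suc r)) → ℕ
      cross c = ∑∑ λ u v → ι (not (c u ≡ᶠ c v))

    -- `count-pairs` times the square of the number of classes, with the squared class sizes
    -- estimated by `size-variance`. One inequality thus controls both the missing pairs and the
    -- shortfall of class j.
    variance : (c : Fin n → Fin (suc r)) → ∀ j → let open Structure G c; d = n ∸ suc r * size j in
      suc r * suc r * (E + ∑∑ miss) + suc r * (n * n) + d * d ≤ suc r * suc r * (loss c + n * n)
    variance c j = begin
      suc r * suc r * (E + ∑∑ miss) + suc r * (n * n) + d * d
        ≡⟨ +-assoc (suc r * suc r * (E + ∑∑ miss)) (suc r * (n * n)) (d * d) ⟩
      suc r * suc r * (E + ∑∑ miss) + (suc r * (n * n) + d * d)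
        ≤⟨ +-monoʳ-≤ (suc r * suc r * (E + ∑∑ miss)) (Sizes.size-variance G c j) ⟩
      suc r * suc r * (E + ∑∑ miss) + suc r * suc r * ∑ (λ i → size i * size i)
        ≡⟨ *-distribˡ-+ (suc r * suc r) (E + ∑∑ miss) (∑ λ i → size i * size i) ⟨
      suc r * suc r * (E + ∑∑ miss + ∑ (λ i → size i * size i))
        ≡⟨ cong (suc r * suc r *_) count-pairs ⟩
      suc r * suc r * (loss c + n * n) ∎
      where
      open ≤-Reasoning
      open Structure G c
      d = n ∸ suc r * size j

-- Casting counts to rationals, and ordered-field arithmetic.

module Rationals where
  open import Data.Integer.Base using (+_)
  open import Data.Rational.Base using (½; _/_; _≤_; _<_; _+_; _*_; _-_; -_)
  open Combinatorics using (∑)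
  open MultiplicationLemmas
  open RootLemmas
  open +-*-Solver

  infix 9 ↑_ #_

  #_ : ℕ → ℚ
  # n = + n / 1

  -- Opaque, because normalising the fractions of symbolic counts is expensive.
  opaque
    ↑_ : ℕ → ℚ
    ↑ n = # n

    ↑≡# : ∀ n → ↑ n ≡ # n
    ↑≡# n = refl

    -- The equations are arguments so that the cast of a compound expression is obtained by nesting
    -- these lemmas along its syntax, with `refl` at the leaves.
    ↑+ : ∀ {a b x y} → ↑ a ≡ x → ↑ b ≡ y → ↑ (a ℕ.+ b) ≡ x + y
    ↑+ {a} {b} refl refl = ℚ.toℚᵘ-injective (begin
      ℚ.toℚᵘ (# (a ℕ.+ b))                 ≈⟨ toℚᵘ-/ (a ℕ.+ b) 0 ⟩
      mkℚᵘ (+ (a ℕ.+ b)) 0                 ≈⟨ ℚᵘ.*≡* (cong (ℤ._* + 1) (trans (ℤ.pos-+ a b) (sym (cong₂ ℤ._+_ (ℤ.*-identityʳ (+ a)) (ℤ.*-identityʳ (+ b)))))) ⟩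
      mkℚᵘ (+ a) 0 ℚᵘ.+ mkℚᵘ (+ b) 0       ≈⟨ ℚᵘ.+-cong (toℚᵘ-/ a 0) (toℚᵘ-/ b 0) ⟨
      ℚ.toℚᵘ (# a) ℚᵘ.+ ℚ.toℚᵘ (# b)       ≈⟨ ℚ.toℚᵘ-homo-+ (# a) (# b) ⟨
      ℚ.toℚᵘ (# a + # b)                   ∎)
      where open import Relation.Binary.Reasoning.Setoid ℚᵘ.≃-setoid

    ↑* : ∀ {a b x y} → ↑ a ≡ x → ↑ b ≡ y → ↑ (a ℕ.* b) ≡ x * y
    ↑* {a} {b} refl refl = ℚ.toℚᵘ-injective (begin
      ℚ.toℚᵘ (# (a ℕ.* b))                 ≈⟨ toℚᵘ-/ (a ℕ.* b) 0 ⟩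
      mkℚᵘ (+ (a ℕ.* b)) 0                 ≈⟨ ℚᵘ.*≡* (cong (ℤ._* + 1) (ℤ.pos-* a b)) ⟩
      mkℚᵘ (+ a) 0 ℚᵘ.* mkℚᵘ (+ b) 0       ≈⟨ ℚᵘ.*-cong (toℚᵘ-/ a 0) (toℚᵘ-/ b 0) ⟨
      ℚ.toℚᵘ (# a) ℚᵘ.* ℚ.toℚᵘ (# b)       ≈⟨ ℚ.toℚᵘ-homo-* (# a) (# b) ⟨
      ℚ.toℚᵘ (# a * # b)                   ∎)
      where open import Relation.Binary.Reasoning.Setoid ℚᵘ.≃-setoid

    ↑-mono : ∀ {a b} → a ℕ.≤ b → ↑ a ≤ ↑ b
    ↑-mono = /-mono 0

    0≤↑ : ∀ a → 0ℚ ≤ ↑ a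
    0≤↑ a = 0≤/ a 0

  0≤# : ∀ a → 0ℚ ≤ # a
  0≤# a = 0≤/ a 0

  0<1 : 0ℚ < 1ℚ
  0<1 = ℚ.positive⁻¹ 1ℚ

  0≤1 : 0ℚ ≤ 1ℚ
  0≤1 = ℚ.<⇒≤ 0<1

  1≤↑ : ∀ n → .{{ℕ.NonZero n}} → 1ℚ ≤ ↑ n
  1≤↑ (suc n) = subst (_≤ ↑ suc n) (↑≡# 1) (↑-mono {1} {suc n} (ℕ.s≤s ℕ.z≤n))

  1≤# : ∀ n → .{{ℕ.NonZero n}} → 1ℚ ≤ # n
  1≤# n = subst (1ℚ ≤_) (↑≡# n) (1≤↑ n)

  0≤+ : ∀ {a b} → 0ℚ ≤ a → 0ℚ ≤ b → 0ℚ ≤ a + b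
  0≤+ = ℚ.+-mono-≤

  0≤* : ∀ {a b} → 0ℚ ≤ a → 0ℚ ≤ b → 0ℚ ≤ a * b
  0≤* {a} {b} 0≤a 0≤b = subst (_≤ a * b) (ℚ.*-zeroʳ a) (ℚ.*-monoˡ-≤-nonNeg a {{ℚ.nonNegative 0≤a}} 0≤b)

  0≤- : ∀ {a b} → a ≤ b → 0ℚ ≤ b - a
  0≤- {a} {b} a≤b = subst (_≤ b - a) (ℚ.+-inverseʳ a) (ℚ.+-monoˡ-≤ (- a) a≤b)

  -- The estimates below are certificates: the difference of the two sides is written as a
  -- combination of slacks of the hypotheses with nonnegative coefficients, and the ring solver
  -- checks the identity.
  ≤-by : ∀ {a b} e → 0ℚ ≤ e → b ≡ a + e → a ≤ b
  ≤-by {a} e 0≤e refl = p≤p+q {a} 0≤e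

  *-mono : ∀ {a b c d} → 0ℚ ≤ a → 0ℚ ≤ c → a ≤ b → c ≤ d → a * c ≤ b * d
  *-mono 0≤a 0≤c a≤b c≤d = *-mono-≤⁺ 0≤a (ℚ.≤-trans 0≤c c≤d) a≤b c≤d

  *-monoˡ : ∀ c {a b} → 0ℚ ≤ c → a ≤ b → c * a ≤ c * b
  *-monoˡ c 0≤c = ℚ.*-monoˡ-≤-nonNeg c {{ℚ.nonNegative 0≤c}}

  *-monoʳ : ∀ c {a b} → 0ℚ ≤ c → a ≤ b → a * c ≤ b * c
  *-monoʳ c 0≤c = ℚ.*-monoʳ-≤-nonNeg c {{ℚ.nonNegative 0≤c}}

  *-cancel : ∀ c {a b} → 0ℚ < c → c * a ≤ c * b → a ≤ b
  *-cancel c 0<c = ℚ.*-cancelˡ-≤-pos c {{ℚ.positive 0<c}}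

  square-cancel : ∀ {a b} → 0ℚ ≤ b → a * a ≤ b * b → a ≤ b
  square-cancel {a} {b} 0≤b h = ℚ.≮⇒≥ λ b<a → ℚ.<-irrefl refl (ℚ.<-≤-trans (strict b<a) h)
    where
    strict : b < a → b * b < a * a
    strict b<a = ℚ.≤-<-trans (*-monoˡ b 0≤b (ℚ.<⇒≤ b<a))
      (ℚ.*-monoˡ-<-pos a {{ℚ.positive 0<a}} b<a)
      where 0<a = ℚ.≤-<-trans 0≤b b<a

  -- Serves as Markov's inequality, with `f` the indicator of a set of vertices that each have many
  -- missing pairs.
  *-∑-≤ : ∀ {n} t {f g : Fin n → ℕ} → (∀ i → t * ↑ f i ≤ ↑ g i) → t * ↑ ∑ f ≤ ↑ ∑ g
  *-∑-≤ {zero}  t h = ℚ.≤-reflexive (trans (cong (t *_) (↑≡# 0)) (trans (ℚ.*-zeroʳ t) (sym (↑≡# 0))))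
  *-∑-≤ {suc n} t {f} {g} h = subst₂ _≤_
    (trans (sym (ℚ.*-distribˡ-+ t (↑ f zero) (↑ ∑ (λ i → f (suc i))))) (cong (t *_) (sym (↑+ {f zero} refl refl))))
    (sym (↑+ {g zero} refl refl))
    (ℚ.+-mono-≤ (h zero) (*-∑-≤ t (λ i → h (suc i))))

  -- Numerical estimates in `R`, `N` and `τ`.

  2ℚ 3ℚ 4ℚ : ℚ
  2ℚ = # 2
  3ℚ = # 3
  4ℚ = # 4

  -- 4 (x + y)³ - 27 x² y = (x - 2 y)² (4 x + y).
  am-gm : ∀ x y → 0ℚ ≤ x → 0ℚ ≤ y → # 27 * (x * x * y) ≤ 4ℚ * ((x + y) * (x + y) * (x + y))
  am-gm x y 0≤x 0≤y = ≤-by ((x - 2ℚ * y) * (x - 2ℚ * y) * (4ℚ * x + y))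
    (0≤* (square (x - 2ℚ * y)) (0≤+ (0≤* (0≤# 4) 0≤x) 0≤y))
    (solve 2 (λ x y → con 4ℚ :* ((x :+ y) :* (x :+ y) :* (x :+ y)) :=
        con (# 27) :* (x :* x :* y) :+ (x :- con 2ℚ :* y) :* (x :- con 2ℚ :* y) :* (con 4ℚ :* x :+ y)) refl x y)
    where
    square : ∀ a → 0ℚ ≤ a * a
    square a with ℚ.≤-total 0ℚ a
    ... | inj₁ 0≤a = 0≤* 0≤a 0≤a
    ... | inj₂ a≤0 = subst (0ℚ ≤_) (solve 1 (λ a → (:- a) :* (:- a) := a :* a) refl a) (0≤* 0≤-a 0≤-a)
      where 0≤-a = ℚ.neg-antimono-≤ a≤0

  -- `curvature` is the rate κ that `joint` produces. In `errorRate`, 8 is half of the 16 that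
  -- bounds the ordered pairs of `heavy` vertices, and 2 κ + κ² comes from (1 + κ τ)² ≤ 1 + (2 κ +
  -- κ²) τ.
  curvature errorRate : ℚ → ℚ
  curvature R = # 112 * (R * R)
  errorRate R = # 8 + R * (2ℚ * curvature R + curvature R * curvature R)

  -- Here N is the number of vertices, R the number of classes, and the edge
  -- deficit is q = τ⁶ N².
  module Estimates (R N τ : ℚ) (1≤R : 1ℚ ≤ R) (0<N : 0ℚ < N) (0<τ : 0ℚ < τ) (small : # 10 * (R * τ) ≤ 1ℚ) where

    p q t κ g K : ℚ
    p = τ * τ * τ
    q = p * p * (N * N)
    t = p * p * p
    κ = curvature R
    g = 1ℚ + κ * τ
    K = errorRate R

    0<R : 0ℚ < R
    0<R = ℚ.<-≤-trans 0<1 1≤R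
    0≤R = ℚ.<⇒≤ 0<R
    0≤N = ℚ.<⇒≤ 0<N
    0≤τ = ℚ.<⇒≤ 0<τ

    0≤p : 0ℚ ≤ p
    0≤p = 0≤* (0≤* 0≤τ 0≤τ) 0≤τ
    0≤q : 0ℚ ≤ q
    0≤q = 0≤* (0≤* 0≤p 0≤p) (0≤* 0≤N 0≤N)

    τ≤1 : τ ≤ 1ℚ
    τ≤1 = ℚ.≤-trans (≤-by (τ * (R - 1ℚ) + # 9 * (R * τ)) (0≤+ (0≤* 0≤τ (0≤- 1≤R)) (0≤* (0≤# 9) (0≤* 0≤R 0≤τ)))
      (solve 2 (λ r x → con (# 10) :* (r :* x) := x :+ (x :* (r :- con 1ℚ) :+ con (# 9) :* (r :* x))) refl R τ)) small

    p≤τ : p ≤ τ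
    p≤τ = ≤-by (τ * (1ℚ - τ) + τ * τ * (1ℚ - τ))
      (0≤+ (0≤* 0≤τ (0≤- τ≤1)) (0≤* (0≤* 0≤τ 0≤τ) (0≤- τ≤1)))
      (solve 1 (λ x → x := x :* x :* x :+ (x :* (con 1ℚ :- x) :+ x :* x :* (con 1ℚ :- x))) refl τ)

    module _ {E b : ℚ} (deficit : R * (N * N) ≤ N * N + R * E + 2ℚ * (R * q)) where

      loss-bound : R * (E + b) + N * N ≤ R * (N * N) → b ≤ 2ℚ * q
      loss-bound h = *-cancel R 0<R (≤-by _ (0≤+ (0≤- h) (0≤- deficit))
        (solve 5 (λ R E b M q → R :* (con 2ℚ :* q) :=
           R :* b :+ ((R :* M :- (R :* (E :+ b) :+ M)) :+ ((M :+ R :* E :+ con 2ℚ :* (R :* q)) :- R :* M))) refl R E b (N * N) q))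

      module _ {μ d : ℚ} (0≤d : 0ℚ ≤ d) (h : R * R * (E + μ) + R * (N * N) + d * d ≤ R * R * (b + N * N)) where

        balance : R * R * μ + d * d ≤ R * R * (b + 2ℚ * q)
        balance = ≤-by _ (0≤+ (0≤- h) (0≤* 0≤R (0≤- deficit)))
          (solve 7 (λ R E b M q μ d → R :* R :* (b :+ con 2ℚ :* q) := R :* R :* μ :+ d :* d :+
             ((R :* R :* (b :+ M) :- (R :* R :* (E :+ μ) :+ R :* M :+ d :* d)) :+ R :* ((M :+ R :* E :+ con 2ℚ :* (R :* q)) :- R :* M)))
            refl R E b (N * N) q μ d)

        missing-bound : μ ≤ b + 2ℚ * q
        missing-bound = *-cancel (R * R) (pos*pos 0<R 0<R) (ℚ.≤-trans (p≤p+q (0≤* 0≤d 0≤d)) balance)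

        class-deficit : 0ℚ ≤ μ → b ≤ 2ℚ * q → d ≤ 2ℚ * (R * (p * N))
        class-deficit 0≤μ b≤ = square-cancel (0≤* (0≤# 2) (0≤* 0≤R (0≤* 0≤p 0≤N))) (≤-by _
          (0≤+ (0≤+ (0≤* (0≤* 0≤R 0≤R) 0≤μ) (0≤- balance)) (0≤* (0≤* 0≤R 0≤R) (0≤- b≤)))
          (solve 6 (λ R N p μ d b → con 2ℚ :* (R :* (p :* N)) :* (con 2ℚ :* (R :* (p :* N))) :=
            d :* d :+ (R :* R :* μ :+ (R :* R :* (b :+ con 2ℚ :* (p :* p :* (N :* N))) :- (R :* R :* μ :+ d :* d))
              :+ R :* R :* (con 2ℚ :* (p :* p :* (N :* N)) :- b))) refl R N p μ d b))

    missing-bound′ : ∀ {μ b} → μ ≤ b + 2ℚ * q → b ≤ 2ℚ * q → μ ≤ 4ℚ * q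
    missing-bound′ {μ} {b} h b≤ = ≤-by _ (0≤+ (0≤- h) (0≤- b≤))
      (solve 3 (λ μ b q → con 4ℚ :* q := μ :+ ((b :+ con 2ℚ :* q :- μ) :+ (con 2ℚ :* q :- b))) refl μ b q)

    clique-deficit : ∀ {μ k} → μ ≤ 4ℚ * q → 2ℚ * (k * k) ≤ μ → k ≤ 2ℚ * (p * N)
    clique-deficit {μ} {k} μ≤ h = square-cancel (0≤* (0≤# 2) (0≤* 0≤p 0≤N)) (*-cancel 2ℚ (ℚ.<-≤-trans 0<1 (1≤# 2))
      (≤-by _ (0≤+ (0≤+ (0≤- h) (0≤- μ≤)) (0≤* (0≤# 4) 0≤q))
        (solve 4 (λ μ k p N → con 2ℚ :* (con 2ℚ :* (p :* N) :* (con 2ℚ :* (p :* N))) := con 2ℚ :* (k :* k) :+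
          ((μ :- con 2ℚ :* (k :* k)) :+ (con 4ℚ :* (p :* p :* (N :* N)) :- μ) :+ con 4ℚ :* (p :* p :* (N :* N)))) refl μ k p N)))

    -- The constant 5 collects 2 from the class shortfall d, 2 from the common neighbourhood k, both
    -- by p ≤ τ, and 1 from the end with at most τ N missing pairs.
    cover-bound : ∀ {V d m m′ k} → N ≤ R * V + d → V ≤ m + m′ + k → d ≤ 2ℚ * (R * (p * N)) → k ≤ 2ℚ * (p * N) → m′ ≤ τ * N →
                  N ≤ R * m + # 5 * (R * (τ * N))
    cover-bound {V} {d} {m} {m′} {k} h₁ h₂ h₃ h₄ h₅ = ≤-by _
      (0≤+ (0≤+ (0≤+ (0≤- h₁) (0≤* 0≤R (0≤- h₂))) (0≤- h₃)) (0≤* 0≤R (0≤+ (0≤+ (0≤- h₄) (0≤- h₅)) (0≤* (0≤* (0≤# 4) 0≤N) (0≤- p≤τ)))))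
      (solve 9 (λ R N τ p V d m m′ k → R :* m :+ con (# 5) :* (R :* (τ :* N)) := N :+
        (((R :* V :+ d :- N) :+ R :* (m :+ m′ :+ k :- V)) :+ (con 2ℚ :* (R :* (p :* N)) :- d)
          :+ R :* ((con 2ℚ :* (p :* N) :- k) :+ (τ :* N :- m′) :+ con 4ℚ :* N :* (τ :- p)))) refl R N τ p V d m m′ k)

    heavy-bound : ∀ {μ s} → μ ≤ 4ℚ * q → τ * N * s ≤ μ → s ≤ 4ℚ * (p * (τ * τ) * N)
    heavy-bound {μ} {s} μ≤ h = *-cancel (τ * N) (pos*pos 0<τ 0<N) (≤-by _ (0≤+ (0≤- h) (0≤- μ≤))
      (solve 4 (λ τ N μ s → τ :* N :* (con 4ℚ :* (τ :* τ :* τ :* (τ :* τ) :* N)) := τ :* N :* s :+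
        ((μ :- τ :* N :* s) :+ (con 4ℚ :* (τ :* τ :* τ :* (τ :* τ :* τ) :* (N :* N)) :- μ))) refl τ N μ s))

    -- By `small`, N - 5 R τ N is at least N / 2. This crude bound on a, of order τ⁶ N, is what
    -- makes the overlap terms of `twice` negligible in `joint`.
    light-bound : ∀ {μ Σ a} → 0ℚ ≤ a → μ ≤ 4ℚ * q → Σ ≤ μ → (N - # 5 * (R * (τ * N))) * a ≤ R * Σ → a ≤ # 8 * (R * (p * p) * N)
    light-bound {μ} {Σ} {a} 0≤a μ≤ Σ≤ h = *-cancel N 0<N (≤-by _
      (0≤+ (0≤+ (0≤* (0≤* (0≤# 2) 0≤R) (0≤+ (0≤- μ≤) (0≤- Σ≤))) (0≤* (0≤# 2) (0≤- h))) (0≤* (0≤* 0≤N 0≤a) (0≤- small)))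
      (solve 7 (λ R N τ p μ Σ a → N :* (con (# 8) :* (R :* (p :* p) :* N)) := N :* a :+
        (con 2ℚ :* R :* ((con 4ℚ :* (p :* p :* (N :* N)) :- μ) :+ (μ :- Σ)) :+ con 2ℚ :* (R :* Σ :- (N :- con (# 5) :* (R :* (τ :* N))) :* a)
          :+ N :* a :* (con 1ℚ :- con (# 10) :* (R :* τ)))) refl R N τ p μ Σ a))

    module _ {μ b Σ a k s : ℚ} (0≤a : 0ℚ ≤ a) (0≤k : 0ℚ ≤ k) (0≤s : 0ℚ ≤ s)
             (μ≤ : μ ≤ b + 2ℚ * q) (b≤ : b ≤ s * s + 2ℚ * (a * k))
             (s≤ : s ≤ 4ℚ * (p * (τ * τ) * N)) (a≤ : a ≤ # 8 * (R * (p * p) * N)) (k≤ : k ≤ 2ℚ * (p * N))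
             (light : (N - # 5 * (R * (τ * N))) * a ≤ R * Σ)
             (twice : 2ℚ * Σ + 2ℚ * (k * k) ≤ μ + a * a + 2ℚ * (a * (R * k))) where

      -- The unit of error: τ times α N².
      w : ℚ
      w = τ * (p * p) * (N * N)

      0≤w : 0ℚ ≤ w
      0≤w = 0≤* (0≤* 0≤τ (0≤* 0≤p 0≤p)) (0≤* 0≤N 0≤N)

      p≤1 : p ≤ 1ℚ
      p≤1 = ℚ.≤-trans p≤τ τ≤1

      shrinks : ∀ {c x} → 0ℚ ≤ c → x ≤ 1ℚ → c * x ≤ c
      shrinks {c} 0≤c x≤1 = subst (c * _ ≤_) (ℚ.*-identityʳ c) (*-monoˡ c 0≤c x≤1)

      grows : ∀ {c} → 0ℚ ≤ c → c ≤ R * c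
      grows {c} 0≤c = subst (_≤ R * c) (ℚ.*-identityˡ c) (*-monoʳ c 0≤c 1≤R)

      ss≤ : s * s ≤ # 16 * w
      ss≤ = ℚ.≤-trans (*-mono 0≤s 0≤s s≤ s≤) (subst (_≤ # 16 * w)
        (solve 2 (λ τ N → con (# 16) :* (τ :* (τ :* τ :* τ :* (τ :* τ :* τ)) :* (N :* N)) :* (τ :* τ :* τ) :=
          con 4ℚ :* (τ :* τ :* τ :* (τ :* τ) :* N) :* (con 4ℚ :* (τ :* τ :* τ :* (τ :* τ) :* N))) refl τ N)
        (shrinks (0≤* (0≤# 16) 0≤w) p≤1))

      ak≤ : a * k ≤ # 16 * (R * w)
      ak≤ = ℚ.≤-trans (*-mono 0≤a 0≤k a≤ k≤) (subst (_≤ # 16 * (R * w))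
        (solve 3 (λ R τ N → con (# 16) :* (R :* (τ :* (τ :* τ :* τ :* (τ :* τ :* τ)) :* (N :* N))) :* (τ :* τ) :=
          con (# 8) :* (R :* (τ :* τ :* τ :* (τ :* τ :* τ)) :* N) :* (con 2ℚ :* (τ :* τ :* τ :* N))) refl R τ N)
        (shrinks (0≤* (0≤# 16) (0≤* 0≤R 0≤w)) (ℚ.≤-trans (*-mono 0≤τ 0≤τ τ≤1 τ≤1) ℚ.≤-refl)))

      aa≤ : a * a ≤ # 64 * (R * R * w)
      aa≤ = ℚ.≤-trans (*-mono 0≤a 0≤a a≤ a≤) (subst (_≤ # 64 * (R * R * w))
        (solve 3 (λ R τ N → con (# 64) :* (R :* R :* (τ :* (τ :* τ :* τ :* (τ :* τ :* τ)) :* (N :* N))) :* (τ :* τ :* τ :* (τ :* τ)) :=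
          con (# 8) :* (R :* (τ :* τ :* τ :* (τ :* τ :* τ)) :* N) :* (con (# 8) :* (R :* (τ :* τ :* τ :* (τ :* τ :* τ)) :* N))) refl R τ N)
        (shrinks (0≤* (0≤# 64) (0≤* (0≤* 0≤R 0≤R) 0≤w)) (*-mono 0≤p (0≤* 0≤τ 0≤τ) p≤1 (*-mono 0≤τ 0≤τ τ≤1 τ≤1))))

      τaN≤ : τ * a * N ≤ # 8 * (R * w)
      τaN≤ = subst (τ * a * N ≤_)
        (solve 4 (λ R τ p N → τ :* (con (# 8) :* (R :* (p :* p) :* N)) :* N := con (# 8) :* (R :* (τ :* (p :* p) :* (N :* N)))) refl R τ p N)
        (*-monoʳ N 0≤N (*-monoˡ τ 0≤τ a≤))

      w≤Rw : w ≤ R * w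
      w≤Rw = grows 0≤w

      Rw≤RRw : R * w ≤ R * R * w
      Rw≤RRw = subst (R * w ≤_) (sym (ℚ.*-assoc R R w)) (grows (0≤* 0≤R 0≤w))

      -- The constraint under which a k is maximised. Inserting the bounds on μ, b and the overlaps
      -- into `light` and `twice` leaves an error of R times 16 w + 112 R w + 96 R² w, at most 224
      -- R² w since R ≥ 1. Both sides carry a factor 2, so half of this is κ τ relative to α N².
      joint : a * N + R * (k * k) ≤ R * (p * p * g * (N * N))
      joint = *-cancel 2ℚ (ℚ.<-≤-trans 0<1 (1≤# 2)) (≤-by _
        (0≤+ (0≤* (0≤# 2) (0≤- light)) (0≤* 0≤R (0≤+ (0≤- twice) (0≤+ (0≤- μ≤) (0≤+ (0≤- b≤) (0≤+ (0≤- ss≤) (0≤+ (0≤* (0≤# 2) (0≤- ak≤)) (0≤+ (0≤- aa≤) (0≤+ (0≤* (0≤* (0≤# 2) 0≤R) (0≤- ak≤)) (0≤+ (0≤* (0≤# 10) (0≤- τaN≤)) (0≤+ (0≤* (0≤# 16) (0≤- w≤Rw)) (0≤* (0≤# 128) (0≤- Rw≤RRw)))))))))))))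
        (solve 10 (λ R N τ p μ b Σ a k s → let w = τ :* (p :* p) :* (N :* N) in
          con 2ℚ :* (R :* (p :* p :* (con 1ℚ :+ con (# 112) :* (R :* R) :* τ) :* (N :* N))) :=
          con 2ℚ :* (a :* N :+ R :* (k :* k)) :+ (con 2ℚ :* (R :* Σ :- (N :- con (# 5) :* (R :* (τ :* N))) :* a)
            :+ R :* ((μ :+ a :* a :+ con 2ℚ :* (a :* (R :* k)) :- (con 2ℚ :* Σ :+ con 2ℚ :* (k :* k)))
            :+ ((b :+ con 2ℚ :* (p :* p :* (N :* N)) :- μ)
            :+ ((s :* s :+ con 2ℚ :* (a :* k) :- b)
            :+ ((con (# 16) :* w :- s :* s)
            :+ (con 2ℚ :* (con (# 16) :* (R :* w) :- a :* k)
            :+ ((con (# 64) :* (R :* R :* w) :- a :* a)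
            :+ (con 2ℚ :* R :* (con (# 16) :* (R :* w) :- a :* k)
            :+ (con (# 10) :* (con (# 8) :* (R :* w) :- τ :* a :* N)
            :+ (con (# 16) :* (R :* w :- w)
            :+ con (# 128) :* (R :* R :* w :- R :* w))))))))))))
          refl R N τ p μ b Σ a k s))

      0≤M : 0ℚ ≤ N * N
      0≤M = 0≤* 0≤N 0≤N
      0≤t : 0ℚ ≤ t
      0≤t = 0≤* (0≤* 0≤p 0≤p) 0≤p
      0≤κ : 0ℚ ≤ κ
      0≤κ = 0≤* (0≤# 112) (0≤* 0≤R 0≤R)
      0≤g : 0ℚ ≤ g
      0≤g = 0≤+ 0≤1 (0≤* 0≤κ 0≤τ)
      1≤g : 1ℚ ≤ g
      1≤g = p≤p+q (0≤* 0≤κ 0≤τ)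

      module _ {σ : ℚ} (0≤σ : 0ℚ ≤ σ) (1≤3σ² : 1ℚ ≤ 3ℚ * (σ * σ)) where

        -- `am-gm` with x = a N and y = R k², for which x² y = R N² (a k)². The comparison is made
        -- between squares: σ stands for an upper approximation of 1/√3, and g² replaces g^(3/2), at
        -- no cost because g ≥ 1.
        product-bound : 3ℚ * (a * k) ≤ 2ℚ * R * σ * t * (g * g) * (N * N)
        product-bound = square-cancel (0≤* (0≤* (0≤* (0≤* (0≤* (0≤# 2) 0≤R) 0≤σ) 0≤t) (0≤* 0≤g 0≤g)) 0≤M)
          (*-cancel 3ℚ (ℚ.<-≤-trans 0<1 (1≤# 3)) (begin
          3ℚ * (3ℚ * (a * k) * (3ℚ * (a * k)))
            ≤⟨ *-cancel (R * (N * N)) (pos*pos 0<R (pos*pos 0<N 0<N)) (subst₂ _≤_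
                 (solve 4 (λ R N a k → con (# 27) :* (a :* N :* (a :* N) :* (R :* (k :* k))) := R :* (N :* N) :* (con 3ℚ :* (con 3ℚ :* (a :* k) :* (con 3ℚ :* (a :* k))))) refl R N a k)
                 (solve 4 (λ R M p g → con 4ℚ :* (R :* (p :* p :* g :* M) :* (R :* (p :* p :* g :* M)) :* (R :* (p :* p :* g :* M))) := R :* M :* (con 4ℚ :* (R :* R :* (p :* p :* p) :* (p :* p :* p) :* (g :* g :* g) :* (M :* M)))) refl R (N * N) p g)
                 (ℚ.≤-trans (am-gm (a * N) (R * (k * k)) 0≤X 0≤Y) (*-monoˡ 4ℚ (0≤# 4) (*-mono (0≤* 0≤X+Y 0≤X+Y) 0≤X+Y (*-mono 0≤X+Y 0≤X+Y joint joint) joint)))) ⟩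
          4ℚ * (R * R * t * t * (g * g * g) * (N * N * (N * N)))
            ≤⟨ ≤-by _ (0≤+ (0≤* (0≤* 0≤U 0≤g³) (0≤- 1≤g)) (0≤* (0≤* 0≤U (0≤* 0≤g 0≤g³)) (0≤- 1≤3σ²)))
               (solve 5 (λ R t g M σ → let U = con 4ℚ :* (R :* R :* t :* t :* (M :* M)) in
                 con 3ℚ :* (con 2ℚ :* R :* σ :* t :* (g :* g) :* M :* (con 2ℚ :* R :* σ :* t :* (g :* g) :* M)) :=
                 con 4ℚ :* (R :* R :* t :* t :* (g :* g :* g) :* (M :* M)) :+ (U :* (g :* g :* g) :* (g :- con 1ℚ) :+ U :* (g :* (g :* g :* g)) :* (con 3ℚ :* (σ :* σ) :- con 1ℚ))) refl R t g (N * N) σ) ⟩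
          3ℚ * (2ℚ * R * σ * t * (g * g) * (N * N) * (2ℚ * R * σ * t * (g * g) * (N * N))) ∎))
          where
          open ℚ.≤-Reasoning
          0≤X : 0ℚ ≤ a * N
          0≤X = 0≤* 0≤a 0≤N
          0≤Y : 0ℚ ≤ R * (k * k)
          0≤Y = 0≤* 0≤R (0≤* 0≤k 0≤k)
          0≤X+Y = 0≤+ 0≤X 0≤Y
          0≤g³ : 0ℚ ≤ g * g * g
          0≤g³ = 0≤* (0≤* 0≤g 0≤g) 0≤g
          0≤U : 0ℚ ≤ 4ℚ * (R * R * t * t * (N * N * (N * N)))
          0≤U = 0≤* (0≤# 4) (0≤* (0≤* (0≤* (0≤* 0≤R 0≤R) 0≤t) 0≤t) (0≤* 0≤M 0≤M))

        conclusion : ∀ {D} → 2ℚ * D ≤ b → σ ≤ 1ℚ → 3ℚ * D ≤ (2ℚ * R * σ + 3ℚ * (K * τ)) * t * (N * N)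
        conclusion {D} 2D≤b σ≤1 = *-cancel 2ℚ (ℚ.<-≤-trans 0<1 (1≤# 2)) (≤-by _
          (0≤+ (0≤* (0≤# 3) (0≤- 2D≤b)) (0≤+ (0≤* (0≤# 3) (0≤- b≤)) (0≤+ (0≤* (0≤# 3) (0≤- ss≤′)) (0≤+ (0≤* (0≤# 2) (0≤- product-bound))
            (0≤* (0≤* (0≤* (0≤* 0≤t 0≤M) 0≤R) 0≤τ) (0≤+ (0≤+ (0≤* (0≤# 2) 0≤c) (0≤* (0≤* (0≤# 4) (0≤- σ≤1)) 0≤c)) (0≤* (0≤* (0≤* (0≤# 4) 0≤σ) (0≤* 0≤κ 0≤κ)) (0≤- τ≤1))))))))
          (solve 11 (λ R M τ t κ σ D b s a k →
            let c = con 2ℚ :* κ :+ κ :* κ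
                g = con 1ℚ :+ κ :* τ
            in con 2ℚ :* ((con 2ℚ :* R :* σ :+ con 3ℚ :* ((con (# 8) :+ R :* c) :* τ)) :* t :* M) :=
               con 2ℚ :* (con 3ℚ :* D) :+ (con 3ℚ :* (b :- con 2ℚ :* D) :+ (con 3ℚ :* (s :* s :+ con 2ℚ :* (a :* k) :- b)
                 :+ (con 3ℚ :* (con (# 16) :* (τ :* t :* M) :- s :* s) :+ (con 2ℚ :* (con 2ℚ :* R :* σ :* t :* (g :* g) :* M :- con 3ℚ :* (a :* k))
                 :+ t :* M :* R :* τ :* (con 2ℚ :* c :+ con 4ℚ :* (con 1ℚ :- σ) :* c :+ con 4ℚ :* σ :* (κ :* κ) :* (con 1ℚ :- τ)))))))
            refl R (N * N) τ t κ σ D b s a k))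
          where
          0≤c : 0ℚ ≤ 2ℚ * κ + κ * κ
          0≤c = 0≤+ (0≤* (0≤# 2) 0≤κ) (0≤* 0≤κ 0≤κ)
          ss≤′ : s * s ≤ # 16 * (τ * t * (N * N))
          ss≤′ = ℚ.≤-trans (*-mono 0≤s 0≤s s≤ s≤) (ℚ.≤-reflexive
            (solve 2 (λ τ N → con 4ℚ :* (τ :* τ :* τ :* (τ :* τ) :* N) :* (con 4ℚ :* (τ :* τ :* τ :* (τ :* τ) :* N)) :=
              con (# 16) :* (τ :* (τ :* τ :* τ :* (τ :* τ :* τ) :* (τ :* τ :* τ)) :* (N :* N))) refl τ N))

-- Stability in terms of the edge deficit.

module EdgeStability where
  open import Data.Nat.Base
  open import Data.Nat.Properties
  open Combinatorics
  open Rationals hiding (*-mono)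
  open import Algebra.Properties.Semiring.Sum +-*-semiring using (*-distribˡ-sum)

  *-indicator : ∀ {A : Set} (A? : Dec A) x {y} → (A → x ℚ.≤ y) → 0ℚ ℚ.≤ y → x ℚ.* ↑ ι (does A?) ℚ.≤ y
  *-indicator (yes a) x {y} h 0≤y = subst (ℚ._≤ y) (sym (trans (cong (x ℚ.*_) (↑≡# 1)) (ℚ.*-identityʳ x))) (h a)
  *-indicator (no _)  x {y} h 0≤y = subst (ℚ._≤ y) (sym x*0)  0≤y
    where x*0 = trans (cong (x ℚ.*_) (↑≡# 0)) (ℚ.*-zeroʳ x)

  *-indicator′ : ∀ {A : Set} (A? : Dec A) x r m → (A → x ℚ.≤ ↑ r ℚ.* ↑ m) → x ℚ.* ↑ ι (does A?) ℚ.≤ ↑ (r * (ι (does A?) * m))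
  *-indicator′ (yes a) x r m h = subst₂ ℚ._≤_ (sym (trans (cong (x ℚ.*_) (↑≡# 1)) (ℚ.*-identityʳ x)))
    (sym (trans (cong (λ z → ↑ (r * z)) (*-identityˡ m)) (↑* {r} refl refl))) (h a)
  *-indicator′ (no _)  x r m h = subst₂ ℚ._≤_
    (sym (trans (cong (x ℚ.*_) (↑≡# 0)) (ℚ.*-zeroʳ x))) (sym (trans (cong ↑_ (*-zeroʳ r)) (↑≡# 0))) ℚ.≤-refl

  module Stability {n r : ℕ} (G : Graph n) (free : CliqueFree G (3 + r)) (v₀ : Fin n) (0<n : 0ℚ ℚ.< ↑ n)
                   {τ : ℚ} (0<τ : 0ℚ ℚ.< τ) (small : # 10 ℚ.* (↑ (2 + r) ℚ.* τ) ℚ.≤ 1ℚ) where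
    open Graph G
    open Partition G
    open Optimum G free

    R N : ℚ
    R = ↑ (2 + r)
    N = ↑ n

    module Est′ = Estimates R N τ (1≤↑ (2 + r)) 0<n 0<τ small
    open Est′ using (p; q; t; K; 0≤R; 0≤N; 0≤τ)

    module _ (deficit : R ℚ.* (N ℚ.* N) ℚ.≤ N ℚ.* N ℚ.+ R ℚ.* ↑ E ℚ.+ 2ℚ ℚ.* (R ℚ.* q)) where

      c : Fin n → Fin (2 + r)
      c = proj₁ optimum
      opt : Optimal c
      opt = proj₁ (proj₂ optimum)

      open Structure G c

      μ : ℕ
      μ = ∑∑ miss

      b≤2q : ↑ loss c ℚ.≤ 2ℚ ℚ.* q
      b≤2q = Est′.loss-bound {↑ E} {↑ loss c} deficit (subst₂ ℚ._≤_
        (↑+ {(2 + r) * (E + loss c)} (↑* {2 + r} refl (↑+ {E} refl refl)) (↑* {n} refl refl))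
        (↑* {2 + r} refl (↑* {n} refl refl)) (↑-mono (proj₂ (proj₂ optimum))))

      variance-ℚ : ∀ j → let d = n ∸ (2 + r) * size j in
        R ℚ.* R ℚ.* (↑ E ℚ.+ ↑ μ) ℚ.+ R ℚ.* (N ℚ.* N) ℚ.+ ↑ d ℚ.* ↑ d ℚ.≤ R ℚ.* R ℚ.* (↑ loss c ℚ.+ N ℚ.* N)
      variance-ℚ j = subst₂ ℚ._≤_
        (↑+ {(2 + r) * (2 + r) * (E + μ) + (2 + r) * (n * n)} (↑+ {(2 + r) * (2 + r) * (E + μ)} (↑* {(2 + r) * (2 + r)} (↑* {2 + r} refl refl) (↑+ {E} refl refl)) (↑* {2 + r} refl (↑* {n} refl refl))) (↑* {n ∸ (2 + r) * size j} refl refl))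
        (↑* {(2 + r) * (2 + r)} (↑* {2 + r} refl refl) (↑+ {loss c} refl (↑* {n} refl refl)))
        (↑-mono (variance c j))

      μ≤b+2q : ↑ μ ℚ.≤ ↑ loss c ℚ.+ 2ℚ ℚ.* q
      μ≤b+2q = Est′.missing-bound {↑ E} {↑ loss c} deficit {↑ μ} (0≤↑ (n ∸ (2 + r) * size zero)) (variance-ℚ zero)

      μ≤4q : ↑ μ ℚ.≤ 4ℚ ℚ.* q
      μ≤4q = Est′.missing-bound′ μ≤b+2q b≤2q

      class-bound : ∀ j → ↑ (n ∸ (2 + r) * size j) ℚ.≤ 2ℚ ℚ.* (R ℚ.* (p ℚ.* N))
      class-bound j = Est′.class-deficit {↑ E} {↑ loss c} deficit {↑ μ} (0≤↑ (n ∸ (2 + r) * size j)) (variance-ℚ j) (0≤↑ μ) b≤2q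

      -- Despite the names, `light` is the stronger condition: it demands nearly N / R missing
      -- pairs, while `heavy` demands only τ N.
      heavy light : Fin n → Bool
      heavy u = does (τ ℚ.* N ℚ.≤? ↑ missing u)
      light u = does (N ℚ.≤? R ℚ.* ↑ missing u ℚ.+ # 5 ℚ.* (R ℚ.* (τ ℚ.* N)))

      -- In the class found by `monochromatic-edge`, u and v have few common neighbours, so almost
      -- every vertex there is missed by u or by v. If v misses fewer than τ N vertices, nearly the
      -- whole class is left to u.
      not-heavy : ∀ u v → u ~ v → c u ≡ c v → heavy v ≡ false → light u ≡ true
      not-heavy u v u~v cu≡cv e =
        let j , k , class , pairs = Cover.monochromatic-edge G c free u v u~v cu≡cv
        in dec-true (N ℚ.≤? _) (Est′.cover-bound {V = ↑ size j} {d = ↑ (n ∸ (2 + r) * size j)} {m′ = ↑ missing v} {k = ↑ k}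
          (subst (N ℚ.≤_) (↑+ {(2 + r) * size j} (↑* {2 + r} refl refl) refl) (↑-mono (m≤n+m∸n n ((2 + r) * size j))))
          (subst (↑ size j ℚ.≤_) (↑+ {missing u + missing v} (↑+ {missing u} refl refl) refl) (↑-mono class))
          (class-bound j)
          (Est′.clique-deficit μ≤4q (subst (ℚ._≤ ↑ μ) (↑* {2} (↑≡# 2) (↑* {k} refl refl)) (↑-mono pairs)))
          (ℚ.<⇒≤ (ℚ.≰⇒> λ le → contra e (dec-true (τ ℚ.* N ℚ.≤? ↑ missing v) le))))
        where
        contra : ∀ {b} → b ≡ false → b ≡ true → ⊥
        contra refl ()

      covered : ∀ u v → u ~ v → c u ≡ c v → (heavy u ≡ true × heavy v ≡ true) ⊎ light u ≡ true ⊎ light v ≡ true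
      covered u v u~v cu≡cv with heavy u in eu | heavy v in ev
      ... | true  | true  = inj₁ (refl , refl)
      ... | _     | false = inj₂ (inj₁ (not-heavy u v u~v cu≡cv ev))
      ... | false | true  = inj₂ (inj₂ (not-heavy v u (~-sym u~v) (sym cu≡cv) eu))

      |heavy| |light| : ℕ
      |heavy| = ∑ λ u → ι (heavy u)
      |light| = ∑ λ u → ι (light u)

      heavy-sum : τ ℚ.* N ℚ.* ↑ |heavy| ℚ.≤ ↑ μ
      heavy-sum = *-∑-≤ (τ ℚ.* N) λ u → *-indicator (τ ℚ.* N ℚ.≤? ↑ missing u) (τ ℚ.* N) (λ h → h) (0≤↑ (missing u))

      ∑light : ℕ
      ∑light = ∑ λ u → ι (light u) * missing u

      light-sum : (N ℚ.- # 5 ℚ.* (R ℚ.* (τ ℚ.* N))) ℚ.* ↑ |light| ℚ.≤ R ℚ.* ↑ ∑light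
      light-sum = subst (x ℚ.* ↑ |light| ℚ.≤_) (trans (cong ↑_ (sym (*-distribˡ-sum {n} (2 + r) λ u → ι (light u) * missing u))) (↑* {2 + r} refl refl))
        (*-∑-≤ x λ u → *-indicator′ (N ℚ.≤? R ℚ.* ↑ missing u ℚ.+ # 5 ℚ.* (R ℚ.* (τ ℚ.* N))) x (2 + r) (missing u)
          λ h → RationalLemmas.shift {b = # 5 ℚ.* (R ℚ.* (τ ℚ.* N))} (subst (N ℚ.≤_) (ℚ.+-comm (R ℚ.* ↑ missing u) _) h))
        where
        x = N ℚ.- # 5 ℚ.* (R ℚ.* (τ ℚ.* N))

      ∑light≤μ : ∑light ≤ μ
      ∑light≤μ = ∑-mono λ u → ≤-trans (*-monoˡ-≤ (missing u) (ι≤1 (light u))) (≤-reflexive (*-identityˡ (missing u)))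

      stability : ∀ {σ} → 0ℚ ℚ.≤ σ → 1ℚ ℚ.≤ 3ℚ ℚ.* (σ ℚ.* σ) → σ ℚ.≤ 1ℚ →
                  3ℚ ℚ.* ↑ D (2 + r) G ℚ.≤ (2ℚ ℚ.* R ℚ.* σ ℚ.+ 3ℚ ℚ.* (K ℚ.* τ)) ℚ.* t ℚ.* (N ℚ.* N)
      stability 0≤σ 1≤3σ² σ≤1 =
        let k , deg≤k , χ , χ≤1 , ∑χ , pairs = Peak.peak G c free v₀ opt
            pairs≤μ : 2 * (k * k) ≤ μ
            pairs≤μ = ≤-trans pairs (∑∑-mono {n} {n} λ u v → weight (χ≤1 u) (weight {b = miss u v} (χ≤1 v) ≤-refl))
            twice : 2 * ∑light + 2 * (k * k) ≤ μ + |light| * |light| + 2 * (|light| * ((2 + r) * k))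
            twice = ≤-trans (+-monoʳ-≤ (2 * ∑light) pairs)
              (subst (λ z → 2 * ∑light + ∑∑ (λ u v → χ u * (χ v * miss u v)) ≤ μ + |light| * |light| + 2 * (|light| * z)) ∑χ (missing-twice light χ χ≤1))
        in Est′.conclusion {μ = ↑ μ} {b = ↑ loss c} {Σ = ↑ ∑light} {a = ↑ |light|} {k = ↑ k} {s = ↑ |heavy|}
          (0≤↑ |light|) (0≤↑ k) (0≤↑ |heavy|) μ≤b+2q
          (subst (↑ loss c ℚ.≤_) (↑+ {|heavy| * |heavy|} (↑* {|heavy|} refl refl) (↑* {2} (↑≡# 2) (↑* {|light|} refl refl))) (↑-mono (loss-cover heavy light covered k deg≤k)))
          (Est′.heavy-bound μ≤4q heavy-sum)
          (Est′.light-bound (0≤↑ |light|) μ≤4q (↑-mono ∑light≤μ) light-sum)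
          (Est′.clique-deficit μ≤4q (subst (ℚ._≤ ↑ μ) (↑* {2} (↑≡# 2) (↑* {k} refl refl)) (↑-mono pairs≤μ)))
          light-sum
          (subst₂ ℚ._≤_ (↑+ {2 * ∑light} (↑* {2} (↑≡# 2) refl) (↑* {2} (↑≡# 2) (↑* {k} refl refl)))
            (↑+ {μ + |light| * |light|} (↑+ {μ} refl (↑* {|light|} refl refl)) (↑* {2} (↑≡# 2) (↑* {|light|} refl (↑* {2 + r} refl refl)))) (↑-mono twice))
          0≤σ 1≤3σ²
          {D = ↑ D (2 + r) G} (subst (ℚ._≤ ↑ loss c) (↑* {2} {D (2 + r) G} (↑≡# 2) refl) (↑-mono D≤loss))
          σ≤1
        where
        weight : ∀ {x a b} → x ≤ 1 → a ≤ b → x * a ≤ b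
        weight {a = a} {b} x≤1 a≤b = ≤-trans (*-mono-≤ x≤1 a≤b) (≤-reflexive (*-identityˡ b))

-- Powers of rationals, and the passage from clique deficit to `τ`.

module Reals where
  open import Data.Integer.Base using (+_)
  open import Data.Rational.Base using (½; _/_; _≤_; _<_; _+_; _*_; _-_; -_; _⊓_; ∣_∣)
  open import Algebra.Definitions.RawSemiring (Semiring.rawSemiring (CommutativeRing.semiring ℚ.+-*-commutativeRing)) using () renaming (_^_ to _^ℚ_)
  open import Algebra.Properties.CommutativeSemiring.Exp (CommutativeRing.commutativeSemiring ℚ.+-*-commutativeRing) using (^-homo-*; ^-assocʳ; ^-distrib-*)
  open Combinatorics using (absorption; 0<nCk; module Adjacency; module Optimum)
  open Rationals
  open EdgeStability using (module Stability)
  open MultiplicationLemmas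
  open RootLemmas
  open RationalLemmas
  open +-*-Solver

  infixr 8 _^_
  _^_ : ℚ → ℕ → ℚ
  _^_ = _^ℚ_

  -- Strict monotonicity is read off from superadditivity, applied to b and a - b > 0.
  ^-cancel-≤ : ∀ {a b} k → 0ℚ ≤ b → a ^ suc k ≤ b ^ suc k → a ≤ b
  ^-cancel-≤ {a} {b} k 0≤b h = ℚ.≮⇒≥ λ b<a → ℚ.<-irrefl refl (ℚ.<-≤-trans (mono-< b<a) h)
    where
    open ℚ.≤-Reasoning
    mono-< : b < a → b ^ suc k < a ^ suc k
    mono-< b<a = begin-strict
      b ^ suc k                      ≡⟨ ℚ.+-identityʳ (b ^ suc k) ⟨
      b ^ suc k + 0ℚ                 <⟨ ℚ.+-monoʳ-< (b ^ suc k) (^-pos (suc k) 0<a-b) ⟩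
      b ^ suc k + (a - b) ^ suc k    ≤⟨ ^-superadd k 0≤b (ℚ.<⇒≤ 0<a-b) ⟩
      (b + (a - b)) ^ suc k          ≡⟨ cong (_^ suc k) (solve 2 (λ a b → b :+ (a :- b) := a) refl a b) ⟩
      a ^ suc k                      ∎
      where
      0<a-b : 0ℚ < a - b
      0<a-b = subst (_< a - b) (ℚ.+-inverseʳ b) (ℚ.+-monoˡ-< (- b) b<a)

  ^≤1 : ∀ {x} k → 0ℚ ≤ x → x ≤ 1ℚ → x ^ k ≤ 1ℚ
  ^≤1 zero    0≤x x≤1 = ℚ.≤-refl
  ^≤1 {x} (suc k) 0≤x x≤1 = ℚ.≤-trans (*-monoˡ x 0≤x (^≤1 k 0≤x x≤1)) (ℚ.≤-trans (ℚ.≤-reflexive (ℚ.*-identityʳ x)) x≤1)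

  -- The k-th power has derivative at most k on the unit interval.
  ^-perturb : ∀ k {x e} → 0ℚ ≤ x → 0ℚ ≤ e → x + e ≤ 1ℚ → (x + e) ^ k ≤ x ^ k + ↑ k * e
  ^-perturb zero    {x} {e} 0≤x 0≤e h = ℚ.≤-reflexive (trans (solve 1 (λ e → con 1ℚ := con 1ℚ :+ con 0ℚ :* e) refl e) (cong (λ z → 1ℚ + z * e) (sym (↑≡# 0))))
  ^-perturb (suc k) {x} {e} 0≤x 0≤e h = begin
    (x + e) * (x + e) ^ k
      ≤⟨ *-monoˡ (x + e) (0≤+ 0≤x 0≤e) (^-perturb k 0≤x 0≤e h) ⟩
    (x + e) * (x ^ k + ↑ k * e)
      ≤⟨ ≤-by _ (0≤+ (0≤* 0≤e (0≤- xᵏ≤1)) (0≤* (0≤* (0≤↑ k) 0≤e) (0≤- h)))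
         (solve 4 (λ x e y k → x :* y :+ (con 1ℚ :+ k) :* e := (x :+ e) :* (y :+ k :* e) :+ (e :* (con 1ℚ :- y) :+ k :* e :* (con 1ℚ :- (x :+ e)))) refl x e (x ^ k) (↑ k)) ⟩
    x * x ^ k + (1ℚ + ↑ k) * e
      ≡⟨ cong (λ z → x * x ^ k + z * e) (sym (↑+ {1} {k} (↑≡# 1) refl)) ⟩
    x * x ^ k + ↑ (suc k) * e ∎
    where
    open ℚ.≤-Reasoning
    x≤1 : x ≤ 1ℚ
    x≤1 = ℚ.≤-trans (p≤p+q 0≤e) h
    xᵏ≤1 = ^≤1 k 0≤x x≤1

  -- The alternative `g ≡ 0ℚ` is the default value of a root approximation, which satisfies any
  -- nonnegative bound.
  lower-≤ : ∀ k {g q b} → g ^ suc k ≤ q ⊎ g ≡ 0ℚ → 0ℚ ≤ b → q ≤ b ^ suc k → g ≤ b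
  lower-≤ k (inj₁ gᵏ≤q) 0≤b q≤bᵏ = ^-cancel-≤ k 0≤b (ℚ.≤-trans gᵏ≤q q≤bᵏ)
  lower-≤ k (inj₂ refl) 0≤b _    = 0≤b

  lower-^-≤ : ∀ k {g q} → g ^ suc k ≤ q ⊎ g ≡ 0ℚ → 0ℚ ≤ q → g ^ suc k ≤ q
  lower-^-≤ k (inj₁ gᵏ≤q) _   = gᵏ≤q
  lower-^-≤ k {q = q} (inj₂ refl) 0≤q = subst (_≤ q) (sym (ℚ.*-zeroˡ (0ℚ ^ k))) 0≤q

  ^≤self : ∀ {x} k → 0ℚ ≤ x → x ≤ 1ℚ → x ^ suc k ≤ x
  ^≤self {x} k 0≤x x≤1 = ℚ.≤-trans (*-monoˡ x 0≤x (^≤1 k 0≤x x≤1)) (ℚ.≤-reflexive (ℚ.*-identityʳ x))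

  exponents : ∀ s → 9 ℕ.* (2 ℕ.* s) ≡ 6 ℕ.* (3 ℕ.* s)
  exponents = solve-∀

  -- With P = c^(3/2) z^(3/s) ≤ τ⁹ and x ≤ z^(2/s), the 3s-th powers show
  -- c x ≤ P^(2/3) ≤ τ⁶.
  deficit-power : ∀ s {c x ζ δ A Z W τ} → 0ℚ ≤ c → 0ℚ ≤ x → 0ℚ ≤ ζ → 0ℚ ≤ δ → 0ℚ ≤ A → 0ℚ ≤ Z → 0ℚ ≤ W → x ^ s ≤ (ζ * δ) ^ 2 →
    c ^ 3 ≤ A ^ 2 → ζ ^ 3 ≤ Z ^ s → δ ^ 3 ≤ W ^ s → A * Z * W ≤ τ ^ 9 → (c * x) ^ (3 ℕ.* s) ≤ (τ ^ 6) ^ (3 ℕ.* s)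
  deficit-power s {c} {x} {ζ} {δ} {A} {Z} {W} {τ} 0≤c 0≤x 0≤ζ 0≤δ 0≤A 0≤Z 0≤W xˢ≤z² c≤ ζ≤ δ≤ P≤ = begin
      (c * x) ^ (3 ℕ.* s)
        ≡⟨ ^-distrib-* c x (3 ℕ.* s) ⟩
      c ^ (3 ℕ.* s) * x ^ (3 ℕ.* s)
        ≡⟨ cong₂ _*_ (sym (^-assocʳ c 3 s)) (trans (cong (x ^_) (ℕ.*-comm 3 s)) (sym (^-assocʳ x s 3))) ⟩
      (c ^ 3) ^ s * (x ^ s) ^ 3
        ≤⟨ *-mono (^-nonNeg s (^-nonNeg 3 0≤c)) (^-nonNeg 3 (^-nonNeg s 0≤x)) (^-mono s (^-nonNeg 3 0≤c) c≤) (^-mono 3 (^-nonNeg s 0≤x) xˢ≤z²) ⟩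
      (A ^ 2) ^ s * (z ^ 2) ^ 3
        ≡⟨ cong ((A ^ 2) ^ s *_) (trans (^-assocʳ z 2 3) (trans (sym (^-assocʳ z 3 2)) (cong (_^ 2) (^-distrib-* ζ δ 3)))) ⟩
      (A ^ 2) ^ s * (ζ ^ 3 * δ ^ 3) ^ 2
        ≤⟨ *-monoˡ ((A ^ 2) ^ s) (^-nonNeg s (^-nonNeg 2 0≤A)) (^-mono 2 (0≤* 0≤ζ³ 0≤δ³) (*-mono 0≤ζ³ 0≤δ³ ζ≤ δ≤)) ⟩
      (A ^ 2) ^ s * (Z ^ s * W ^ s) ^ 2
        ≡⟨ cong₂ _*_ (^-assocʳ A 2 s) (trans (cong (_^ 2) (sym (^-distrib-* Z W s))) (trans (^-assocʳ (Z * W) s 2) (cong ((Z * W) ^_) (ℕ.*-comm s 2)))) ⟩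
      A ^ (2 ℕ.* s) * (Z * W) ^ (2 ℕ.* s)
        ≡⟨ ^-distrib-* A (Z * W) (2 ℕ.* s) ⟨
      (A * (Z * W)) ^ (2 ℕ.* s)
        ≡⟨ cong (_^ (2 ℕ.* s)) (ℚ.*-assoc A Z W) ⟨
      (A * Z * W) ^ (2 ℕ.* s)
        ≤⟨ ^-mono (2 ℕ.* s) (0≤* (0≤* 0≤A 0≤Z) 0≤W) P≤ ⟩
      (τ ^ 9) ^ (2 ℕ.* s)
        ≡⟨ trans (^-assocʳ τ 9 (2 ℕ.* s)) (trans (cong (τ ^_) (exponents s)) (sym (^-assocʳ τ 6 (3 ℕ.* s)))) ⟩
      (τ ^ 6) ^ (3 ℕ.* s) ∎
    where
    open ℚ.≤-Reasoning
    z = ζ * δ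
    0≤ζ³ = ^-nonNeg 3 0≤ζ
    0≤δ³ = ^-nonNeg 3 0≤δ

  -- The double counting gives a deficit linear in z = ζ δ. Smallness of δ turns it into the power
  -- 2/s: (R^t z)^s = (R^s z)^t z², and the first factor is at most 1.
  deficit-≤ : ∀ t {c R ζ δ A Z W τ} → let s = 2 ℕ.+ t in
    0ℚ ≤ c → 0ℚ ≤ R → 0ℚ ≤ ζ → 0ℚ ≤ δ → 0ℚ ≤ A → 0ℚ ≤ Z → 0ℚ ≤ W → 0ℚ ≤ τ → R ^ s * (ζ * δ) ≤ 1ℚ →
    c ^ 3 ≤ A ^ 2 → ζ ^ 3 ≤ Z ^ s → δ ^ 3 ≤ W ^ s → A * Z * W ≤ τ ^ 9 → c * (R ^ t * (ζ * δ)) ≤ τ ^ 6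
  deficit-≤ t {c} {R} {ζ} {δ} {A} {Z} {W} {τ} 0≤c 0≤R 0≤ζ 0≤δ 0≤A 0≤Z 0≤W 0≤τ Rˢz≤1 c≤ ζ≤ δ≤ P≤ =
    ^-cancel-≤ (suc t ℕ.+ 2 ℕ.* (2 ℕ.+ t)) (^-nonNeg 6 0≤τ)
      (deficit-power (2 ℕ.+ t) {c} {x} {ζ} {δ} {A} {Z} {W} {τ} 0≤c 0≤x 0≤ζ 0≤δ 0≤A 0≤Z 0≤W (xˢ≤z² (2 ℕ.+ t) refl Rˢz≤1) c≤ ζ≤ δ≤ P≤)
    where
    open ℚ.≤-Reasoning
    z = ζ * δ
    x = R ^ t * z
    0≤z : 0ℚ ≤ z
    0≤z = 0≤* 0≤ζ 0≤δ
    0≤x : 0ℚ ≤ x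
    0≤x = 0≤* (^-nonNeg t 0≤R) 0≤z
    xˢ≤z² : ∀ s → 2 ℕ.+ t ≡ s → R ^ s * z ≤ 1ℚ → x ^ s ≤ z ^ 2
    xˢ≤z² s eq Rˢz≤1 = begin
      (R ^ t * z) ^ s
        ≡⟨ trans (^-distrib-* (R ^ t) z s) (cong₂ _*_ (trans (^-assocʳ R t s) (trans (cong (R ^_) (ℕ.*-comm t s)) (sym (^-assocʳ R s t)))) (trans (cong (z ^_) (sym eq)) (^-homo-* z 2 t))) ⟩
      (R ^ s) ^ t * (z ^ 2 * z ^ t)
        ≡⟨ trans (solve 3 (λ a b c → a :* (b :* c) := (a :* c) :* b) refl ((R ^ s) ^ t) (z ^ 2) (z ^ t)) (cong (_* z ^ 2) (sym (^-distrib-* (R ^ s) z t))) ⟩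
      (R ^ s * z) ^ t * z ^ 2
        ≤⟨ *-monoʳ (z ^ 2) (^-nonNeg 2 0≤z) (^≤1 t (0≤* (^-nonNeg s 0≤R) 0≤z) Rˢz≤1) ⟩
      1ℚ * z ^ 2
        ≡⟨ ℚ.*-identityˡ (z ^ 2) ⟩
      z ^ 2 ∎

  -- Equivalence of reals as termwise closeness, preserved by products and roots.

  Close : ℝ → ℝ → Set
  Close x y = ∀ ε → 0ℚ < ε → ∃[ N ] (∀ n → N ℕ.≤ n → ∣ seq x n - seq y n ∣ ≤ ε)

  ≈⇒Close : ∀ {x y} → x ≈ᴿ y → Close x y
  ≈⇒Close (x≤y , y≤x) ε 0<ε =
    let N , h = x≤y ε 0<ε
        M , k = y≤x ε 0<ε
    in N ℕ.⊔ M , λ n p → close⁺ (h n (ℕ.m⊔n≤o⇒m≤o N M p)) (k n (ℕ.m⊔n≤o⇒n≤o N M p))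

  Close⇒≤ : ∀ {x y} → Close x y → x ≤ᴿ y
  Close⇒≤ c ε 0<ε = let N , h = c ε 0<ε in N , λ n p → close⁻ (h n p)

  Close-sym : ∀ {x y} → Close x y → Close y x
  Close-sym {x} {y} c ε 0<ε = let N , h = c ε 0<ε in N , λ n p → subst (_≤ ε) (dist-comm (seq x n) (seq y n)) (h n p)

  Close⇒≈ : ∀ {x y} → Close x y → x ≈ᴿ y
  Close⇒≈ {x} {y} c = Close⇒≤ {x} {y} c , Close⇒≤ {y} {x} (Close-sym {x} {y} c)

  Close-refl : ∀ x → Close x x
  Close-refl x ε 0<ε = 0 , λ n _ → subst (_≤ ε) (sym (cong ∣_∣ (ℚ.+-inverseʳ (seq x n)))) (ℚ.<⇒≤ 0<ε)

  *ᴿ-Close : ∀ {x x′ y y′} → Close x x′ → Close y y′ → Close (x *ᴿ y) (x′ *ᴿ y′)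
  *ᴿ-Close {x} {x′} {y} {y′} cx cy ε 0<ε = combine (bounded x) (bounded y′)
    where
    combine : (∃[ K ] 1ℚ ≤ K × Bound x K) → (∃[ K ] 1ℚ ≤ K × Bound y′ K) →
              ∃[ N ] (∀ n → N ℕ.≤ n → ∣ seq x n * seq y n - seq x′ n * seq y′ n ∣ ≤ ε)
    combine (K , 1≤K , Nx , bx) (L , 1≤L , Ny , by) =
      let η , 0<η , Kη = shrink (K + L) ε (ℚ.<-≤-trans 0<1 (ℚ.≤-trans 1≤K (p≤p+q (1≤⇒0≤ 1≤L)))) 0<ε
          M , hx = cx η 0<η
          M′ , hy = cy η 0<η
      in (Nx ℕ.⊔ Ny) ℕ.⊔ (M ℕ.⊔ M′) , λ n p →
        let p₁ = ℕ.m⊔n≤o⇒m≤o (Nx ℕ.⊔ Ny) (M ℕ.⊔ M′) p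
            p₂ = ℕ.m⊔n≤o⇒n≤o (Nx ℕ.⊔ Ny) (M ℕ.⊔ M′) p
        in product-close {seq x n} {seq y n} {seq x′ n} {seq y′ n} (0≤+ (1≤⇒0≤ 1≤K) (1≤⇒0≤ 1≤L)) (ℚ.<⇒≤ 0<η) Kη
             (ℚ.≤-trans (bx n (ℕ.m⊔n≤o⇒m≤o Nx Ny p₁)) (p≤p+q (1≤⇒0≤ 1≤L)))
             (ℚ.≤-trans (by n (ℕ.m⊔n≤o⇒n≤o Nx Ny p₁)) (q≤p+q (1≤⇒0≤ 1≤K)))
             (hx n (ℕ.m⊔n≤o⇒m≤o M M′ p₂)) (hy n (ℕ.m⊔n≤o⇒n≤o M M′ p₂))

  ^ᴿ-Close : ∀ {x y} k → Close x y → Close (x ^ᴿ k) (y ^ᴿ k)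
  ^ᴿ-Close zero    c = Close-refl 1ᴿ
  ^ᴿ-Close {x} {y} (suc k) c = *ᴿ-Close {x} {y} {x ^ᴿ k} {y ^ᴿ k} c (^ᴿ-Close k c)

  root-Close : ∀ {x y} k → Close x y → Close (root k x) (root k y)
  root-Close {x} {y} k c ε 0<ε = modulus (½ * ε) (half-pos 0<ε) (halves ε)
    where
    modulus : ∀ e → 0ℚ < e → e + e ≡ ε → ∃[ N ] (∀ n → N ℕ.≤ n → ∣ seq (root k x) n - seq (root k y) n ∣ ≤ ε)
    modulus e 0<e e+e≡ε =
      let N , h = c (e ^ suc k) (^-pos (suc k) 0<e)
      in N ℕ.⊔ ℚ.↧ₙ e , λ n p →
        let close = h n (ℕ.m⊔n≤o⇒m≤o N (ℚ.↧ₙ e) p)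
            u≤e = unit≤ e 0<e n (ℕ.m⊔n≤o⇒n≤o N (ℚ.↧ₙ e) p)
        in close⁺
          (subst (λ z → rootApprox (suc k) (seq x n) n ≤ rootApprox (suc k) (seq y n) n + z) e+e≡ε
            (rootApprox-close k (seq x n) (seq y n) n n e 0<e (close⁻ close) u≤e))
          (subst (λ z → rootApprox (suc k) (seq y n) n ≤ rootApprox (suc k) (seq x n) n + z) e+e≡ε
            (rootApprox-close k (seq y n) (seq x n) n n e 0<e
              (close⁻ (subst (_≤ e ^ suc k) (dist-comm (seq x n) (seq y n)) close)) u≤e))

  -- Inequalities between the rational terms.

  seq-^ᴿ : ∀ x k m → seq (x ^ᴿ k) m ≡ seq x m ^ k
  seq-^ᴿ x zero    m = refl
  seq-^ᴿ x (suc k) m = cong (seq x m *_) (seq-^ᴿ x k m)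

  inverse : ∀ x → 0ℚ < x → ∃[ i ] 0ℚ < i × x * i ≡ 1ℚ
  inverse x 0<x = ℚ.1/ x , ℚ.positive⁻¹ (ℚ.1/ x) {{ℚ.1/pos⇒pos x}} , ℚ.*-inverseʳ x
    where
    instance
      x-pos : ℚ.Positive x
      x-pos = ℚ.positive 0<x
      x-nonZero : ℚ.NonZero x
      x-nonZero = ℚ.pos⇒nonZero x

  ⊓-pos : ∀ {x y} → 0ℚ < x → 0ℚ < y → 0ℚ < x ⊓ y
  ⊓-pos {x} {y} 0<x 0<y with ℚ.⊓-sel x y
  ... | inj₁ e = subst (0ℚ <_) (sym e) 0<x
  ... | inj₂ e = subst (0ℚ <_) (sym e) 0<y

  -- Each of the seven other terms of the expansion contains a factor e, and its remaining factors
  -- have product at most B.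
  product-bump : ∀ {A Z W B e} → 0ℚ ≤ A → 0ℚ ≤ Z → 0ℚ ≤ W → 0ℚ ≤ e → A ≤ B → Z ≤ 1ℚ → W ≤ 1ℚ → 1ℚ ≤ B → e ≤ 1ℚ →
                 (A + e) * (Z + e) * (W + e) ≤ A * Z * W + # 7 * B * e
  product-bump {A} {Z} {W} {B} {e} 0≤A 0≤Z 0≤W 0≤e A≤B Z≤1 W≤1 1≤B e≤1 = ≤-by
    (e * (# 4 * (B - 1ℚ) + # 3 * (B - A) + (# 4 - (Z + e) * (W + e)) + A * (2ℚ - (W + e)) + A * (1ℚ - Z)))
    (0≤* 0≤e (0≤+ (0≤+ (0≤+ (0≤+ (0≤* (0≤# 4) (0≤- 1≤B)) (0≤* (0≤# 3) (0≤- A≤B)))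
      (0≤- (*-mono (0≤+ 0≤Z 0≤e) (0≤+ 0≤W 0≤e) (ℚ.+-mono-≤ Z≤1 e≤1) (ℚ.+-mono-≤ W≤1 e≤1))))
      (0≤* 0≤A (0≤- (ℚ.+-mono-≤ W≤1 e≤1)))) (0≤* 0≤A (0≤- Z≤1))))
    (solve 5 (λ A Z W B e → A :* Z :* W :+ con (# 7) :* B :* e := (A :+ e) :* (Z :+ e) :* (W :+ e) :+
      e :* (con (# 4) :* (B :- con 1ℚ) :+ con (# 3) :* (B :- A) :+ (con (# 4) :- (Z :+ e) :* (W :+ e)) :+ A :* (con 2ℚ :- (W :+ e)) :+ A :* (con 1ℚ :- Z))) refl A Z W B e)

  -- With ρ = N / R, division of the clique bound by N^t and by Y = C(r,s) leaves c ρ² ≤ k₂ + c R^t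
  -- ζ δ N². The relation 2 c + R = R² identifies c ρ² with half of (1 - 1/R) N².
  edge-deficit : ∀ t {R c Y ζ ρ N k k₂ δ τ⁶} → let s = 2 ℕ.+ t in
    0ℚ < R → 0ℚ < N → 0ℚ ≤ c → 0ℚ ≤ ζ → R * ρ ≡ N → Y * ζ ≡ 1ℚ → 2ℚ * c + R ≡ R * R →
    c * (R ^ t * k) ≤ Y * (N ^ t * k₂) → Y * ρ ^ s ≤ k + δ * N ^ s → c * (R ^ t * (ζ * δ)) ≤ τ⁶ →
    R * (N * N) ≤ N * N + R * (2ℚ * k₂) + 2ℚ * (R * (τ⁶ * (N * N)))
  edge-deficit t {R} {c} {Y} {ζ} {ρ} {N} {k} {k₂} {δ} {τ⁶} 0<R 0<N 0≤c 0≤ζ Rρ≡N Cζ≡1 2c≡ cliques many small =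
    subst (λ N → R * (N * N) ≤ N * N + R * (2ℚ * k₂) + 2ℚ * (R * (τ⁶ * (N * N)))) Rρ≡N
      (*-cancel R 0<R (≤-by _ (0≤* (0≤* (0≤# 2) (0≤* 0≤R 0≤R)) (0≤- per-pair)) (trans
        (solve 4 (λ R ρ k₂ τ⁶ → R :* (R :* ρ :* (R :* ρ) :+ R :* (con 2ℚ :* k₂) :+ con 2ℚ :* (R :* (τ⁶ :* (R :* ρ :* (R :* ρ)))))
          := R :* (R :* ρ :* (R :* ρ)) :+ con 2ℚ :* (R :* R) :* (k₂ :+ τ⁶ :* (R :* ρ :* (R :* ρ)))) refl R ρ k₂ τ⁶)
        (trans (solve 5 (λ R ρ c k₂ τ⁶ → R :* (R :* ρ :* (R :* ρ)) :+ con 2ℚ :* (R :* R) :* (k₂ :+ τ⁶ :* (R :* ρ :* (R :* ρ)))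
          := (con 2ℚ :* c :+ R) :* (R :* ρ :* (R :* ρ)) :+ con 2ℚ :* (R :* R) :* (k₂ :+ τ⁶ :* (R :* ρ :* (R :* ρ)) :- c :* (ρ :* ρ))) refl R ρ c k₂ τ⁶)
        (trans (cong (λ z → z * (R * ρ * (R * ρ)) + 2ℚ * (R * R) * (k₂ + τ⁶ * (R * ρ * (R * ρ)) - c * (ρ * ρ))) 2c≡)
          (cong (_+ 2ℚ * (R * R) * (k₂ + τ⁶ * (R * ρ * (R * ρ)) - c * (ρ * ρ))) (ℚ.*-assoc R R (R * ρ * (R * ρ)))))))))
    where
    open ℚ.≤-Reasoning
    0≤R = ℚ.<⇒≤ 0<R
    scaled : N ^ t * (c * Y * (ρ * ρ)) ≤ N ^ t * (Y * k₂ + c * (R ^ t * δ) * (N * N))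
    scaled = begin
      N ^ t * (c * Y * (ρ * ρ))
        ≡⟨ cong (_* (c * Y * (ρ * ρ))) (trans (cong (_^ t) (sym Rρ≡N)) (^-distrib-* R ρ t)) ⟩
      R ^ t * ρ ^ t * (c * Y * (ρ * ρ))
        ≡⟨ solve 5 (λ x y c Y ρ → x :* y :* (c :* Y :* (ρ :* ρ)) := c :* x :* (Y :* (ρ :* (ρ :* y)))) refl (R ^ t) (ρ ^ t) c Y ρ ⟩
      c * R ^ t * (Y * (ρ * (ρ * ρ ^ t)))
        ≤⟨ *-monoˡ (c * R ^ t) (0≤* 0≤c (^-nonNeg t 0≤R)) many ⟩
      c * R ^ t * (k + δ * (N * (N * N ^ t)))
        ≡⟨ solve 6 (λ c x k δ N y → c :* x :* (k :+ δ :* (N :* (N :* y))) := c :* (x :* k) :+ y :* (c :* (x :* δ) :* (N :* N))) refl c (R ^ t) k δ N (N ^ t) ⟩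
      c * (R ^ t * k) + N ^ t * (c * (R ^ t * δ) * (N * N))
        ≤⟨ ℚ.+-monoˡ-≤ _ cliques ⟩
      Y * (N ^ t * k₂) + N ^ t * (c * (R ^ t * δ) * (N * N))
        ≡⟨ solve 4 (λ Y y k₂ z → Y :* (y :* k₂) :+ y :* z := y :* (Y :* k₂ :+ z)) refl Y (N ^ t) k₂ (c * (R ^ t * δ) * (N * N)) ⟩
      N ^ t * (Y * k₂ + c * (R ^ t * δ) * (N * N)) ∎
    per-pair : c * (ρ * ρ) ≤ k₂ + τ⁶ * (R * ρ * (R * ρ))
    per-pair = begin
      c * (ρ * ρ)
        ≡⟨ ℚ.*-identityˡ (c * (ρ * ρ)) ⟨
      1ℚ * (c * (ρ * ρ))
        ≡⟨ cong (_* (c * (ρ * ρ))) Cζ≡1 ⟨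
      Y * ζ * (c * (ρ * ρ))
        ≡⟨ solve 4 (λ Y ζ c ρ → Y :* ζ :* (c :* (ρ :* ρ)) := ζ :* (c :* Y :* (ρ :* ρ))) refl Y ζ c ρ ⟩
      ζ * (c * Y * (ρ * ρ))
        ≤⟨ *-monoˡ ζ 0≤ζ (*-cancel (N ^ t) (^-pos t 0<N) scaled) ⟩
      ζ * (Y * k₂ + c * (R ^ t * δ) * (N * N))
        ≡⟨ solve 7 (λ Y ζ c x δ N k₂ → ζ :* (Y :* k₂ :+ c :* (x :* δ) :* (N :* N)) := Y :* ζ :* k₂ :+ c :* (x :* (ζ :* δ)) :* (N :* N)) refl Y ζ c (R ^ t) δ N k₂ ⟩
      Y * ζ * k₂ + c * (R ^ t * (ζ * δ)) * (N * N)
        ≤⟨ ℚ.+-monoʳ-≤ (Y * ζ * k₂) (*-monoʳ (N * N) (0≤* (ℚ.<⇒≤ 0<N) (ℚ.<⇒≤ 0<N)) small) ⟩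
      Y * ζ * k₂ + τ⁶ * (N * N)
        ≡⟨ cong₂ (λ a b → a * k₂ + τ⁶ * (b * b)) Cζ≡1 (sym Rρ≡N) ⟩
      1ℚ * k₂ + τ⁶ * (R * ρ * (R * ρ))
        ≡⟨ cong (_+ τ⁶ * (R * ρ * (R * ρ))) (ℚ.*-identityˡ k₂) ⟩
      k₂ + τ⁶ * (R * ρ * (R * ρ)) ∎

  -- The hypothesis on D is the bound at τ = G + 2ν and σ = S + u.
  perturbed-bound : ∀ {R K Q S G P u ν M D} → 0ℚ ≤ R → 0ℚ ≤ K → 0ℚ ≤ S → 0ℚ ≤ G → 0ℚ ≤ ν → 0ℚ ≤ M →
    3ℚ * Q ≡ 2ℚ * R → S ≤ 1ℚ → u ≤ ν → G + 2ℚ * ν ≤ 1ℚ → G ^ 9 ≤ P →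
    3ℚ * D ≤ (2ℚ * R * (S + u) + 3ℚ * (K * (G + 2ℚ * ν))) * (G + 2ℚ * ν) ^ 9 * M →
    D ≤ (Q * S + K * G) * P * M + # 20 * (R + K) * M * ν
  perturbed-bound {R} {K} {Q} {S} {G} {P} {u} {ν} {M} {D} 0≤R 0≤K 0≤S 0≤G 0≤ν 0≤M 3Q≡2R S≤1 u≤ν τ≤1 G⁹≤P h =
    *-cancel 3ℚ (ℚ.<-≤-trans 0<1 (1≤# 3)) (begin
      3ℚ * D
        ≤⟨ h ⟩
      (2ℚ * R * (S + u) + 3ℚ * (K * (G + 2ℚ * ν))) * x * M
        -- Replacing x by P + 18 ν costs at most (36 R + 54 K) ν M; u and 2 ν in the first factor
        -- cost at most (2 R + 6 K) ν M. The coefficient 60 (R + K) covers both, and division by 3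
        -- gives 20.
        ≤⟨ ≤-by ((2ℚ * R * S + 3ℚ * (K * G)) * (P + # 18 * ν - x) * M + 2ℚ * R * (ν - u) * x * M + (2ℚ * R + # 6 * K) * ν * (1ℚ - x) * M
                 + M * ν * (# 36 * (R * (1ℚ - S)) + # 54 * (K * (1ℚ - G)) + # 22 * R))
            (0≤+ (0≤+ (0≤+ (0≤* (0≤* (0≤+ (0≤* (0≤* (0≤# 2) 0≤R) 0≤S) (0≤* (0≤# 3) (0≤* 0≤K 0≤G))) (0≤- x≤)) 0≤M)
              (0≤* (0≤* (0≤* (0≤* (0≤# 2) 0≤R) (0≤- u≤ν)) 0≤x) 0≤M)) (0≤* (0≤* (0≤* (0≤+ (0≤* (0≤# 2) 0≤R) (0≤* (0≤# 6) 0≤K)) 0≤ν) (0≤- x≤1)) 0≤M))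
              (0≤* (0≤* 0≤M 0≤ν) (0≤+ (0≤+ (0≤* (0≤# 36) (0≤* 0≤R (0≤- S≤1))) (0≤* (0≤# 54) (0≤* 0≤K (0≤- G≤1)))) (0≤* (0≤# 22) 0≤R))))
            (solve 9 (λ R K S G P u ν M x → (con 2ℚ :* R :* S :+ con 3ℚ :* (K :* G)) :* P :* M :+ con (# 60) :* (R :+ K) :* M :* ν :=
              (con 2ℚ :* R :* (S :+ u) :+ con 3ℚ :* (K :* (G :+ con 2ℚ :* ν))) :* x :* M :+
              ((con 2ℚ :* R :* S :+ con 3ℚ :* (K :* G)) :* (P :+ con (# 18) :* ν :- x) :* M :+ con 2ℚ :* R :* (ν :- u) :* x :* M :+ (con 2ℚ :* R :+ con (# 6) :* K) :* ν :* (con 1ℚ :- x) :* M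
                 :+ M :* ν :* (con (# 36) :* (R :* (con 1ℚ :- S)) :+ con (# 54) :* (K :* (con 1ℚ :- G)) :+ con (# 22) :* R))) refl R K S G P u ν M x) ⟩
      (2ℚ * R * S + 3ℚ * (K * G)) * P * M + # 60 * (R + K) * M * ν
        ≡⟨ cong (λ z → (z * S + 3ℚ * (K * G)) * P * M + # 60 * (R + K) * M * ν) (sym 3Q≡2R) ⟩
      (3ℚ * Q * S + 3ℚ * (K * G)) * P * M + # 60 * (R + K) * M * ν
        ≡⟨ solve 8 (λ Q S K G P M R ν → (con 3ℚ :* Q :* S :+ con 3ℚ :* (K :* G)) :* P :* M :+ con (# 60) :* (R :+ K) :* M :* ν :=
             con 3ℚ :* ((Q :* S :+ K :* G) :* P :* M :+ con (# 20) :* (R :+ K) :* M :* ν)) refl Q S K G P M R ν ⟩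
      3ℚ * ((Q * S + K * G) * P * M + # 20 * (R + K) * M * ν) ∎)
    where
    open ℚ.≤-Reasoning
    x = (G + 2ℚ * ν) ^ 9
    0≤2ν : 0ℚ ≤ 2ℚ * ν
    0≤2ν = 0≤* (0≤# 2) 0≤ν
    0≤x : 0ℚ ≤ x
    0≤x = ^-nonNeg 9 (0≤+ 0≤G 0≤2ν)
    x≤1 : x ≤ 1ℚ
    x≤1 = ^≤1 9 (0≤+ 0≤G 0≤2ν) τ≤1
    G≤1 : G ≤ 1ℚ
    G≤1 = ℚ.≤-trans (p≤p+q 0≤2ν) τ≤1
    x≤ : x ≤ P + # 18 * ν
    x≤ = ℚ.≤-trans (^-perturb 9 0≤G 0≤2ν τ≤1) (ℚ.+-mono-≤ G⁹≤P (ℚ.≤-reflexive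
      (trans (cong (_* (2ℚ * ν)) (↑≡# 9)) (solve 1 (λ ν → con (# 9) :* (con 2ℚ :* ν) := con (# 18) :* ν) refl ν))))

  ↑^ : ∀ a k → ↑ (a ℕ.^ k) ≡ ↑ a ^ k
  ↑^ a zero    = ↑≡# 1
  ↑^ a (suc k) = ↑* {a} refl (↑^ a k)

  2C+r≡r² : ∀ r → 2 ℕ.* (r C 2) ℕ.+ r ≡ r ℕ.* r
  2C+r≡r² r = trans (cong (2 ℕ.* (r C 2) ℕ.+_) (sym (trans (ℕ.*-identityˡ (r C 1)) (nC1≡n r))))
    (trans (absorption r 1) (cong (r ℕ.*_) (nC1≡n r)))

  -- The bound at one index of the Cauchy sequences.

  module Bound {n r : ℕ} (t : ℕ) (s≤r : 2 ℕ.+ t ℕ.≤ 2 ℕ.+ r) (G : Graph (suc n)) (free : CliqueFree G (3 ℕ.+ r)) where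

    s : ℕ
    s = 2 ℕ.+ t

    R N c C′ k k₂ : ℚ
    R = ↑ (2 ℕ.+ r)
    N = ↑ (suc n)
    c = ↑ ((2 ℕ.+ r) C 2)
    C′ = ↑ ((2 ℕ.+ r) C s)
    k = ↑ cliqueCount G s
    k₂ = ↑ cliqueCount G 2

    0<N : 0ℚ < N
    0<N = ℚ.<-≤-trans 0<1 (1≤↑ (suc n))
    0<R : 0ℚ < R
    0<R = ℚ.<-≤-trans 0<1 (1≤↑ (2 ℕ.+ r))
    0≤R = ℚ.<⇒≤ 0<R
    0≤N = ℚ.<⇒≤ 0<N

    2c+R≡R² : 2ℚ * c + R ≡ R * R
    2c+R≡R² = trans (sym (↑+ {2 ℕ.* ((2 ℕ.+ r) C 2)} (↑* {2} (↑≡# 2) refl) refl))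
      (trans (cong ↑_ (2C+r≡r² (2 ℕ.+ r))) (↑* {2 ℕ.+ r} refl refl))

    cliques : c * (R ^ t * k) ≤ C′ * (N ^ t * k₂)
    cliques = subst₂ _≤_ (↑* {(2 ℕ.+ r) C 2} refl (↑* {(2 ℕ.+ r) ℕ.^ t} (↑^ (2 ℕ.+ r) t) refl))
      (↑* {(2 ℕ.+ r) C s} refl (↑* {suc n ℕ.^ t} (↑^ (suc n) t) refl))
      (↑-mono (Adjacency.cliques≤edges G (2 ℕ.+ r) free t s≤r))

    0≤errorRate : 0ℚ ≤ errorRate R
    0≤errorRate = 0≤+ (0≤# 8) (0≤* 0≤R (0≤+ (0≤* (0≤# 2) 0≤κ) (0≤* 0≤κ 0≤κ)))
      where
      0≤κ : 0ℚ ≤ curvature R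
      0≤κ = 0≤* (0≤# 112) (0≤* 0≤R 0≤R)

    module _ {ζ ρ Q A Z W Γ S u δ ε ν ω B : ℚ}
      (0≤ζ : 0ℚ ≤ ζ) (Cζ≡1 : C′ * ζ ≡ 1ℚ) (Rρ≡N : R * ρ ≡ N) (3Q≡2R : 3ℚ * Q ≡ 2ℚ * R)
      (0≤A : 0ℚ ≤ A) (0≤Z : 0ℚ ≤ Z) (0≤W : 0ℚ ≤ W) (0≤Γ : 0ℚ ≤ Γ) (0≤S : 0ℚ ≤ S) (0≤u : 0ℚ ≤ u) (0≤δ : 0ℚ ≤ δ) (0≤ε : 0ℚ ≤ ε) (0<ν : 0ℚ < ν)
      (A-lower : c ^ 3 ≤ (A + u) ^ 2) (Z-lower : ζ ^ 3 ≤ (Z + u) ^ s) (W-lower : δ ^ 3 ≤ (W + u) ^ s)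
      (Γ-lower : A * Z * W ≤ (Γ + u) ^ 9) (Γ-upper : Γ ^ 9 ≤ A * Z * W)
      (S-lower : 1ℚ ≤ 3ℚ * ((S + u) * (S + u))) (S+u≤1 : S + u ≤ 1ℚ)
      (A≤B : A ≤ B) (Z≤1 : Z ≤ 1ℚ) (W≤1 : W ≤ 1ℚ) (1≤B : 1ℚ ≤ B)
      (u≤ω : u ≤ ω) (ω≤ν : ω ≤ ν) (2ω≤1 : 2ℚ * ω ≤ 1ℚ) (ω-small : # 7 * B * (2ℚ * ω) ≤ ν ^ 9)
      (ε-small : 3ℚ * ε ≤ ω ^ s) (δ+ε≤1 : δ + ε ≤ 1ℚ) (δ-small : R ^ s * (ζ * (δ + ε)) ≤ 1ℚ)
      (τ-small : # 10 * (R * (Γ + 2ℚ * ν)) ≤ 1ℚ)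
      (many : C′ * ρ ^ s ≤ k + (δ + ε) * N ^ s) where

      private
        τ e : ℚ
        -- One ν covers the rounding u of the ninth root, the other the rounding of the three
        -- factors under it.
        τ = Γ + 2ℚ * ν
        -- One ω covers the rounding u, the other the shift of δ by ε.
        e = 2ℚ * ω

        0≤ν = ℚ.<⇒≤ 0<ν
        0≤ω : 0ℚ ≤ ω
        0≤ω = ℚ.≤-trans 0≤u u≤ω
        0≤e : 0ℚ ≤ e
        0≤e = 0≤* (0≤# 2) 0≤ω

        0<τ : 0ℚ < τ
        0<τ = ℚ.<-≤-trans (pos*pos (ℚ.<-≤-trans 0<1 (1≤# 2)) 0<ν) (q≤p+q 0≤Γ)

        module E′ = Estimates R N τ (1≤↑ (2 ℕ.+ r)) 0<N 0<τ τ-small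

        u≤e : u ≤ e
        u≤e = ℚ.≤-trans u≤ω (≤-by ω 0≤ω (solve 1 (λ ω → con 2ℚ :* ω := ω :+ ω) refl ω))

        bump : ∀ {x} → x + u ≤ x + e
        bump {x} = ℚ.+-monoʳ-≤ x u≤e

        W-lower′ : (δ + ε) ^ 3 ≤ (W + e) ^ s
        W-lower′ = begin
          (δ + ε) ^ 3                    ≤⟨ ^-perturb 3 0≤δ 0≤ε δ+ε≤1 ⟩
          δ ^ 3 + ↑ 3 * ε                ≡⟨ cong (λ z → δ ^ 3 + z * ε) (↑≡# 3) ⟩
          δ ^ 3 + 3ℚ * ε                 ≤⟨ ℚ.+-mono-≤ W-lower ε-small ⟩
          (W + u) ^ s + ω ^ s            ≤⟨ ^-superadd (suc t) (0≤+ 0≤W 0≤u) 0≤ω ⟩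
          (W + u + ω) ^ s                ≤⟨ ^-mono s (0≤+ (0≤+ 0≤W 0≤u) 0≤ω) (≤-by (ω - u) (0≤- u≤ω) (solve 3 (λ W u ω → W :+ con 2ℚ :* ω := W :+ u :+ ω :+ (ω :- u)) refl W u ω)) ⟩
          (W + e) ^ s                    ∎
          where open ℚ.≤-Reasoning

        product≤τ⁹ : (A + e) * (Z + e) * (W + e) ≤ τ ^ 9
        product≤τ⁹ = begin
          (A + e) * (Z + e) * (W + e)    ≤⟨ product-bump 0≤A 0≤Z 0≤W 0≤e A≤B Z≤1 W≤1 1≤B 2ω≤1 ⟩
          A * Z * W + # 7 * B * e        ≤⟨ ℚ.+-mono-≤ Γ-lower ω-small ⟩
          (Γ + u) ^ 9 + ν ^ 9            ≤⟨ ^-superadd 8 (0≤+ 0≤Γ 0≤u) 0≤ν ⟩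
          (Γ + u + ν) ^ 9                ≤⟨ ^-mono 9 (0≤+ (0≤+ 0≤Γ 0≤u) 0≤ν) (≤-by (ν - u) (0≤- (ℚ.≤-trans u≤ω ω≤ν)) (solve 3 (λ G u ν → G :+ con 2ℚ :* ν := G :+ u :+ ν :+ (ν :- u)) refl Γ u ν)) ⟩
          τ ^ 9                          ∎
          where open ℚ.≤-Reasoning

        small-deficit : c * (R ^ t * (ζ * (δ + ε))) ≤ τ ^ 6
        small-deficit = deficit-≤ t {c} {R} {ζ} {δ + ε} {A + e} {Z + e} {W + e} {τ}
          (0≤↑ ((2 ℕ.+ r) C 2)) 0≤R 0≤ζ (0≤+ 0≤δ 0≤ε) (0≤+ 0≤A 0≤e) (0≤+ 0≤Z 0≤e) (0≤+ 0≤W 0≤e) (ℚ.<⇒≤ 0<τ) δ-small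
          (ℚ.≤-trans A-lower (^-mono 2 (0≤+ 0≤A 0≤u) (bump {A})))
          (ℚ.≤-trans Z-lower (^-mono s (0≤+ 0≤Z 0≤u) (bump {Z}))) W-lower′ product≤τ⁹

        τ⁶ : τ ^ 6 ≡ τ * τ * τ * (τ * τ * τ)
        τ⁶ = solve 1 (λ τ → τ :* (τ :* (τ :* (τ :* (τ :* (τ :* con 1ℚ))))) := τ :* τ :* τ :* (τ :* τ :* τ)) refl τ

        τ⁹ : τ * τ * τ * (τ * τ * τ) * (τ * τ * τ) ≡ τ ^ 9
        τ⁹ = solve 1 (λ τ → τ :* τ :* τ :* (τ :* τ :* τ) :* (τ :* τ :* τ) := τ :* (τ :* (τ :* (τ :* (τ :* (τ :* (τ :* (τ :* (τ :* con 1ℚ))))))))) refl τ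

        edges≡ : 2ℚ * k₂ ≡ ↑ Optimum.E G free
        edges≡ = trans (sym (↑* {2} (↑≡# 2) refl)) (cong ↑_ (sym (Adjacency.∑∑-adj G)))

        deficit : R * (N * N) ≤ N * N + R * ↑ Optimum.E G free + 2ℚ * (R * E′.q)
        deficit = subst₂ (λ x y → R * (N * N) ≤ N * N + R * x + 2ℚ * (R * (y * (N * N)))) edges≡ τ⁶
          (edge-deficit t {R} {c} {C′} {ζ} {ρ} {N} {k} {k₂} {δ + ε} {τ ^ 6} 0<R 0<N (0≤↑ ((2 ℕ.+ r) C 2)) 0≤ζ Rρ≡N Cζ≡1 2c+R≡R² cliques many small-deficit)

        2ν+Γ≤1 : Γ + 2ℚ * ν ≤ 1ℚ
        2ν+Γ≤1 = E′.τ≤1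

      bound : ↑ D (2 ℕ.+ r) G ≤ (Q * S + errorRate R * Γ) * (A * Z * W) * (N * N) + # 20 * (R + errorRate R) * (N * N) * ν
      bound = perturbed-bound {R} {errorRate R} {Q} {S} {Γ} {A * Z * W} {u} {ν} {N * N} {↑ D (2 ℕ.+ r) G}
        0≤R 0≤errorRate 0≤S 0≤Γ 0≤ν (0≤* 0≤N 0≤N) 3Q≡2R (ℚ.≤-trans (p≤p+q 0≤u) S+u≤1) (ℚ.≤-trans u≤ω ω≤ν) 2ν+Γ≤1 Γ-upper
        (subst (λ x → 3ℚ * ↑ D (2 ℕ.+ r) G ≤ (2ℚ * R * (S + u) + 3ℚ * (errorRate R * τ)) * x * (N * N)) τ⁹
          (Stability.stability G free zero 0<N 0<τ τ-small deficit (0≤+ 0≤S 0≤u) S-lower S+u≤1))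

  -- Rational bounds on the terms of fractions and roots.

  frac-inverse : ∀ a b m → 0 ℕ.< b → ↑ b * seq (frac a b) m ≡ ↑ a
  frac-inverse a (suc b) m _ = trans (cong (_* (+ a / suc b)) (↑≡# (suc b))) (trans (ℚ.toℚᵘ-injective (begin
    ℚ.toℚᵘ (# (suc b) * (+ a / suc b))                 ≈⟨ ℚ.toℚᵘ-homo-* (# (suc b)) (+ a / suc b) ⟩
    ℚ.toℚᵘ (# (suc b)) ℚᵘ.* ℚ.toℚᵘ (+ a / suc b)       ≈⟨ ℚᵘ.*-cong (toℚᵘ-/ (suc b) 0) (toℚᵘ-/ a b) ⟩
    mkℚᵘ (+ suc b) 0 ℚᵘ.* mkℚᵘ (+ a) b                 ≈⟨ ℚᵘ.*≡* (trans (ℤ.*-identityʳ _) (trans (ℤ.*-comm (+ suc b) (+ a)) (cong (λ z → + a ℤ.* (+ suc z)) (sym (ℕ.+-identityʳ b))))) ⟩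
    mkℚᵘ (+ a) 0                                       ≈⟨ toℚᵘ-/ a 0 ⟨
    ℚ.toℚᵘ (# a)                                       ∎)) (sym (↑≡# a)))
    where open import Relation.Binary.Reasoning.Setoid ℚᵘ.≃-setoid

  frac-nonNeg : ∀ a b m → 0ℚ ≤ seq (frac a b) m
  frac-nonNeg a zero    m = ℚ.≤-refl
  frac-nonNeg a (suc b) m = 0≤/ a b

  -- With e a variable, these types match at concrete exponents without unfolding the roots.
  pow-nonNeg : ∀ x p e m → .{{ℕ.NonZero e}} → 0ℚ ≤ seq (x ^ᴿ[ p / e ]) m
  pow-nonNeg x p (suc q) m = rootApprox-nonNeg (suc q) (seq (x ^ᴿ p) m) m

  pow-upper : ∀ x p e m → .{{ℕ.NonZero e}} → seq x m ^ p ≤ (seq (x ^ᴿ[ p / e ]) m + unit m) ^ e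
  pow-upper x p (suc q) m = subst (_≤ (seq (x ^ᴿ[ p / suc q ]) m + unit m) ^ suc q) (seq-^ᴿ x p m)
    (ℚ.<⇒≤ (rootApprox-upper q (seq (x ^ᴿ p) m) m))

  pow-≤ : ∀ x p e m → .{{ℕ.NonZero e}} → ∀ {b} → 0ℚ ≤ b → seq x m ^ p ≤ b ^ e → seq (x ^ᴿ[ p / e ]) m ≤ b
  pow-≤ x p (suc q) m {b} 0≤b h = lower-≤ q (rootApprox-lower (suc q) (seq (x ^ᴿ p) m) m) 0≤b (subst (_≤ b ^ suc q) (sym (seq-^ᴿ x p m)) h)

  pow-upper-fromℕ : ∀ n p e m → .{{ℕ.NonZero e}} → ↑ n ^ p ≤ (seq (fromℕ n ^ᴿ[ p / e ]) m + unit m) ^ e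
  pow-upper-fromℕ n p e m = subst (λ z → z ^ p ≤ (seq (fromℕ n ^ᴿ[ p / e ]) m + unit m) ^ e) (sym (↑≡# n)) (pow-upper (fromℕ n) p e m)

  pow-≤-fromℕ : ∀ n p e m → .{{ℕ.NonZero e}} → ∀ {b} → 0ℚ ≤ b → ↑ n ^ p ≤ b ^ e → seq (fromℕ n ^ᴿ[ p / e ]) m ≤ b
  pow-≤-fromℕ n p e m {b} 0≤b h = pow-≤ (fromℕ n) p e m 0≤b (subst (λ z → z ^ p ≤ b ^ e) (↑≡# n) h)

  root-nonNeg : ∀ k x m → 0ℚ ≤ seq (root k x) m
  root-nonNeg k x m = rootApprox-nonNeg (suc k) (seq x m) m

  root-upper : ∀ k x m → seq x m ≤ (seq (root k x) m + unit m) ^ suc k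
  root-upper k x m = ℚ.<⇒≤ (rootApprox-upper k (seq x m) m)

  root-≤ : ∀ k x m {b} → 0ℚ ≤ b → seq x m ≤ b ^ suc k → seq (root k x) m ≤ b
  root-≤ k x m = lower-≤ k (rootApprox-lower (suc k) (seq x m) m)

  root-^-≤ : ∀ k x m → 0ℚ ≤ seq x m → seq (root k x) m ^ suc k ≤ seq x m
  root-^-≤ k x m = lower-^-≤ k (rootApprox-lower (suc k) (seq x m) m)

  module _ (A Z W : ℝ) (k m : ℕ) where

    root-product-upper : ∀ {e} → suc k ≡ e → seq A m * seq Z m * seq W m ≤ (seq (root k (A *ᴿ Z *ᴿ W)) m + unit m) ^ e
    root-product-upper refl = root-upper k (A *ᴿ Z *ᴿ W) m

    root-product-≤ : ∀ {e} → suc k ≡ e → ∀ {b} → 0ℚ ≤ b → seq A m * seq Z m * seq W m ≤ b ^ e → seq (root k (A *ᴿ Z *ᴿ W)) m ≤ b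
    root-product-≤ refl = root-≤ k (A *ᴿ Z *ᴿ W) m

    root-product-^-≤ : ∀ {e} → suc k ≡ e → 0ℚ ≤ seq A m * seq Z m * seq W m → seq (root k (A *ᴿ Z *ᴿ W)) m ^ e ≤ seq A m * seq Z m * seq W m
    root-product-^-≤ refl = root-^-≤ k (A *ᴿ Z *ᴿ W) m

  pow-Close : ∀ {x y} p e → .{{ℕ.NonZero e}} → Close x y → Close (x ^ᴿ[ p / e ]) (y ^ᴿ[ p / e ])
  pow-Close {x} {y} p (suc q) c = root-Close {x ^ᴿ p} {y ^ᴿ p} q (^ᴿ-Close {x} {y} p c)

  root-product-Close : ∀ {A W W′} k → Close W W′ → Close (root k (A *ᴿ W)) (root k (A *ᴿ W′))
  root-product-Close {A} {W} {W′} k c = root-Close {A *ᴿ W} {A *ᴿ W′} k (*ᴿ-Close {A} {A} {W} {W′} (Close-refl A) c)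

  0ᴿ<⇒nonNeg : ∀ {x} → 0ᴿ <ᴿ x → ∃[ N ] (∀ m → N ℕ.≤ m → 0ℚ ≤ seq x m)
  0ᴿ<⇒nonNeg (e , 0<e , N , h) = N , λ m p → ℚ.≤-trans (ℚ.≤-trans (ℚ.<⇒≤ 0<e) (ℚ.≤-reflexive (sym (ℚ.+-identityˡ e)))) (h m p)

  0ᴿ<fromℚ : ∀ {q} → 0ℚ < q → 0ᴿ <ᴿ fromℚ q
  0ᴿ<fromℚ {q} 0<q = q , 0<q , 0 , λ _ _ → ℚ.≤-reflexive (ℚ.+-identityˡ q)

  -- The relation `≤ᴿ` bounds terms only up to an additive error. Giving away half of q turns it
  -- into a bound on the terms themselves.
  ≤fromℚ-half : ∀ {x q} → 0ℚ < q → x ≤ᴿ fromℚ (½ * q) → ∃[ N ] (∀ m → N ℕ.≤ m → seq x m ≤ q)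
  ≤fromℚ-half {x} {q} 0<q h = let N , k = h (½ * q) (half-pos 0<q) in N , λ m p → subst (seq x m ≤_) (halves q) (k m p)

  -- What is used about the reals in the statement: 𝔸 = C(r,2)^(3/2),
  -- ℤᴿ = C(r,s)^(-3/s), 𝕊 = 1/√3, ℚᴿ = 2r/3, 𝕎 δ = δ^(3/s) and 𝔾 δ = (𝔸 ℤᴿ 𝕎 δ)^(1/9).
  record Roots (r t a b : ℕ) (𝔸 ℤᴿ 𝕊 ℚᴿ : ℝ) (𝕎 𝔾 : ℝ → ℝ) : Set where
    no-eta-equality
    s : ℕ
    s = suc (suc t)
    R : ℚ
    R = ↑ (suc (suc r))
    c : ℚ
    c = ↑ a
    B : ℚ
    B = 1ℚ + c ^ 3
    C′ : ℚ
    C′ = ↑ b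
    ζ : ℕ → ℚ
    ζ = seq (frac 1 b)

    P : ℝ → ℕ → ℚ
    P = λ δ m → seq 𝔸 m * seq ℤᴿ m * seq (𝕎 δ) m

    field
      A-nonNeg : ∀ m → 0ℚ ≤ seq 𝔸 m
      A-lower  : ∀ m → c ^ 3 ≤ (seq 𝔸 m + unit m) ^ 2
      A-≤      : ∀ m → seq 𝔸 m ≤ B
      Z-nonNeg : ∀ m → 0ℚ ≤ seq ℤᴿ m
      Z-lower  : ∀ m → ζ m ^ 3 ≤ (seq ℤᴿ m + unit m) ^ suc (suc t)
      Z-≤      : ∀ m → seq ℤᴿ m ≤ 1ℚ
      S-nonNeg : ∀ m → 0ℚ ≤ seq 𝕊 m
      S-lower  : ∀ m → 1ℚ ≤ 3ℚ * ((seq 𝕊 m + unit m) * (seq 𝕊 m + unit m))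
      S-≤      : ∀ m → seq 𝕊 m ≤ + 2 / 3
      Q-value  : ∀ m → 3ℚ * seq ℚᴿ m ≡ 2ℚ * R
      W-nonNeg : ∀ δ m → 0ℚ ≤ seq (𝕎 δ) m
      W-lower  : ∀ δ m → seq δ m ^ 3 ≤ (seq (𝕎 δ) m + unit m) ^ suc (suc t)
      W-≤      : ∀ δ m {w} → 0ℚ ≤ w → seq δ m ^ 3 ≤ w ^ suc (suc t) → seq (𝕎 δ) m ≤ w
      G-nonNeg : ∀ δ m → 0ℚ ≤ seq (𝔾 δ) m
      G-lower  : ∀ δ m → P δ m ≤ (seq (𝔾 δ) m + unit m) ^ 9
      G-^-≤    : ∀ δ m → 0ℚ ≤ P δ m → seq (𝔾 δ) m ^ 9 ≤ P δ m
      G-≤      : ∀ δ m {g} → 0ℚ ≤ g → P δ m ≤ g ^ 9 → seq (𝔾 δ) m ≤ g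
      G-Close  : ∀ x y → Close x y → Close (𝔾 x) (𝔾 y)

  frac1-inverse : ∀ n m → 0 ℕ.< n → ↑ n * seq (frac 1 n) m ≡ 1ℚ
  frac1-inverse n m 0<n = trans (frac-inverse 1 n m 0<n) (↑≡# 1)

  frac1≤1 : ∀ n m → 0 ℕ.< n → seq (frac 1 n) m ≤ 1ℚ
  frac1≤1 n m 0<n = subst₂ _≤_ (ℚ.*-identityˡ (seq (frac 1 n) m)) (frac1-inverse n m 0<n)
    (*-monoʳ (seq (frac 1 n) m) (frac-nonNeg 1 n m) (1≤↑ n {{ℕ.>-nonZero 0<n}}))

  -- The error term η and its convergence to zero.

  module Constants {r t a b : ℕ} {𝔸 ℤᴿ 𝕊 ℚᴿ : ℝ} {𝕎 𝔾 : ℝ → ℝ} (roots : Roots r t a b 𝔸 ℤᴿ 𝕊 ℚᴿ 𝕎 𝔾) where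
    open Roots roots public

    K : ℚ
    K = errorRate R

    -- This is the error K τ of the stability bound with τ replaced by the exact root `𝔾 δ`, so it
    -- does not depend on G or n.
    η : ℝ → ℝ
    η δ = fromℚ K *ᴿ 𝔾 δ

    η-cong : ∀ x y → x ≈ᴿ y → η x ≈ᴿ η y
    η-cong x y x≈y = Close⇒≈ {η x} {η y} (*ᴿ-Close {fromℚ K} {fromℚ K} {𝔾 x} {𝔾 y} (Close-refl (fromℚ K)) (G-Close x y (≈⇒Close {x} {y} x≈y)))

    1≤R : 1ℚ ≤ R
    1≤R = 1≤↑ (2 ℕ.+ r)
    0<R : 0ℚ < R
    0<R = ℚ.<-≤-trans 0<1 1≤R
    0≤R = ℚ.<⇒≤ 0<R

    0≤c : 0ℚ ≤ c
    0≤c = 0≤↑ a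

    1≤B : 1ℚ ≤ B
    1≤B = p≤p+q (^-nonNeg 3 0≤c)
    0<B : 0ℚ < B
    0<B = ℚ.<-≤-trans 0<1 1≤B

    0<K : 0ℚ < K
    0<K = ℚ.<-≤-trans (ℚ.<-≤-trans 0<1 (1≤# 8)) (p≤p+q (0≤* 0≤R (0≤+ (0≤* (0≤# 2) 0≤κ) (0≤* 0≤κ 0≤κ))))
      where
      0≤κ : 0ℚ ≤ curvature R
      0≤κ = 0≤* (0≤# 112) (0≤* 0≤R 0≤R)

    -- With w = θ⁹ / B, a term of δ that is at most 1 and w^s satisfies δ³ ≤ δ ≤ w^s. Hence δ^(3/s)
    -- is at most w, and the product under the ninth root is at most B w = θ⁹.
    threshold : ∀ θ → 0ℚ < θ → ∃[ d ] 0ℚ < d × d ≤ 1ℚ × (∀ δ m → 0ℚ ≤ seq δ m → seq δ m ≤ d → seq (𝔾 δ) m ≤ θ)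
    threshold θ 0<θ = 1ℚ ⊓ w ^ s , ⊓-pos 0<1 (^-pos s 0<w) , ℚ.p⊓q≤p 1ℚ (w ^ s) , small
      where
      iB = proj₁ (inverse B 0<B)
      0<iB = proj₁ (proj₂ (inverse B 0<B))
      BiB≡1 = proj₂ (proj₂ (inverse B 0<B))
      w : ℚ
      w = iB * θ ^ 9
      0<w : 0ℚ < w
      0<w = pos*pos 0<iB (^-pos 9 0<θ)
      small : ∀ δ m → 0ℚ ≤ seq δ m → seq δ m ≤ 1ℚ ⊓ w ^ s → seq (𝔾 δ) m ≤ θ
      small δ m 0≤δ δ≤ = G-≤ δ m (ℚ.<⇒≤ 0<θ) (begin
        seq 𝔸 m * seq ℤᴿ m * seq (𝕎 δ) m
          ≤⟨ *-mono (0≤* 0≤A 0≤Z) (W-nonNeg δ m) (*-mono 0≤A 0≤Z (A-≤ m) (Z-≤ m))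
               (W-≤ δ m (ℚ.<⇒≤ 0<w) (ℚ.≤-trans (^≤self 2 0≤δ (ℚ.≤-trans δ≤ (ℚ.p⊓q≤p 1ℚ (w ^ s)))) (ℚ.≤-trans δ≤ (ℚ.p⊓q≤q 1ℚ (w ^ s))))) ⟩
        B * 1ℚ * (iB * θ ^ 9)
          ≡⟨ solve 3 (λ B i x → B :* con 1ℚ :* (i :* x) := B :* i :* x) refl B iB (θ ^ 9) ⟩
        B * iB * θ ^ 9
          ≡⟨ cong (_* θ ^ 9) BiB≡1 ⟩
        1ℚ * θ ^ 9
          ≡⟨ ℚ.*-identityˡ (θ ^ 9) ⟩
        θ ^ 9 ∎)
        where
        open ℚ.≤-Reasoning
        0≤A = A-nonNeg m
        0≤Z = Z-nonNeg m

    η-vanishes : TendsToZeroAt0⁺ η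
    η-vanishes ε (e , 0<e , N₀ , e≤ε) = choose (inverse K 0<K)
      where
      choose : (∃[ i ] 0ℚ < i × K * i ≡ 1ℚ) → ∃[ δ₁ ] 0ᴿ <ᴿ δ₁ × (∀ δ → 0ᴿ <ᴿ δ → δ ≤ᴿ δ₁ → ∣ η δ ∣ᴿ ≤ᴿ ε)
      choose (i , 0<i , Ki≡1) =
        let d , 0<d , _ , small = threshold (i * e) (pos*pos 0<i 0<e)
        in fromℚ (½ * d) , 0ᴿ<fromℚ (half-pos 0<d) , λ δ 0<δ δ≤ ε′ 0<ε′ →
          let N₁ , 0≤δ = 0ᴿ<⇒nonNeg {δ} 0<δ
              N₂ , δ≤d = ≤fromℚ-half {δ} 0<d δ≤
          in N₀ ℕ.⊔ (N₁ ℕ.⊔ N₂) , λ m p →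
            let p′ = ℕ.m⊔n≤o⇒n≤o N₀ (N₁ ℕ.⊔ N₂) p
            in bound δ m (small δ m (0≤δ m (ℕ.m⊔n≤o⇒m≤o N₁ N₂ p′)) (δ≤d m (ℕ.m⊔n≤o⇒n≤o N₁ N₂ p′)))
                 (e≤ε m (ℕ.m⊔n≤o⇒m≤o N₀ (N₁ ℕ.⊔ N₂) p)) 0<ε′
        where
        open ℚ.≤-Reasoning
        bound : ∀ δ m {x ε′} → seq (𝔾 δ) m ≤ i * e → 0ℚ + e ≤ x → 0ℚ < ε′ → ℚ.∣ K * seq (𝔾 δ) m ∣ ≤ x + ε′
        bound δ m {x} {ε′} g≤ e≤x 0<ε′ = begin
          ℚ.∣ K * seq (𝔾 δ) m ∣   ≡⟨ ℚ.0≤p⇒∣p∣≡p (0≤* (ℚ.<⇒≤ 0<K) (G-nonNeg δ m)) ⟩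
          K * seq (𝔾 δ) m         ≤⟨ *-monoˡ K (ℚ.<⇒≤ 0<K) g≤ ⟩
          K * (i * e)             ≡⟨ ℚ.*-assoc K i e ⟨
          K * i * e               ≡⟨ cong (_* e) Ki≡1 ⟩
          1ℚ * e                  ≡⟨ trans (ℚ.*-identityˡ e) (sym (ℚ.+-identityˡ e)) ⟩
          0ℚ + e                  ≤⟨ e≤x ⟩
          x                       ≤⟨ p≤p+q (ℚ.<⇒≤ 0<ε′) ⟩
          x + ε′                  ∎

  -- The choice of δ₀ and of the rounding errors.

  1^≡1 : ∀ k → 1ℚ ^ k ≡ 1ℚ
  1^≡1 k = ℚ.≤-antisym (^≤1 k 0≤1 ℚ.≤-refl) (1≤^ k ℚ.≤-refl)

  -- The slack ε that `≤ᴿ` leaves in the clique count is absorbed into δ, which is possible because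
  -- y = N^s is at least 1.
  deficit-split : ∀ {x δ ε k y} → 0ℚ ≤ ε → 1ℚ ≤ y → x + - (δ * y) ≤ k + ε → x ≤ k + (δ + ε) * y
  deficit-split {x} {δ} {ε} {k} {y} 0≤ε 1≤y h = ≤-by ((k + ε - (x + - (δ * y))) + ε * (y - 1ℚ))
    (0≤+ (0≤- h) (0≤* 0≤ε (0≤- 1≤y)))
    (solve 5 (λ x δ ε k y → k :+ (δ :+ ε) :* y := x :+ ((k :+ ε :- (x :+ :- (δ :* y))) :+ ε :* (y :- con 1ℚ))) refl x δ ε k y)

  module Assembly {r t : ℕ} (s≤r : suc (suc t) ℕ.≤ suc (suc r)) {𝔸 ℤᴿ 𝕊 ℚᴿ : ℝ} {𝕎 𝔾 : ℝ → ℝ} (roots : Roots r t (suc (suc r) C 2) (suc (suc r) C suc (suc t)) 𝔸 ℤᴿ 𝕊 ℚᴿ 𝕎 𝔾) where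
    open Constants roots

    private
      iR = proj₁ (inverse R 0<R)
      0<iR : 0ℚ < iR
      0<iR = proj₁ (proj₂ (inverse R 0<R))
      0≤iR = ℚ.<⇒≤ 0<iR
      RiR≡1 : R * iR ≡ 1ℚ
      RiR≡1 = proj₂ (proj₂ (inverse R 0<R))

      iR≤1 : iR ≤ 1ℚ
      iR≤1 = subst₂ _≤_ (ℚ.*-identityˡ iR) RiR≡1 (*-monoʳ iR 0≤iR 1≤R)

      θ : ℚ
      -- With ν ≤ 1 / (40 R) below, this gives 10 R (θ + 2 ν) ≤ 1, the smallness of τ required by
      -- `Estimates`.
      θ = (+ 1 / 20) * iR
      0<θ : 0ℚ < θ
      0<θ = pos*pos (ℚ.positive⁻¹ (+ 1 / 20)) 0<iR

      d = proj₁ (threshold θ 0<θ)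
      0<d : 0ℚ < d
      0<d = proj₁ (proj₂ (threshold θ 0<θ))
      𝔾≤θ : ∀ δ m → 0ℚ ≤ seq δ m → seq δ m ≤ d → seq (𝔾 δ) m ≤ θ
      𝔾≤θ = proj₂ (proj₂ (proj₂ (threshold θ 0<θ)))

      half : ℚ
      -- δ and the slack ε′ each receive half of R^(-s), so that R^s ζ (δ + ε′) ≤ 1 by ζ ≤ 1.
      half = ½ * iR ^ s
      0<half : 0ℚ < half
      0<half = half-pos (^-pos s 0<iR)

      d₁ : ℚ
      d₁ = d ⊓ half
      0<d₁ : 0ℚ < d₁
      0<d₁ = ⊓-pos 0<d 0<half

    δ₀ : ℝ
    δ₀ = fromℚ (½ * d₁)

    0<δ₀ : 0ᴿ <ᴿ δ₀
    0<δ₀ = 0ᴿ<fromℚ (half-pos 0<d₁)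

    private
      target-seq : ∀ δ n m → (seq ℚᴿ m * seq 𝕊 m + K * seq (𝔾 δ) m) * (seq 𝔸 m * seq ℤᴿ m * seq (𝕎 δ) m) * (↑ n * ↑ n) ≡ seq ((ℚᴿ *ᴿ 𝕊 +ᴿ η δ) *ᴿ (𝔸 *ᴿ ℤᴿ) *ᴿ 𝕎 δ *ᴿ fromℕ n ^ᴿ 2) m
      target-seq δ n m = trans (cong (λ z → (seq ℚᴿ m * seq 𝕊 m + K * seq (𝔾 δ) m) * (seq 𝔸 m * seq ℤᴿ m * seq (𝕎 δ) m) * (z * z)) (↑≡# n))
        (solve 5 (λ x a z w n → x :* (a :* z :* w) :* (n :* n) := x :* (a :* z) :* w :* (n :* (n :* con 1ℚ))) refl
          (seq ℚᴿ m * seq 𝕊 m + K * seq (𝔾 δ) m) (seq 𝔸 m) (seq ℤᴿ m) (seq (𝕎 δ) m) (# n))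

    theorem : (n : ℕ) → 1 ℕ.≤ n → (δ : ℝ) → 0ᴿ <ᴿ δ → δ ≤ᴿ δ₀ → (G : Graph n) → CliqueFree G (suc (suc (suc r))) →
      fromℕ (suc (suc r) C suc (suc t)) *ᴿ frac n (suc (suc r)) ^ᴿ suc (suc t) -ᴿ δ *ᴿ fromℕ n ^ᴿ suc (suc t) ≤ᴿ fromℕ (cliqueCount G (suc (suc t))) →
      fromℕ (D (suc (suc r)) G) ≤ᴿ (ℚᴿ *ᴿ 𝕊 +ᴿ η δ) *ᴿ (𝔸 *ᴿ ℤᴿ) *ᴿ 𝕎 δ *ᴿ fromℕ n ^ᴿ 2
    theorem (suc n) _ δ 0<δ δ≤δ₀ G free many ε 0<ε =
      N₁ ℕ.⊔ (N₂ ℕ.⊔ (N₃ ℕ.⊔ ℚ.↧ₙ ω)) , λ m p →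
        let p′ = ℕ.m⊔n≤o⇒n≤o N₁ (N₂ ℕ.⊔ (N₃ ℕ.⊔ ℚ.↧ₙ ω)) p
            p″ = ℕ.m⊔n≤o⇒n≤o N₂ (N₃ ℕ.⊔ ℚ.↧ₙ ω) p′
        in index m (proj₂ positive m (ℕ.m⊔n≤o⇒m≤o N₁ (N₂ ℕ.⊔ (N₃ ℕ.⊔ ℚ.↧ₙ ω)) p))
             (proj₂ small m (ℕ.m⊔n≤o⇒m≤o N₂ (N₃ ℕ.⊔ ℚ.↧ₙ ω) p′))
             (unit≤ ω 0<ω m (ℕ.m⊔n≤o⇒n≤o N₃ (ℚ.↧ₙ ω) p″))
             (proj₂ dense m (ℕ.m⊔n≤o⇒m≤o N₃ (ℚ.↧ₙ ω) p″))
      where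
      N M L : ℚ
      N = ↑ (suc n)
      M = N * N
      L = # 20 * (R + K) * M
      1≤N : 1ℚ ≤ N
      1≤N = 1≤↑ (suc n)
      0<L : 0ℚ < L
      0<L = pos*pos (pos*pos (ℚ.<-≤-trans 0<1 (1≤# 20)) (ℚ.<-≤-trans 0<R (p≤p+q (ℚ.<⇒≤ 0<K)))) (pos*pos 0<N 0<N)
        where 0<N = ℚ.<-≤-trans 0<1 1≤N
      iL = proj₁ (inverse L 0<L)
      0<iL = proj₁ (proj₂ (inverse L 0<L))
      LiL≡1 = proj₂ (proj₂ (inverse L 0<L))

      ν : ℚ
      -- The second bound makes the total rounding error L ν at most ε. It may depend on n, which is
      -- fixed here.
      ν = ((+ 1 / 40) * iR) ⊓ (iL * ε)
      0<ν : 0ℚ < ν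
      0<ν = ⊓-pos (pos*pos (ℚ.positive⁻¹ (+ 1 / 40)) 0<iR) (pos*pos 0<iL 0<ε)
      0≤ν = ℚ.<⇒≤ 0<ν
      ν≤iR : ν ≤ (+ 1 / 40) * iR
      ν≤iR = ℚ.p⊓q≤p ((+ 1 / 40) * iR) (iL * ε)
      ν≤1/40 : ν ≤ + 1 / 40
      ν≤1/40 = ℚ.≤-trans ν≤iR (ℚ.≤-trans (*-monoˡ (+ 1 / 40) (0≤/ 1 39) iR≤1) (ℚ.≤-reflexive (ℚ.*-identityʳ (+ 1 / 40))))
      ν≤1 : ν ≤ 1ℚ
      ν≤1 = ℚ.≤-trans ν≤1/40 (from-yes ((+ 1 / 40) ℚ.≤? 1ℚ))

      Lν≤ε : L * ν ≤ ε
      Lν≤ε = subst (L * ν ≤_) (trans (sym (ℚ.*-assoc L iL ε)) (trans (cong (_* ε) LiL≡1) (ℚ.*-identityˡ ε)))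
        (*-monoˡ L (ℚ.<⇒≤ 0<L) (ℚ.p⊓q≤q ((+ 1 / 40) * iR) (iL * ε)))

      0<14B : 0ℚ < # 14 * B
      0<14B = pos*pos (ℚ.<-≤-trans 0<1 (1≤# 14)) 0<B
      1≤14B : 1ℚ ≤ # 14 * B
      1≤14B = ℚ.≤-trans 1≤B (subst (_≤ # 14 * B) (ℚ.*-identityˡ B) (*-monoʳ B (ℚ.<⇒≤ 0<B) (1≤# 14)))
      i = proj₁ (inverse (# 14 * B) 0<14B)
      0<i = proj₁ (proj₂ (inverse (# 14 * B) 0<14B))
      14Bi≡1 = proj₂ (proj₂ (inverse (# 14 * B) 0<14B))
      i≤1 : i ≤ 1ℚ
      i≤1 = subst₂ _≤_ (ℚ.*-identityˡ i) 14Bi≡1 (*-monoʳ i (ℚ.<⇒≤ 0<i) 1≤14B)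

      ω : ℚ
      -- i is 1 / (14 B), where 14 B is the factor 7 B of `product-bump` applied to the rounding 2
      -- ω.
      ω = i * ν ^ 9
      0<ω : 0ℚ < ω
      0<ω = pos*pos 0<i (^-pos 9 0<ν)
      ω≤ν : ω ≤ ν
      ω≤ν = ℚ.≤-trans (*-monoʳ (ν ^ 9) (^-nonNeg 9 0≤ν) i≤1) (ℚ.≤-trans (ℚ.≤-reflexive (ℚ.*-identityˡ (ν ^ 9))) (^≤self 8 0≤ν ν≤1))
      2ω≤1 : 2ℚ * ω ≤ 1ℚ
      2ω≤1 = ℚ.≤-trans (*-monoˡ 2ℚ (0≤# 2) (ℚ.≤-trans ω≤ν ν≤1/40)) (from-yes ((2ℚ * (+ 1 / 40)) ℚ.≤? 1ℚ))
      ω-small : # 7 * B * (2ℚ * ω) ≤ ν ^ 9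
      ω-small = ℚ.≤-reflexive (trans (solve 3 (λ B i x → con (# 7) :* B :* (con 2ℚ :* (i :* x)) := con (# 14) :* B :* i :* x) refl B i (ν ^ 9))
        (trans (cong (_* ν ^ 9) 14Bi≡1) (ℚ.*-identityˡ (ν ^ 9))))

      ε′ : ℚ
      -- One third, because the cube of a number in the unit interval grows by at most 3 ε′.
      ε′ = ((+ 1 / 3) * ω ^ s) ⊓ half
      0<ε′ : 0ℚ < ε′
      0<ε′ = ⊓-pos (pos*pos (ℚ.positive⁻¹ (+ 1 / 3)) (^-pos s 0<ω)) 0<half
      0≤ε′ = ℚ.<⇒≤ 0<ε′
      ε-small : 3ℚ * ε′ ≤ ω ^ s
      ε-small = subst (3ℚ * ε′ ≤_) (solve 1 (λ x → con 3ℚ :* (con (+ 1 / 3) :* x) := x) refl (ω ^ s))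
        (*-monoˡ 3ℚ (0≤# 3) (ℚ.p⊓q≤p ((+ 1 / 3) * ω ^ s) half))

      positive = 0ᴿ<⇒nonNeg {δ} 0<δ
      small = ≤fromℚ-half {δ} 0<d₁ δ≤δ₀
      dense = many ε′ 0<ε′
      N₁ = proj₁ positive
      N₂ = proj₁ small
      N₃ = proj₁ dense

      index : ∀ m → 0ℚ ≤ seq δ m → seq δ m ≤ d₁ → unit m ≤ ω →
        # (suc (suc r) C suc (suc t)) * seq (frac (suc n) (suc (suc r)) ^ᴿ suc (suc t)) m + - (seq δ m * seq (fromℕ (suc n) ^ᴿ suc (suc t)) m) ≤ # (cliqueCount G (suc (suc t))) + ε′ →
        # (D (suc (suc r)) G) ≤ seq ((ℚᴿ *ᴿ 𝕊 +ᴿ η δ) *ᴿ (𝔸 *ᴿ ℤᴿ) *ᴿ 𝕎 δ *ᴿ fromℕ (suc n) ^ᴿ 2) m + ε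
      index m 0≤δ δ≤d₁ u≤ω dense = subst₂ _≤_ (↑≡# (D (suc (suc r)) G)) (cong (_+ ε) (target-seq δ (suc n) m))
        (ℚ.≤-trans bound (ℚ.+-monoʳ-≤ ((seq ℚᴿ m * seq 𝕊 m + K * seq (𝔾 δ) m) * (seq 𝔸 m * seq ℤᴿ m * seq (𝕎 δ) m) * (N * N)) Lν≤ε))
        where
        0<rCs : 0 ℕ.< suc (suc r) C suc (suc t)
        0<rCs = 0<nCk s≤r
        ρ δ′ u : ℚ
        ρ = seq (frac (suc n) (suc (suc r))) m
        δ′ = seq δ m + ε′
        u = unit m
        δ′≤ : δ′ ≤ iR ^ s
        δ′≤ = subst (δ′ ≤_) (halves (iR ^ s)) (ℚ.+-mono-≤ (ℚ.≤-trans δ≤d₁ (ℚ.p⊓q≤q d half)) (ℚ.p⊓q≤q ((+ 1 / 3) * ω ^ s) half))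
        0≤δ′ : 0ℚ ≤ δ′
        0≤δ′ = 0≤+ 0≤δ 0≤ε′
        δ-small : R ^ s * (ζ m * δ′) ≤ 1ℚ
        δ-small = ℚ.≤-trans (*-monoˡ (R ^ s) (^-nonNeg s 0≤R) (ℚ.≤-trans (*-monoʳ δ′ 0≤δ′ (frac1≤1 (suc (suc r) C suc (suc t)) m 0<rCs)) (ℚ.≤-trans (ℚ.≤-reflexive (ℚ.*-identityˡ δ′)) δ′≤)))
          (ℚ.≤-reflexive (trans (sym (^-distrib-* R iR s)) (trans (cong (_^ s) RiR≡1) (1^≡1 s))))
        τ-small : # 10 * (R * (seq (𝔾 δ) m + 2ℚ * ν)) ≤ 1ℚ
        τ-small = ℚ.≤-trans (*-monoˡ (# 10) (0≤# 10) (*-monoˡ R 0≤R (ℚ.+-mono-≤ (𝔾≤θ δ m 0≤δ (ℚ.≤-trans δ≤d₁ (ℚ.p⊓q≤p d half))) (*-monoˡ 2ℚ (0≤# 2) ν≤iR))))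
          (ℚ.≤-reflexive (trans (solve 2 (λ R x → con (# 10) :* (R :* (con (+ 1 / 20) :* x :+ con 2ℚ :* (con (+ 1 / 40) :* x))) := R :* x) refl R iR) RiR≡1))
        dense′ : C′ * ρ ^ s ≤ ↑ cliqueCount G (suc (suc t)) + δ′ * N ^ s
        dense′ = deficit-split {C′ * ρ ^ s} {seq δ m} {ε′} {↑ cliqueCount G (suc (suc t))} {N ^ s} 0≤ε′ (1≤^ s 1≤N) (subst₂ _≤_
          (cong₂ (λ x y → x + - (seq δ m * y)) (cong₂ _*_ (sym (↑≡# (suc (suc r) C suc (suc t)))) (seq-^ᴿ (frac (suc n) (suc (suc r))) (suc (suc t)) m))
            (trans (seq-^ᴿ (fromℕ (suc n)) (suc (suc t)) m) (cong (_^ s) (sym (↑≡# (suc n))))))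
          (cong (_+ ε′) (sym (↑≡# (cliqueCount G (suc (suc t)))))) dense)
        bound = Bound.bound {n} {r} t s≤r G free {ζ m} {ρ} {seq ℚᴿ m} {seq 𝔸 m} {seq ℤᴿ m} {seq (𝕎 δ) m} {seq (𝔾 δ) m} {seq 𝕊 m} {u} {seq δ m} {ε′} {ν} {ω} {B}
          (frac-nonNeg 1 (suc (suc r) C suc (suc t)) m) (frac1-inverse (suc (suc r) C suc (suc t)) m 0<rCs) (frac-inverse (suc n) (suc (suc r)) m (ℕ.s≤s ℕ.z≤n)) (Q-value m)
          (A-nonNeg m) (Z-nonNeg m) (W-nonNeg δ m) (G-nonNeg δ m) (S-nonNeg m) (0≤/ 1 m) 0≤δ 0≤ε′ 0<ν
          (A-lower m) (Z-lower m) (W-lower δ m) (G-lower δ m) (G-^-≤ δ m (0≤* (0≤* (A-nonNeg m) (Z-nonNeg m)) (W-nonNeg δ m)))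
          (S-lower m) (ℚ.+-mono-≤ (S-≤ m) (ℚ.≤-trans (ℚ.≤-trans u≤ω (ℚ.≤-trans ω≤ν ν≤1/40)) (from-yes ((+ 1 / 40) ℚ.≤? (+ 1 / 3)))))
          (A-≤ m) (Z-≤ m) (W-≤ δ m 0≤1 (ℚ.≤-trans (^≤1 3 0≤δ (ℚ.≤-trans (p≤p+q 0≤ε′) (ℚ.≤-trans δ′≤ (^≤1 s 0≤iR iR≤1)))) (1≤^ s ℚ.≤-refl))) 1≤B
          u≤ω ω≤ν 2ω≤1 ω-small ε-small (ℚ.≤-trans δ′≤ (^≤1 s 0≤iR iR≤1)) δ-small τ-small dense′

  -- The roots that occur in the theorem.

  module _ (r t a b : ℕ) (0<b : 0 ℕ.< b) where

    roots : Roots r t a b (fromℕ a ^ᴿ[ 3 / 2 ]) (frac 1 b ^ᴿ[ 3 / suc (suc t) ]) (frac 1 3 ^ᴿ[ 1 / 2 ]) (frac (2 ℕ.* suc (suc r)) 3)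
      (λ δ → δ ^ᴿ[ 3 / suc (suc t) ]) (λ δ → root 8 (fromℕ a ^ᴿ[ 3 / 2 ] *ᴿ frac 1 b ^ᴿ[ 3 / suc (suc t) ] *ᴿ δ ^ᴿ[ 3 / suc (suc t) ]))
    roots = record
      { A-nonNeg = λ m → pow-nonNeg (fromℕ a) 3 2 m
      ; A-lower  = λ m → pow-upper-fromℕ a 3 2 m
      ; A-≤      = λ m → pow-≤-fromℕ a 3 2 m (ℚ.≤-trans 0≤1 1≤B) (ℚ.≤-trans (q≤p+q 0≤1) (a≤^ 1 1≤B))
      ; Z-nonNeg = λ m → pow-nonNeg (frac 1 b) 3 (suc (suc t)) m
      ; Z-lower  = λ m → pow-upper (frac 1 b) 3 (suc (suc t)) m
      ; Z-≤      = λ m → pow-≤ (frac 1 b) 3 (suc (suc t)) m 0≤1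
          (ℚ.≤-trans (^≤1 3 (frac-nonNeg 1 b m) (frac1≤1 b m 0<b)) (1≤^ (suc (suc t)) ℚ.≤-refl))
      ; S-nonNeg = λ m → pow-nonNeg (frac 1 3) 1 2 m
      ; S-lower  = λ m → third {seq (frac 1 3 ^ᴿ[ 1 / 2 ]) m + unit m} (pow-upper (frac 1 3) 1 2 m)
      -- 2/3 exceeds 1/√3 and leaves 1/3 for the rounding, so that S + u ≤ 1.
      ; S-≤      = λ m → pow-≤ (frac 1 3) 1 2 m (0≤/ 2 2) (from-yes (((+ 1 / 3) ^ 1) ℚ.≤? ((+ 2 / 3) ^ 2)))
      ; Q-value  = λ m → trans (cong (_* seq (frac (2 ℕ.* suc (suc r)) 3) m) (sym (↑≡# 3)))
          (trans (frac-inverse (2 ℕ.* suc (suc r)) 3 m (ℕ.s≤s ℕ.z≤n)) (↑* {2} (↑≡# 2) refl))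
      ; W-nonNeg = λ δ m → pow-nonNeg δ 3 (suc (suc t)) m
      ; W-lower  = λ δ m → pow-upper δ 3 (suc (suc t)) m
      ; W-≤      = λ δ m → pow-≤ δ 3 (suc (suc t)) m
      ; G-nonNeg = λ δ → root-nonNeg 8 (fromℕ a ^ᴿ[ 3 / 2 ] *ᴿ frac 1 b ^ᴿ[ 3 / suc (suc t) ] *ᴿ δ ^ᴿ[ 3 / suc (suc t) ])
      ; G-lower  = λ δ m → root-product-upper (fromℕ a ^ᴿ[ 3 / 2 ]) (frac 1 b ^ᴿ[ 3 / suc (suc t) ]) (δ ^ᴿ[ 3 / suc (suc t) ]) 8 m {9} refl
      ; G-^-≤    = λ δ m → root-product-^-≤ (fromℕ a ^ᴿ[ 3 / 2 ]) (frac 1 b ^ᴿ[ 3 / suc (suc t) ]) (δ ^ᴿ[ 3 / suc (suc t) ]) 8 m {9} refl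
      ; G-≤      = λ δ m → root-product-≤ (fromℕ a ^ᴿ[ 3 / 2 ]) (frac 1 b ^ᴿ[ 3 / suc (suc t) ]) (δ ^ᴿ[ 3 / suc (suc t) ]) 8 m {9} refl
      ; G-Close  = λ x y close → root-product-Close {fromℕ a ^ᴿ[ 3 / 2 ] *ᴿ frac 1 b ^ᴿ[ 3 / suc (suc t) ]} {x ^ᴿ[ 3 / suc (suc t) ]} {y ^ᴿ[ 3 / suc (suc t) ]} 8 (pow-Close {x} {y} 3 (suc (suc t)) close)
      }
      where
      1≤B : 1ℚ ≤ 1ℚ + ↑ a ^ 3
      1≤B = p≤p+q (^-nonNeg 3 (0≤↑ a))
      third : ∀ {x} → (+ 1 / 3) ^ 1 ≤ x ^ 2 → 1ℚ ≤ 3ℚ * (x * x)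
      third {x} h = subst₂ _≤_ refl (solve 1 (λ x → con 3ℚ :* (x :* (x :* con 1ℚ)) := con 3ℚ :* (x :* x)) refl x) (*-monoˡ 3ℚ (0≤# 3) h)

open import Data.Nat using (_*_; _≤_)
open Combinatorics using (0<nCk)
open Reals using (roots; module Constants; module Assembly)

theorem3p6 : (r s : ℕ) → 2 ≤ r → 2 ≤ s → s ≤ r →
    Σ[ δ₀ ∈ ℝ ] 0ᴿ <ᴿ δ₀ × (Σ[ n₀ ∈ ℕ ] Σ[ η ∈ (ℝ → ℝ) ]
    (∀ x y → x ≈ᴿ y → η x ≈ᴿ η y) × TendsToZeroAt0⁺ η ×
    ((n : ℕ) → n₀ ≤ n → (δ : ℝ) → 0ᴿ <ᴿ δ → δ ≤ᴿ δ₀ →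
    (G : Graph n) → CliqueFree G (suc r) →
    fromℕ (r C s) *ᴿ frac n r ^ᴿ s -ᴿ δ *ᴿ fromℕ n ^ᴿ s ≤ᴿ fromℕ (cliqueCount G s) →
    fromℕ (D r G) ≤ᴿ
    (frac (2 * r) 3 *ᴿ frac 1 3 ^ᴿ[ 1 / 2 ] +ᴿ η δ)
    *ᴿ (fromℕ (r C 2) ^ᴿ[ 3 / 2 ] *ᴿ frac 1 (r C s) ^ᴿ[ 3 / s ])
    *ᴿ δ ^ᴿ[ 3 / s ] *ᴿ fromℕ n ^ᴿ 2))
theorem3p6 (suc (suc r)) (suc (suc t)) (ℕ.s≤s (ℕ.s≤s ℕ.z≤n)) (ℕ.s≤s (ℕ.s≤s ℕ.z≤n)) s≤r =
  -- n₀ is 1 because a vertex is needed to divide by n and to start the search for the largest inner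
  -- degree.
  Assembly.δ₀ s≤r rs , Assembly.0<δ₀ s≤r rs , 1 , Constants.η rs , Constants.η-cong rs , Constants.η-vanishes rs , Assembly.theorem s≤r rs
  where
  rs = roots r t (suc (suc r) C 2) (suc (suc r) C suc (suc t)) (0<nCk s≤r)
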